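{- Let $n$ be a positive integer and let $\kappa_{D_n}(q)$ denote the unicellular LLT cumulant of the sequence of $n$ single cells, as defined in the context. Then \[ \kappa_{D_n}(q)\;=\;\sum_{T}\mathrm{LLT}(\nu(T))\;=\;\sum_{f\in PF_{n-1}}\mathrm{LLT}(\mu(f)), \] where the first sum runs over all labeled trees $T$ on the vertex set $[n]=\{1,\dots,n\}$ (Cayley trees), and the second sum runs over all parking functions $f$ on $n-1$ cars.
   Context: Throughout, $q$ is a formal parameter and $x_1,x_2,\dots$ are commuting variables; all functions below take values in $\mathbb{N}_+=\{1,2,\dots\}$. LLT polynomials of vertical strips. A vertical strip is a single column of $\ell\ge1$ cells whose contents are consecutive integers $c,c+1,\dots,c+\ell-1$ read from top to bottom. For a sequence $\nu=(\nu_1,\dots,\nu_k)$ of vertical strips, a cell $\alpha$ of $\nu_m$ with content $c(\alpha)$ has shifted content $\tilde c(\alpha)=k\,c(\alpha)+m$. A filling $\mathcal T$ of the cells of $\nu$ by positive integers is admissible if within each strip the entries strictly decrease from top to bottom (the cell of content $c$ has a larger entry than the cell of content $c+1$ in the same strip). Set $\mathrm{inv}(\mathcal T)=\#\{(\alpha,\beta): 0<\tilde c(\beta)-\tilde c(\alpha)<k,\ \mathcal T(\alpha)>\mathcal T(\beta)\}$ and $\mathrm{LLT}(\nu)=\sum_{\mathcal T} q^{\mathrm{inv}(\mathcal T)}\prod_{\alpha}x_{\mathcal T(\alpha)}$, the sum over admissible fillings. The cumulant. For a nonempty $B\subseteq[n]$ put $\mathrm{LLT}(B)=\sum_{g:B\to\mathbb{N}_+}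 q^{\#\{(a,b)\in B^2:\,a<b,\ g(a)>g(b)\}}\prod_{a\in B}x_{g(a)}$ (the LLT polynomial of $|B|$ single cells all of content $0$, ordered as in $B$). Define $\kappa(B)$ for all nonempty $B\subseteq[n]$ recursively by $\mathrm{LLT}(B)=\sum_{\pi}(q-1)^{|B|-|\pi|}\prod_{C\in\pi}\kappa(C)$, the sum over all set partitions $\pi$ of $B$ ($|\pi|$ = number of blocks); this determines each $\kappa(B)$ uniquely. Then $\kappa_{D_n}(q):=\kappa([n])$. Shapes of trees. For a tree $T$ on $[n]$, root it at $1$. Form the first strip by starting at $1$ and repeatedly moving to the child with the smallest label until reaching a leaf; the visited vertices, in order, are the cells of $\nu_1$ from top to bottom. Then backtrack along previously visited vertices to the most recently visited vertex that still has unvisited children, take its unvisited child with the smallest label, and form the next strip starting at that child by the same rule. Repeat until all vertices are visited, obtaining strips $\nu_1,\dots,\nu_k$ in this order. The cell of vertex $v$ is given content equal to the distance from $v$ to $1$ in $T$. This sequence of vertical strips is $\nu(T)$. Schröder paths. A Schröder path of length $n$ is a lattice path from $(0,0)$ to $(n,n)$ with steps $n=(0,1)$, $e=(1,0)$, $d=(1,1)$, never going below the line $y=x$ and with no $d$ step on that line. The box $(i,j)$ is the unit square with lower-left corner $(i-1,j-1)$; a $d$ step from $(i-1,j-1)$ to $(i,j)$ is said to lie in box $(i,j)$. For such a path $P$ (with box $(i,i)$ labeled $i$), $\mu(P)$ is the associated sequence of vertical strips, whose LLT polynomial is \[\mathrm{LLT}(\mu(P))=\sum_{g:[n]\to\mathbb{N}_+}\Big[\,g(i)>g(j)\text{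 for every box }(i,j)\text{ containing a }d\text{ step of }P\Big]\; q^{\#\{(i,j):\,i<j,\ \text{box }(i,j)\text{ lies weakly below }P,\ g(i)>g(j)\}}\prod_{i=1}^n x_{g(i)}.\] Parking functions. A parking function on $n-1$ cars is a map $f:[n-1]\to[n-1]$ with $|f^{ -1}([i])|\ge i$ for $1\le i\le n-1$; $PF_{n-1}$ is the set of them. Let $D_f$ be the path from $(1,1)$ to $(n,n)$ which, for $i=1,\dots,n-1$, takes $|f^{ -1}(i)|$ north steps followed by one east step. Let $P_f$ be the Schröder path of length $n$ obtained from the path $n\,e\,D_f$ (from $(0,0)$ to $(n,n)$) by replacing every consecutive pair of steps $e\,n$ by a single step $d$. Set $\mu(f):=\mu(P_f)$. -}

module Defs where

open import Level using (Level)
open import Data.Nat as ℕ using (ℕ; zero; suc; _∸_; _<ᵇ_; _≡ᵇ_; _≤ᵇ_)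
open import Data.Bool using (Bool; true; false; _∧_; _∨_; not; if_then_else_)
open import Data.List using (List; []; _∷_; [_]; _++_; map; concatMap; foldr; filterᵇ; length; upTo; allFin; zip; replicate)
open import Data.Bool.ListAction using (any; all)
open import Data.Fin as Fin using (Fin; toℕ)
open import Data.Product using (_×_; _,_; proj₁; proj₂)
open import Data.Maybe using (Maybe; just; nothing)
open import Data.Vec as Vec using (Vec)
open import Data.Fin.Subset using (Subset; Nonempty)
open import Relation.Nullary.Decidable using (does)
open import Algebra.Bundles using (CommutativeRing)

allFuns : (N L : ℕ) → List (List (Fin N))
allFuns N zero    = [ [] ]
allFuns N (suc L) = concatMap (λ a → map (a ∷_) (allFuns N L)) (allFin N)

sublists : {A : Set} → List A → List (List A)
sublists []       = [ [] ]
sublists (a ∷ as) = let r = sublists as in r ++ map (a ∷_) r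

count : {A : Set} → (A → Bool) → List A → ℕ
count p xs = length (filterᵇ p xs)

nth : List ℕ → ℕ → ℕ
nth []       _       = 0
nth (a ∷ _)  zero    = a
nth (_ ∷ as) (suc i) = nth as i

indexed : {A : Set} → List A → List (ℕ × A)
indexed xs = zip (upTo (length xs)) xs

_=ᶠ_ : {n : ℕ} → Fin n → Fin n → Bool
i =ᶠ j = does (i Fin.≟ j)

insertEach : {A : Set} → A → List (List A) → List (List (List A))
insertEach x []       = []
insertEach x (b ∷ bs) = ((x ∷ b) ∷ bs) ∷ map (b ∷_) (insertEach x bs)

setPartitions : {A : Set} → List A → List (List (List A))
setPartitions []       = [ [] ]
setPartitions (x ∷ xs) =
  concatMap (λ p → ([ x ] ∷ p) ∷ insertEach x p) (setPartitions xs)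

elems : {n : ℕ} → Subset n → List (Fin n)
elems {n} B = filterᵇ (λ i → Vec.lookup B i) (allFin n)

toSubset : {n : ℕ} → List (Fin n) → Subset n
toSubset C = Vec.tabulate (λ i → any (λ j → i =ᶠ j) C)

invList : List ℕ → ℕ
invList []       = 0
invList (a ∷ as) = count (λ b → b <ᵇ a) as ℕ.+ invList as

-- Vertical strips: content of the top cell, number of cells (≥ 1)

record VStrip : Set where
  constructor strip
  field
    content : ℕ
    len     : ℕ
open VStrip public

-- cells of ν = (ν₁,…,ν_k): (strip index m (1-based), shifted content k·c+m),
-- listed strip by strip, each strip from top to bottom
stripCells : (k m : ℕ) → VStrip → List (ℕ × ℕ)
stripCells k m s = map (λ j → (m , k ℕ.* (content s ℕ.+ j) ℕ.+ m)) (upTo (len s))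

cellsFrom : (k m : ℕ) → List VStrip → List (ℕ × ℕ)
cellsFrom k m []       = []
cellsFrom k m (s ∷ ss) = stripCells k m s ++ cellsFrom k (suc m) ss

cellsOf : List VStrip → List (ℕ × ℕ)
cellsOf ν = cellsFrom (length ν) 1 ν

-- a filled cell: (strip index, shifted content, entry)
FCell : Set
FCell = ℕ × ℕ × ℕ

admissible : List FCell → Bool
admissible []                   = true
admissible (a ∷ [])             = true
admissible ((m , _ , u) ∷ (m' , s' , v) ∷ cs) =
  ((not (m ≡ᵇ m')) ∨ (v <ᵇ u)) ∧ admissible ((m' , s' , v) ∷ cs)

invF : ℕ → List FCell → ℕ
invF k cs = length (concatMap (λ α → filterᵇ (λ β →
     (proj₁ (proj₂ α) <ᵇ proj₁ (proj₂ β))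
   ∧ (proj₁ (proj₂ β) <ᵇ proj₁ (proj₂ α) ℕ.+ k)
   ∧ (proj₂ (proj₂ β) <ᵇ proj₂ (proj₂ α))) cs) cs)

fill : {N : ℕ} → List (ℕ × ℕ) → List (Fin N) → List FCell
fill cs g = map (λ p → (proj₁ (proj₁ p) , proj₂ (proj₁ p) , toℕ (proj₂ p))) (zip cs g)

pairs : (n : ℕ) → List (Fin n × Fin n)
pairs n = concatMap (λ i → map (i ,_) (filterᵇ (λ j → toℕ i <ᵇ toℕ j) (allFin n))) (allFin n)

Edges : ℕ → Set
Edges n = List (Fin n × Fin n)

adj : {n : ℕ} → Edges n → Fin n → Fin n → Bool
adj E u v = any (λ e → ((proj₁ e =ᶠ u) ∧ (proj₂ e =ᶠ v)) ∨ ((proj₁ e =ᶠ v) ∧ (proj₂ e =ᶠ u))) E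

reach : {n : ℕ} → Edges n → ℕ → Fin n → Fin n → Bool
reach E zero    s w = s =ᶠ w
reach {n} E (suc k) s w = reach E k s w ∨ any (λ u → reach E k s u ∧ adj E u w) (allFin n)

connected : {n : ℕ} → Edges n → Bool
connected {n} E = all (λ u → all (λ w → reach E n u w) (allFin n)) (allFin n)

removeEdge : {n : ℕ} → Fin n × Fin n → Edges n → Edges n
removeEdge e = filterᵇ (λ e' → not ((proj₁ e =ᶠ proj₁ e') ∧ (proj₂ e =ᶠ proj₂ e')))

acyclic : {n : ℕ} → Edges n → Bool
acyclic {n} E = all (λ e → not (reach (removeEdge e E) n (proj₁ e) (proj₂ e))) E

isTree : {n : ℕ} → Edges n → Bool
isTree E = connected E ∧ acyclic E

cayleyTrees : (n : ℕ) → List (Edges n)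
cayleyTrees n = filterᵇ isTree (sublists (pairs n))

children : {n : ℕ} → Edges n → Maybe (Fin n) → Fin n → List (Fin n)
children {n} E p v = filterᵇ (λ w → adj E v w ∧ notParent p w) (allFin n)
  where
  notParent : Maybe (Fin n) → Fin n → Bool
  notParent nothing  w = true
  notParent (just u) w = not (u =ᶠ w)

-- strips of the subtree at v (parent p, depth d), in the order produced by the
-- traversal of the paper: the first strip starts at v and follows smallest
-- children down to a leaf; then the subtrees are handled in preorder with
-- children in increasing label order.  The fuel bounds the depth.
stripsAt : {n : ℕ} → Edges n → ℕ → Maybe (Fin n) → Fin n → ℕ → List VStrip
stripsAt E zero    p v d = []
stripsAt E (suc f) p v d with children E p v
... | []      = [ strip d 1 ]
... | c ∷ cs  = extend (stripsAt E f (just v) c (suc d))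
                ++ concatMap (λ c' → stripsAt E f (just v) c' (suc d)) cs
  where
  extend : List VStrip → List VStrip
  extend []       = [ strip d 1 ]
  extend (s ∷ ss) = strip d (suc (len s)) ∷ ss

-- ν(T) for a tree on [suc m] rooted at vertex 1 (= Fin.zero); content = distance to 1
νTree : (m : ℕ) → Edges (suc m) → List VStrip
νTree m E = stripsAt E (suc m) nothing Fin.zero 0

-- Parking functions on m cars (values Fin m stand for 1..m)

isPF : (m : ℕ) → List (Fin m) → Bool
isPF m f = all (λ i → i ≤ᵇ count (λ c → toℕ c <ᵇ i) f) (map suc (upTo m))

parkingFunctions : (m : ℕ) → List (List (Fin m))
parkingFunctions m = filterᵇ (isPF m) (allFuns m m)

data Step : Set where
  nS eS dS : Step

pathD : (m : ℕ) → List (Fin m) → List Step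
pathD m f = concatMap (λ i → replicate (count (λ c → toℕ c ≡ᵇ i) f) nS ++ [ eS ]) (upTo m)

mergeEN : List Step → List Step
mergeEN []             = []
mergeEN (eS ∷ nS ∷ s)  = dS ∷ mergeEN s
mergeEN (eS ∷ s)       = eS ∷ mergeEN s
mergeEN (nS ∷ s)       = nS ∷ mergeEN s
mergeEN (dS ∷ s)       = dS ∷ mergeEN s

schröderOf : (m : ℕ) → List (Fin m) → List Step
schröderOf m f = mergeEN (nS ∷ eS ∷ pathD m f)

columns : ℕ → List Step → List (ℕ × Bool)
columns y []       = []
columns y (nS ∷ s) = columns (suc y) s
columns y (eS ∷ s) = (y , false) ∷ columns y s
columns y (dS ∷ s) = (y , true)  ∷ columns (suc y) s

-- Everything valued in a commutative ring R, with q ∈ R and x₁,…,x_N ∈ R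
-- (the x_i for i > N specialised to 0).

module Poly {c ℓ : Level} (R : CommutativeRing c ℓ)
            (q : CommutativeRing.Carrier R) (N : ℕ)
            (x : Fin N → CommutativeRing.Carrier R) where
  open CommutativeRing R

  sumR : List Carrier → Carrier
  sumR = foldr _+_ 0#

  prodR : List Carrier → Carrier
  prodR = foldr _*_ 1#

  pow : Carrier → ℕ → Carrier
  pow a zero    = 1#
  pow a (suc k) = a * pow a k

  monomial : List (Fin N) → Carrier
  monomial g = prodR (map x g)

  LLT : List VStrip → Carrier
  LLT ν = sumR (map (λ g → let fc = fill (cellsOf ν) g in
              if admissible fc then pow q (invF (length ν) fc) * monomial g else 0#)
            (allFuns N (length (cellsOf ν))))

  -- LLT(B): |B| cells of content 0, ordered as in B
  LLTset : {n : ℕ} → Subset n → Carrier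
  LLTset B = sumR (map (λ g → pow q (invList (map toℕ g)) * monomial g)
                       (allFuns N (length (elems B))))

  IsCumulant : (n : ℕ) → (Subset n → Carrier) → Set ℓ
  IsCumulant n κ = ∀ (B : Subset n) → Nonempty B →
    LLTset B ≈ sumR (map (λ π → pow (q - 1#) (length (elems B) ∸ length π)
                                  * prodR (map (λ C → κ (toSubset C)) π))
                         (setPartitions (elems B)))

  -- LLT(μ(P)) of a Schröder path of length n, via the formula in the paper
  LLTμ : (n : ℕ) → List Step → Carrier
  LLTμ n P = sumR (map (λ g → let v = map toℕ g in
                if dCond v then pow q (below v) * monomial g else 0#)
             (allFuns N n))
    where
    cols = indexed (columns 0 P)
    -- g(i) > g(j) for every box (i,j) containing a d step
    dCond : List ℕ → Bool
    dCond v = all (λ col → not (proj₂ (proj₂ col)) ∨ (nth v (proj₁ (proj₂ col)) <ᵇ nth v (proj₁ col))) cols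
    -- #{(i,j) : i < j, box (i,j) weakly below P, g(i) > g(j)}
    below : List ℕ → ℕ
    below v = length (concatMap (λ col → filterᵇ (λ b →
                   (proj₁ col <ᵇ b) ∧ (b <ᵇ proj₁ (proj₂ col)) ∧ (nth v b <ᵇ nth v (proj₁ col)))
                 (upTo n)) cols)

{-# OPTIONS --safe #-}
-- Explore a tree breadth first, with a queue U of vertices carrying values and a pool of r unused
-- labels. Popping u contributes q^#{w ∈ U : u > w}; its children are a subset of the pool, appended
-- to U with arbitrary values except that the first one is below u. Let F_r(U) be the sum over all
-- ways to empty queue and pool together. Then
--   Σ_c q^inv(Uc) x^c = Σ_s C(r,s) (q-1)^s F_s(U) LLT_{r-s}      (c runs over words of length r),
-- by induction: after popping u this reduces to
--   Σ_c q^inv(c) x^c q^#{i : u > c_i} = Σ_c q^inv(c) x^c (1 + (q^r - 1) [u > c_1]),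
-- which follows by exchanging the first two letters of c. For U = (u) this is the recursion that the
-- cumulants satisfy (split a set partition at the block of 1), so κ([n]) = Σ_u x_u F_{n-1}(u).
-- Read by increasing shifted content, the cells of ν(T) form the breadth-first order of T, and the
-- number of children of the i-th vertex plays the role of |f⁻¹(i)|; hence both sums in the theorem
-- expand to Σ_u x_u F_{n-1}(u). That a graph is a tree exactly when the search succeeds uses a
-- 2-colouring, constant along all other edges, to separate the ends of each edge.
module Submission where

open import Defs
open import Level using (Level)
open import Data.Nat as ℕ using (ℕ; zero; suc; _∸_; _<ᵇ_; _≡ᵇ_; _≤ᵇ_; s≤s; z≤n)
import Data.Nat.Properties as ℕ
open import Data.Bool using (Bool; true; false; if_then_else_; not; _∧_; _∨_; T)
import Data.Bool.Properties as Bool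
open import Data.Bool.ListAction using (any; all)
open import Data.List
  using (List; []; _∷_; [_]; _++_; map; concatMap; foldr; filterᵇ; length; allFin; take; drop; null;
         upTo; applyUpTo; zip; replicate)
import Data.List.Properties as List
open import Data.List.Membership.Propositional using (_∈_; _∉_; find)
open import Data.List.Membership.Propositional.Properties
  using (∈-map⁻; ∈-map⁺; ∈-concatMap⁻; ∈-++⁻; ∈-++⁺ˡ; ∈-++⁺ʳ; ∈-allFin)
open import Data.List.Relation.Unary.Any as Any using (here; there)
open import Data.List.Relation.Unary.All as All using (All; []; _∷_)
import Data.List.Relation.Unary.All.Properties as All
open import Data.List.Relation.Unary.AllPairs using (AllPairs; []; _∷_)
import Data.List.Relation.Unary.AllPairs.Properties as AllPairs
open import Data.List.Relation.Unary.Unique.Propositional using (Unique)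
open import Data.List.Relation.Unary.Unique.Propositional.Properties using (allFin⁺)
open import Data.List.Relation.Binary.Pointwise as Pointwise using (Pointwise; []; _∷_)
open import Data.List.Relation.Binary.Sublist.Propositional
  using (_⊆_; []; _∷_; _∷ʳ_; ⊆-refl; ⊆-trans; lookup)
open import Data.List.Relation.Binary.Permutation.Propositional as Perm
  using (_↭_; ↭-refl; ↭-sym; ↭-trans; prep)
import Data.List.Relation.Binary.Permutation.Propositional.Properties as Perm
open import Data.List.Relation.Ternary.Interleaving.Propositional
  using (Interleaving; []; consˡ; consʳ; toPermutation)
open import Data.Fin as Fin using (Fin; toℕ)
open import Data.Fin.Subset using (Subset; Nonempty; ⊤)
open import Data.Maybe using (Maybe; just; nothing)
open import Data.Maybe.Properties using (just-injective)
open import Data.Vec as Vec using ()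
import Data.Vec.Properties as Vec
open import Data.Product using (_×_; _,_; proj₁; proj₂; map₁; map₂; Σ; ∃; ∃₂)
open import Data.Sum using (_⊎_; inj₁; inj₂)
open import Data.Empty using (⊥-elim)
open import Data.Unit using (tt)
open import Function using (_∘_; id)
open import Relation.Nullary using (yes; no; ¬_)
open import Relation.Binary.Construct.Closure.ReflexiveTransitive as Star using (Star; ε; _◅_; _◅◅_)
open import Relation.Binary.PropositionalEquality as ≡ using (_≡_; _≢_; cong; cong₂; subst)
open import Algebra.Bundles using (CommutativeRing)
import Algebra.Solver.Ring.NaturalCoefficients.Default as NatSolver
import Relation.Binary.Reasoning.Setoid as SetoidReasoning

-- The power (q-1)^s appears because q^r = Σ_C (q-1)^|C| over the subsets C of a pool of r labels.
-- So 1 + (q^r - 1)[u > c_1] is the sum over C of (q-1)^|C|, with the factor [u > c_1] unless C is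
-- empty. Reading C as the children of u and the first |C| letters of c as their values gives one
-- step of the search. Binomial coefficients are never formed: `splits` runs over the subsets of a
-- list, and the same index set serves for children, blocks of set partitions and neighbourhoods in
-- a graph. The condition falls on the first child alone because only the smallest child continues
-- the strip of its parent. The exchange of letters is needed for arbitrary letter weights, since a
-- removed first letter, like the queue, acts on the rest of the word by rescaling its letters. The
-- other obstacle is order: strips list cells in preorder, edge lists follow the labels, the search
-- follows its queue. Hence the strip conditions become a product over all ordered pairs of cells,
-- and sums over graphs of adjacency-invariant terms are shown to be independent of the order of the
-- vertices.

private variable
  A B C : Set
  n M   : ℕ

-- Splittings of a list into two parts

splits : List A → List (List A × List A)
splits []       = ([] , []) ∷ []
splits (y ∷ ys) = map (map₁ (y ∷_)) (splits ys) ++ map (map₂ (y ∷_)) (splits ys)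

splits-interleaving : (l : List A) {C D : List A} → (C , D) ∈ splits l → Interleaving C D l
splits-interleaving []       (here ≡.refl) = []
splits-interleaving (y ∷ ys) CD∈ with ∈-++⁻ (map (map₁ (y ∷_)) (splits ys)) CD∈
... | inj₁ p with ∈-map⁻ (map₁ (y ∷_)) p
...   | _ , CD∈′ , ≡.refl = consˡ (splits-interleaving ys CD∈′)
splits-interleaving (y ∷ ys) CD∈ | inj₂ p with ∈-map⁻ (map₂ (y ∷_)) p
...   | _ , CD∈′ , ≡.refl = consʳ (splits-interleaving ys CD∈′)

interleaving-length : {C D l : List A} → Interleaving C D l → length C ℕ.+ length D ≡ length l
interleaving-length []         = ≡.refl
interleaving-length (consˡ sp) = cong suc (interleaving-length sp)
interleaving-length {C = C} {D = _ ∷ D} (consʳ sp) =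
  ≡.trans (ℕ.+-suc (length C) (length D)) (cong suc (interleaving-length sp))

allFuns-length : ∀ N r {g} → g ∈ allFuns N r → length g ≡ r
allFuns-length N zero    (here ≡.refl) = ≡.refl
allFuns-length N (suc r) g∈ with Any.satisfied (∈-concatMap⁻ (λ a → map (a ∷_) (allFuns N r)) {xs = allFin N} g∈)
... | a , p with ∈-map⁻ (a ∷_) p
...   | _ , g∈′ , ≡.refl = cong suc (allFuns-length N r g∈′)

-- A state of the process is a queue of k vertices and a pool l; each of the f ≡ k + length l
-- steps pops a vertex and moves its children, a subset of the pool, to the end of the queue.
degreeSeqs : ℕ → ℕ → List A → List (List ℕ)
degreeSeqs zero    _       _ = [] ∷ []
degreeSeqs (suc f) zero    _ = []
degreeSeqs (suc f) (suc k) l =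
  concatMap (λ (C , D) → map (length C ∷_) (degreeSeqs f (k ℕ.+ length C) D)) (splits l)

-- Finite sums and products in a commutative ring

module Sums {c ℓ : Level} (R : CommutativeRing c ℓ) where
  open CommutativeRing R
  open SetoidReasoning setoid

  ∑ : List A → (A → Carrier) → Carrier
  ∑ xs f = foldr _+_ 0# (map f xs)

  syntax ∑ xs (λ a → e) = ∑[ a ∈ xs ] e
  infix 5 ∑

  ∑-cong : (xs : List A) {f g : A → Carrier} →
           (∀ {a} → a ∈ xs → f a ≈ g a) → ∑ xs f ≈ ∑ xs g
  ∑-cong []       f≈g = refl
  ∑-cong (a ∷ as) f≈g = +-cong (f≈g (here ≡.refl)) (∑-cong as (λ a∈ → f≈g (there a∈)))

  ∑-zero : (xs : List A) → ∑[ _ ∈ xs ] 0# ≈ 0#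
  ∑-zero []       = refl
  ∑-zero (_ ∷ as) = trans (+-identityˡ _) (∑-zero as)

  ∑-++ : (xs ys : List A) (f : A → Carrier) → ∑ (xs ++ ys) f ≈ ∑ xs f + ∑ ys f
  ∑-++ []       ys f = sym (+-identityˡ _)
  ∑-++ (a ∷ as) ys f = trans (+-congˡ (∑-++ as ys f)) (sym (+-assoc _ _ _))

  ∑-map : (g : A → B) (xs : List A) (f : B → Carrier) → ∑ (map g xs) f ≈ ∑ xs (f ∘ g)
  ∑-map g []       f = refl
  ∑-map g (a ∷ as) f = +-congˡ (∑-map g as f)

  ∑-concatMap : (g : A → List B) (xs : List A) (f : B → Carrier) →
                ∑ (concatMap g xs) f ≈ ∑[ a ∈ xs ] ∑ (g a) f
  ∑-concatMap g []       f = refl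
  ∑-concatMap g (a ∷ as) f = trans (∑-++ (g a) _ f) (+-congˡ (∑-concatMap g as f))

  private
    open NatSolver commutativeSemiring using (solve; _:=_; _:+_; _:*_; con)

    *-interchange : ∀ a b c d → (a * b) * (c * d) ≈ (a * c) * (b * d)
    *-interchange = solve 4 (λ a b c d → (a :* b) :* (c :* d) := (a :* c) :* (b :* d)) refl

    +-interchange : ∀ a b c d → (a + b) + (c + d) ≈ (a + c) + (b + d)
    +-interchange = solve 4 (λ a b c d → (a :+ b) :+ (c :+ d) := (a :+ c) :+ (b :+ d)) refl

  ∏ : List A → (A → Carrier) → Carrier
  ∏ xs f = foldr _*_ 1# (map f xs)

  ∏-cong : (xs : List A) {f g : A → Carrier} → (∀ a → f a ≈ g a) → ∏ xs f ≈ ∏ xs g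
  ∏-cong []       f≈g = refl
  ∏-cong (a ∷ as) f≈g = *-cong (f≈g a) (∏-cong as f≈g)

  ∏-* : (xs : List A) (f g : A → Carrier) → ∏ xs (λ a → f a * g a) ≈ ∏ xs f * ∏ xs g
  ∏-* []       f g = sym (*-identityˡ 1#)
  ∏-* (a ∷ as) f g = trans (*-congˡ (∏-* as f g)) (*-interchange _ _ _ _)

  ∏-++ : (xs ys : List A) (f : A → Carrier) → ∏ (xs ++ ys) f ≈ ∏ xs f * ∏ ys f
  ∏-++ []       ys f = sym (*-identityˡ _)
  ∏-++ (a ∷ as) ys f = trans (*-congˡ (∏-++ as ys f)) (sym (*-assoc _ _ _))

  ∏-map : (g : A → B) (xs : List A) (f : B → Carrier) → ∏ (map g xs) f ≈ ∏ xs (f ∘ g)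
  ∏-map g []       f = refl
  ∏-map g (a ∷ as) f = *-congˡ (∏-map g as f)

  ∏-↭ : {xs ys : List A} → xs ↭ ys → (f : A → Carrier) → ∏ xs f ≈ ∏ ys f
  ∏-↭ Perm.refl          f = refl
  ∏-↭ (Perm.prep _ p)    f = *-congˡ (∏-↭ p f)
  ∏-↭ (Perm.swap a b p)  f = trans (*-congˡ (*-congˡ (∏-↭ p f)))
    (solve 3 (λ a b c → a :* (b :* c) := b :* (a :* c)) refl _ _ _)
  ∏-↭ (Perm.trans p p′)  f = trans (∏-↭ p f) (∏-↭ p′ f)

  ∑-+ : (xs : List A) (f g : A → Carrier) → ∑ xs f + ∑ xs g ≈ ∑[ a ∈ xs ] (f a + g a)
  ∑-+ []       f g = +-identityˡ _
  ∑-+ (a ∷ as) f g = trans (+-interchange _ _ _ _) (+-congˡ (∑-+ as f g))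

  ∑-distribˡ : (b : Carrier) (xs : List A) (f : A → Carrier) → b * ∑ xs f ≈ ∑[ a ∈ xs ] b * f a
  ∑-distribˡ b []       f = zeroʳ b
  ∑-distribˡ b (a ∷ as) f = trans (distribˡ _ _ _) (+-congˡ (∑-distribˡ b as f))

  ∑-distribʳ : (b : Carrier) (xs : List A) (f : A → Carrier) → ∑ xs f * b ≈ ∑[ a ∈ xs ] f a * b
  ∑-distribʳ b []       f = zeroˡ b
  ∑-distribʳ b (a ∷ as) f = trans (distribʳ _ _ _) (+-congˡ (∑-distribʳ b as f))

  ∑-swap : (xs : List A) (ys : List B) (f : A → B → Carrier) →
           ∑[ a ∈ xs ] ∑[ b ∈ ys ] f a b ≈ ∑[ b ∈ ys ] ∑[ a ∈ xs ] f a b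
  ∑-swap []       ys f = sym (∑-zero ys)
  ∑-swap (a ∷ as) ys f = trans (+-congˡ (∑-swap as ys f)) (∑-+ ys _ _)

  ∑-filterᵇ : (p : A → Bool) (xs : List A) (f : A → Carrier) →
              ∑ (filterᵇ p xs) f ≈ ∑[ a ∈ xs ] (if p a then f a else 0#)
  ∑-filterᵇ p []       f = refl
  ∑-filterᵇ p (a ∷ as) f with p a
  ... | true  = +-congˡ (∑-filterᵇ p as f)
  ... | false = trans (∑-filterᵇ p as f) (sym (+-identityˡ _))

  ∑-splits-∷ : (y : A) (ys : List A) (f : List A × List A → Carrier) →
               ∑ (splits (y ∷ ys)) f
                 ≈ ∑ (splits ys) (f ∘ map₁ (y ∷_)) + ∑ (splits ys) (f ∘ map₂ (y ∷_))
  ∑-splits-∷ y ys f = trans (∑-++ (map (map₁ (y ∷_)) (splits ys)) _ f)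
    (+-cong (∑-map _ (splits ys) f) (∑-map _ (splits ys) f))

  ∑-splits-cong : (l : List A) {f g : List A × List A → Carrier} →
    (∀ {C D} → Interleaving C D l → f (C , D) ≈ g (C , D)) → ∑ (splits l) f ≈ ∑ (splits l) g
  ∑-splits-cong l f≈g = ∑-cong (splits l) (λ CD∈ → f≈g (splits-interleaving l CD∈))

  ∑-splits-[] : (l : List A) (f : List A → Carrier) →
    ∑[ CD ∈ splits l ] (if null (proj₁ CD) then f (proj₂ CD) else 0#) ≈ f l
  ∑-splits-[] []       f = +-identityʳ _
  ∑-splits-[] (y ∷ ys) f = begin
    _                 ≈⟨ ∑-splits-∷ y ys _ ⟩
    _                 ≈⟨ +-cong (∑-zero (splits ys)) (∑-splits-[] ys (f ∘ (y ∷_))) ⟩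
    0# + f (y ∷ ys)   ≈⟨ +-identityˡ _ ⟩
    f (y ∷ ys)        ∎

  -- Each element of `l` lands in one of three parts on either side. This merges the children found
  -- at one pop with the vertices found later into a single explored set.
  ∑-splits-assoc : (l : List A) (f : List A → List A → List A → Carrier) →
    ∑[ (S , E) ∈ splits l ] ∑[ (C , D) ∈ splits S ] f C D E
      ≈ ∑[ (C , S) ∈ splits l ] ∑[ (D , E) ∈ splits S ] f C D E
  ∑-splits-assoc []       f = refl
  ∑-splits-assoc (y ∷ ys) f = begin
    _ ≈⟨ ∑-splits-∷ y ys _ ⟩
    _ ≈⟨ +-congʳ (∑-cong (splits ys) (λ {(S , E)} _ → ∑-splits-∷ y S _)) ⟩
    _ ≈⟨ +-congʳ (∑-+ (splits ys) _ _) ⟨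
    _ ≈⟨ +-cong (+-cong (∑-splits-assoc ys (λ C D E → f (y ∷ C) D E))
                        (∑-splits-assoc ys (λ C D E → f C (y ∷ D) E)))
                (∑-splits-assoc ys (λ C D E → f C D (y ∷ E))) ⟩
    _ ≈⟨ +-assoc _ _ _ ⟩
    _ ≈⟨ +-congˡ (∑-+ (splits ys) _ _) ⟩
    _ ≈⟨ +-congˡ (∑-cong (splits ys) (λ {(C , S)} _ → ∑-splits-∷ y S _)) ⟨
    _ ≈⟨ ∑-splits-∷ y ys _ ⟨
    _ ∎

  ∑-allFuns-suc : ∀ N r (f : List (Fin N) → Carrier) →
    ∑ (allFuns N (suc r)) f ≈ ∑[ a ∈ allFin N ] ∑[ g ∈ allFuns N r ] f (a ∷ g)
  ∑-allFuns-suc N r f = trans (∑-concatMap _ (allFin N) f)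
    (∑-cong (allFin N) (λ _ → ∑-map _ (allFuns N r) f))

  ∑-allFuns-+ : ∀ N r s (f : List (Fin N) → Carrier) →
    ∑ (allFuns N (r ℕ.+ s)) f ≈ ∑[ g ∈ allFuns N r ] ∑[ h ∈ allFuns N s ] f (g ++ h)
  ∑-allFuns-+ N zero    s f = sym (+-identityʳ _)
  ∑-allFuns-+ N (suc r) s f = begin
    _ ≈⟨ ∑-allFuns-suc N (r ℕ.+ s) f ⟩
    _ ≈⟨ ∑-cong (allFin N) (λ {a} _ → ∑-allFuns-+ N r s (f ∘ (a ∷_))) ⟩
    _ ≈⟨ ∑-allFuns-suc N r _ ⟨
    _ ∎

<ᵇ-false⇒≥ : ∀ m n → (m <ᵇ n) ≡ false → n ℕ.≤ m
<ᵇ-false⇒≥ m n eq = ℕ.≮⇒≥ (λ m<n → subst T eq (ℕ.<⇒<ᵇ m<n))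

<ᵇ-true⇒< : ∀ m n → (m <ᵇ n) ≡ true → m ℕ.< n
<ᵇ-true⇒< m n eq = ℕ.<ᵇ⇒< m n (subst T (≡.sym eq) tt)

<⇒<ᵇ-true : ∀ {m n} → m ℕ.< n → (m <ᵇ n) ≡ true
<⇒<ᵇ-true {m} {n} m<n with m <ᵇ n in eq
... | true  = ≡.refl
... | false = ⊥-elim (ℕ.<⇒≱ m<n (<ᵇ-false⇒≥ m n eq))

≥⇒<ᵇ-false : ∀ {m n} → n ℕ.≤ m → (m <ᵇ n) ≡ false
≥⇒<ᵇ-false {m} {n} n≤m with m <ᵇ n in eq
... | false = ≡.refl
... | true  = ⊥-elim (ℕ.<⇒≱ (<ᵇ-true⇒< m n eq) n≤m)

take-++ : (xs ys : List A) → take (length xs) (xs ++ ys) ≡ xs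
take-++ []       ys = ≡.refl
take-++ (a ∷ as) ys = cong (a ∷_) (take-++ as ys)

drop-++ : (xs ys : List A) → drop (length xs) (xs ++ ys) ≡ ys
drop-++ []       ys = ≡.refl
drop-++ (_ ∷ as) ys = drop-++ as ys

-- The weighted breadth-first process

module Process {c ℓ : Level} (R : CommutativeRing c ℓ) (q : CommutativeRing.Carrier R)
               (N : ℕ) (x : Fin N → CommutativeRing.Carrier R) where
  open CommutativeRing R
  open Poly R q N x
  open Sums R
  open SetoidReasoning setoid
  open NatSolver commutativeSemiring using (solve; _:=_; _:+_; _:*_; con)

  t : Carrier
  t = q - 1#

  q≈1+t : q ≈ 1# + t
  q≈1+t = sym (begin
    1# + (q - 1#)      ≈⟨ +-comm _ _ ⟩
    (q + - 1#) + 1#    ≈⟨ +-assoc _ _ _ ⟩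
    q + (- 1# + 1#)    ≈⟨ +-congˡ (-‿inverseˡ 1#) ⟩
    q + 0#             ≈⟨ +-identityʳ q ⟩
    q                  ∎)

  _≻_ : Fin N → Fin N → Bool
  a ≻ b = toℕ b <ᵇ toℕ a

  e ι : Fin N → Fin N → Carrier
  e a b = if a ≻ b then q else 1#
  ι a b = if a ≻ b then 1# else 0#

  e≈1+tι : ∀ a b → e a b ≈ 1# + t * ι a b
  e≈1+tι a b with a ≻ b
  ... | true  = trans q≈1+t (+-congˡ (sym (*-identityʳ t)))
  ... | false = sym (trans (+-congˡ (zeroʳ t)) (+-identityʳ 1#))

  weight : (Fin N → Carrier) → List (Fin N) → Carrier
  weight w g = prodR (map w g)

  cross : Fin N → List (Fin N) → Carrier
  cross a = weight (e a)

  inversionWeight : List (Fin N) → Carrier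
  inversionWeight []      = 1#
  inversionWeight (a ∷ g) = cross a g * inversionWeight g

  pow-+ : ∀ y m n → pow y (m ℕ.+ n) ≈ pow y m * pow y n
  pow-+ y zero    n = sym (*-identityˡ _)
  pow-+ y (suc m) n = trans (*-congˡ (pow-+ y m n)) (sym (*-assoc _ _ _))

  pow-count : ∀ a g → pow q (count (λ b → b <ᵇ toℕ a) (map toℕ g)) ≈ cross a g
  pow-count a []      = refl
  pow-count a (b ∷ g) with a ≻ b
  ... | true  = *-congˡ (pow-count a g)
  ... | false = trans (pow-count a g) (sym (*-identityˡ _))

  pow-invList : ∀ g → pow q (invList (map toℕ g)) ≈ inversionWeight g
  pow-invList []      = refl
  pow-invList (a ∷ g) =
    trans (pow-+ q (count _ (map toℕ g)) _) (*-cong (pow-count a g) (pow-invList g))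

  weight-* : ∀ w w′ g → weight (λ a → w a * w′ a) g ≈ weight w g * weight w′ g
  weight-* w w′ g = ∏-* g w w′

  weight-++ : ∀ w g h → weight w (g ++ h) ≈ weight w g * weight w h
  weight-++ w g h = ∏-++ g h w

  weight-const : ∀ g → weight (λ _ → 1#) g ≈ 1#
  weight-const []      = refl
  weight-const (a ∷ g) = trans (*-identityˡ _) (weight-const g)

  -- The condition on a vertex `u` with the given number of children, read off a word that begins
  -- with their values. It involves the first child only, the one that continues the strip of `u`.
  guard : ℕ → Fin N → List (Fin N) → Carrier
  guard zero    u g       = 1#
  guard (suc _) u []      = 0#
  guard (suc _) u (b ∷ _) = ι u b

  -- q^r - 1
  qm1 : ℕ → Carrier
  qm1 zero    = 0#
  qm1 (suc r) = t + q * qm1 r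

  private
    both : Fin N → Fin N → Fin N → Carrier
    both u a b = e a b * (q * (ι u a * ι u b))

    onlyʳ : Fin N → Fin N → Fin N → Carrier
    onlyʳ u a b = if not (u ≻ a) ∧ (u ≻ b) then q else 0#

    -- If only `b` is below `u`, then `b < u ≤ a`, so `a` and `b` form an inversion themselves and
    -- `e a b` supplies the factor `q` of `onlyʳ`.
    swap-lhs : ∀ u a b → e a b * (e u a * ι u b) ≈ both u a b + onlyʳ u a b
    swap-lhs u a b with u ≻ a in ua | u ≻ b in ub
    ... | true  | true  = solve 2 (λ e q → e :* (q :* con 1) := e :* (q :* (con 1 :* con 1)) :+ con 0) refl _ _
    ... | true  | false = solve 2 (λ e q → e :* (q :* con 0) := e :* (q :* (con 1 :* con 0)) :+ con 0) refl _ _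
    ... | false | false = solve 2 (λ e q → e :* (con 1 :* con 0) := e :* (q :* (con 0 :* con 0)) :+ con 0) refl _ _
    ... | false | true  rewrite <⇒<ᵇ-true (ℕ.<-≤-trans (<ᵇ-true⇒< (toℕ b) (toℕ u) ub) (<ᵇ-false⇒≥ (toℕ a) (toℕ u) ua)) =
      solve 1 (λ q → q :* (con 1 :* con 1) := q :* (q :* (con 0 :* con 1)) :+ q) refl _

    -- Now the exceptional case is `a < u ≤ b`: there is no inversion, and the factor `q` is the
    -- explicit one. Interchanging the letters turns this term into the exceptional one of
    -- `swap-lhs`.
    swap-rhs : ∀ u a b → e a b * (q * ι u a) ≈ both u a b + onlyʳ u b a
    swap-rhs u a b with u ≻ a in ua | u ≻ b in ub
    ... | true  | true  = solve 2 (λ e q → e :* (q :* con 1) := e :* (q :* (con 1 :* con 1)) :+ con 0) refl _ _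
    ... | true  | false rewrite ≥⇒<ᵇ-false (ℕ.<⇒≤ (ℕ.<-≤-trans (<ᵇ-true⇒< (toℕ a) (toℕ u) ua) (<ᵇ-false⇒≥ (toℕ b) (toℕ u) ub))) =
      solve 1 (λ q → con 1 :* (q :* con 1) := con 1 :* (q :* (con 1 :* con 0)) :+ q) refl _
    ... | false | false = solve 2 (λ e q → e :* (q :* con 0) := e :* (q :* (con 0 :* con 0)) :+ con 0) refl _ _
    ... | false | true  = solve 2 (λ e q → e :* (q :* con 0) := e :* (q :* (con 0 :* con 1)) :+ con 0) refl _ _

    module _ (w : Fin N → Carrier) where
      -- The weight of the word `a b g` without the mutual factor `e a b`; what remains is symmetric
      -- in the first two letters.
      sorted : Fin N → Fin N → List (Fin N) → Carrier
      sorted a b g = ((w a * w b) * weight w g) * ((cross a g * cross b g) * inversionWeight g)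

      sorted-comm : ∀ a b g → sorted a b g ≈ sorted b a g
      sorted-comm a b g = *-cong (*-congʳ (*-comm _ _)) (*-congʳ (*-comm _ _))

      wt : List (Fin N) → Carrier
      wt g = weight w g * inversionWeight g

      wt-∷∷ : ∀ a b g y → wt (a ∷ b ∷ g) * y ≈ (e a b * y) * sorted a b g
      wt-∷∷ a b g y = solve 8 (λ wa wb wg eab ag bg iv y →
        ((wa :* (wb :* wg)) :* ((eab :* ag) :* (bg :* iv))) :* y
          := (eab :* y) :* (((wa :* wb) :* wg) :* ((ag :* bg) :* iv))) refl _ _ _ _ _ _ _ _

      ∑³ : ℕ → (Fin N → Fin N → List (Fin N) → Carrier) → Carrier
      ∑³ r f = ∑[ a ∈ allFin N ] ∑[ b ∈ allFin N ] ∑[ g ∈ allFuns N r ] f a b g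

      ∑³-cong : ∀ r {f g} → (∀ a b h → f a b h ≈ g a b h) → ∑³ r f ≈ ∑³ r g
      ∑³-cong r f≈g = ∑-cong (allFin N) (λ _ → ∑-cong (allFin N) (λ _ → ∑-cong (allFuns N r) (λ _ → f≈g _ _ _)))

      ∑³-+ : ∀ r f g → ∑³ r (λ a b h → f a b h + g a b h) ≈ ∑³ r f + ∑³ r g
      ∑³-+ r f g = sym (trans (∑-+ (allFin N) _ _) (∑-cong (allFin N) (λ _ →
        trans (∑-+ (allFin N) _ _) (∑-cong (allFin N) (λ _ → ∑-+ (allFuns N r) _ _)))))

      ∑-wt-∷∷ : ∀ r (f : Fin N → List (Fin N) → Carrier) → ∑[ a ∈ allFin N ] ∑[ g ∈ allFuns N (suc r) ] wt (a ∷ g) * f a g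
                  ≈ ∑³ r (λ a b g → (e a b * f a (b ∷ g)) * sorted a b g)
      ∑-wt-∷∷ r f = ∑-cong (allFin N) (λ {a} _ → trans (∑-allFuns-suc N r _)
        (∑-cong (allFin N) (λ {b} _ → ∑-cong (allFuns N r) (λ {g} _ → wt-∷∷ a b g _))))

      -- Exchanging the first two letters a, b turns one side into the other, since
      -- q^[u>a] [u>b] and q [u>a] only differ when exactly one of a, b is below u.
      exchange : ∀ r u →
        ∑[ a ∈ allFin N ] ∑[ g ∈ allFuns N (suc r) ] wt (a ∷ g) * (e u a * guard 1 u g)
          ≈ ∑[ a ∈ allFin N ] ∑[ g ∈ allFuns N (suc r) ] wt (a ∷ g) * (q * ι u a)
      exchange r u = begin
        _ ≈⟨ ∑-wt-∷∷ r (λ a g → e u a * guard 1 u g) ⟩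
        ∑³ r (λ a b g → (e a b * (e u a * ι u b)) * sorted a b g)
          ≈⟨ ∑³-cong r (λ a b g → trans (*-congʳ (swap-lhs u a b)) (distribʳ _ _ _)) ⟩
        ∑³ r (λ a b g → both u a b * sorted a b g + onlyʳ u a b * sorted a b g)
          ≈⟨ ∑³-+ r _ _ ⟩
        ∑³ r (λ a b g → both u a b * sorted a b g) + ∑³ r (λ a b g → onlyʳ u a b * sorted a b g)
          ≈⟨ +-congˡ (∑-swap (allFin N) (allFin N) _) ⟩
        ∑³ r (λ a b g → both u a b * sorted a b g) + ∑³ r (λ a b g → onlyʳ u b a * sorted b a g)
          ≈⟨ ∑³-+ r _ _ ⟨
        ∑³ r (λ a b g → both u a b * sorted a b g + onlyʳ u b a * sorted b a g)
          ≈⟨ ∑³-cong r (λ a b g → trans (*-congʳ (swap-rhs u a b))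
                (trans (distribʳ _ _ _) (+-congˡ (*-congˡ (sorted-comm a b g))))) ⟨
        ∑³ r (λ a b g → (e a b * (q * ι u a)) * sorted a b g)
          ≈⟨ ∑-wt-∷∷ r (λ a g → q * ι u a) ⟨
        _ ∎

      -- A one-letter word has no second letter to exchange, but its coefficient `qm1 0` vanishes.
      exchange-scaled : ∀ r u →
        qm1 r * (∑[ a ∈ allFin N ] ∑[ g ∈ allFuns N r ] wt (a ∷ g) * (e u a * guard 1 u g))
          ≈ qm1 r * (∑[ a ∈ allFin N ] ∑[ g ∈ allFuns N r ] wt (a ∷ g) * (q * ι u a))
      exchange-scaled zero    u = trans (zeroˡ _) (sym (zeroˡ _))
      exchange-scaled (suc r) u = *-congˡ (exchange r u)

      ∑²-split : ∀ r y (f g : Fin N → List (Fin N) → Carrier) →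
        ∑[ a ∈ allFin N ] ∑[ h ∈ allFuns N r ] (f a h + y * g a h)
          ≈ (∑[ a ∈ allFin N ] ∑[ h ∈ allFuns N r ] f a h)
            + y * (∑[ a ∈ allFin N ] ∑[ h ∈ allFuns N r ] g a h)
      ∑²-split r y f g = begin
        _ ≈⟨ ∑-cong (allFin N) (λ _ → ∑-+ (allFuns N r) _ _) ⟨
        _ ≈⟨ ∑-+ (allFin N) _ _ ⟨
        _ ≈⟨ +-congˡ (∑-cong (allFin N) (λ _ → ∑-distribˡ y (allFuns N r) _)) ⟨
        _ ≈⟨ +-congˡ (∑-distribˡ y (allFin N) _) ⟨
        _ ∎

  -- Induction on the length, with the letter weights left free: removing the first letter `a`
  -- multiplies the weight of every other letter by `e a`, so the hypothesis is applied to `w′ a`.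
  -- It yields a condition on the second letter, which `exchange` moves to the first; the
  -- coefficients add up by q^(r+1) - 1 = t + q (q^r - 1).
  ∑-cross : ∀ r w u →
    ∑[ g ∈ allFuns N r ] (weight w g * inversionWeight g) * cross u g
      ≈ ∑[ g ∈ allFuns N r ] (weight w g * inversionWeight g) * (1# + qm1 r * guard 1 u g)
  ∑-cross zero    w u = +-congʳ (*-congˡ (sym (trans (+-congˡ (zeroˡ _)) (+-identityʳ 1#))))
  ∑-cross (suc r) w u = begin
    _ ≈⟨ ∑-allFuns-suc N r _ ⟩
    ∑[ a ∈ allFin N ] ∑[ g ∈ allFuns N r ] wt w (a ∷ g) * (e u a * cross u g)
      ≈⟨ ∑-cong (allFin N) (λ {a} _ → first a (cross u)) ⟩
    ∑[ a ∈ allFin N ] (w a * e u a) * (∑[ g ∈ allFuns N r ] wt (w′ a) g * cross u g)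
      ≈⟨ ∑-cong (allFin N) (λ {a} _ → *-congˡ (∑-cross r (w′ a) u)) ⟩
    ∑[ a ∈ allFin N ] (w a * e u a) * (∑[ g ∈ allFuns N r ] wt (w′ a) g * (1# + qm1 r * guard 1 u g))
      ≈⟨ ∑-cong (allFin N) (λ {a} _ → first a (λ g → 1# + qm1 r * guard 1 u g)) ⟨
    ∑[ a ∈ allFin N ] ∑[ g ∈ allFuns N r ] wt w (a ∷ g) * (e u a * (1# + qm1 r * guard 1 u g))
      ≈⟨ ∑-cong (allFin N) (λ {a} _ → ∑-cong (allFuns N r) (λ {g} _ → solve 4 (λ y e k i →
           y :* (e :* (con 1 :+ k :* i)) := y :* e :+ k :* (y :* (e :* i))) refl _ _ _ _)) ⟩
    ∑[ a ∈ allFin N ] ∑[ g ∈ allFuns N r ] (wt w (a ∷ g) * e u a + qm1 r * (wt w (a ∷ g) * (e u a * guard 1 u g)))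
      ≈⟨ ∑²-split w r (qm1 r) _ _ ⟩
    _ ≈⟨ +-congˡ (exchange-scaled w r u) ⟩
    _ ≈⟨ ∑²-split w r (qm1 r) _ _ ⟨
    ∑[ a ∈ allFin N ] ∑[ g ∈ allFuns N r ] (wt w (a ∷ g) * e u a + qm1 r * (wt w (a ∷ g) * (q * ι u a)))
      ≈⟨ ∑-cong (allFin N) (λ {a} _ → ∑-cong (allFuns N r) (λ {g} _ →
          trans (+-congʳ (*-congˡ (e≈1+tι u a))) (solve 5 (λ y t q k i →
             y :* (con 1 :+ t :* i) :+ k :* (y :* (q :* i)) := y :* (con 1 :+ (t :+ q :* k) :* i)) refl _ _ _ _ _))) ⟩
    ∑[ a ∈ allFin N ] ∑[ g ∈ allFuns N r ] wt w (a ∷ g) * (1# + qm1 (suc r) * ι u a)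
      ≈⟨ ∑-allFuns-suc N r _ ⟨
    _ ∎
    where
    w′ : Fin N → Fin N → Carrier
    w′ a b = w b * e a b

    first : ∀ a (f : List (Fin N) → Carrier) →
      ∑[ g ∈ allFuns N r ] wt w (a ∷ g) * (e u a * f g)
        ≈ (w a * e u a) * (∑[ g ∈ allFuns N r ] wt (w′ a) g * f g)
    first a f = sym (trans (∑-distribˡ _ (allFuns N r) _) (∑-cong (allFuns N r) (λ {g} _ →
      trans (*-congˡ (*-congʳ (*-congʳ (weight-* w (e a) g))))
        (solve 6 (λ wa eu wg ag iv f → (wa :* eu) :* (((wg :* ag) :* iv) :* f)
           := ((wa :* wg) :* (ag :* iv)) :* (eu :* f)) refl _ _ _ _ _ _))))

  -- The word lists the queue of k vertices followed by the vertices that enter it later.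
  degreeWeight : ℕ → List ℕ → List (Fin N) → Carrier
  degreeWeight (suc k) (a ∷ as) (u ∷ v) =
    (guard a u (drop k v) * cross u (take k v)) * degreeWeight (k ℕ.+ a) as v
  degreeWeight _       _        _       = 1#

  process : ℕ → ℕ → List (Fin N) → List A → Carrier
  process f k U l =
    ∑[ as ∈ degreeSeqs f k l ] ∑[ v ∈ allFuns N (length l) ] degreeWeight k as (U ++ v) * monomial v

  guard-++ : ∀ u g h → guard (length g) u (g ++ h) ≡ guard (length g) u g
  guard-++ u []      h = ≡.refl
  guard-++ u (b ∷ g) h = ≡.refl

  step-weight : ∀ u U (C : List A) as g v → length g ≡ length C →
    degreeWeight (suc (length U)) (length C ∷ as) ((u ∷ U) ++ (g ++ v)) * monomial (g ++ v)
      ≈ ((guard (length C) u g * cross u U) * monomial g)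
          * (degreeWeight (length U ℕ.+ length C) as ((U ++ g) ++ v) * monomial v)
  step-weight u U C as g v eq
    rewrite take-++ U (g ++ v) | drop-++ U (g ++ v) | ≡.sym (List.++-assoc U g v) | ≡.sym eq | guard-++ u g v =
    trans (*-congˡ (weight-++ x g v))
      (solve 5 (λ a b c d e → ((a :* b) :* c) :* (d :* e) := ((a :* b) :* d) :* (c :* e)) refl _ _ _ _ _)

  process-step : ∀ f u U (l : List A) →
    process (suc f) (suc (length U)) (u ∷ U) l
      ≈ ∑[ (C , D) ∈ splits l ] ∑[ g ∈ allFuns N (length C) ]
          ((guard (length C) u g * cross u U) * monomial g)
            * process f (length U ℕ.+ length C) (U ++ g) D
  process-step f u U l = begin
    _ ≈⟨ ∑-concatMap _ (splits l) _ ⟩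
    _ ≈⟨ ∑-splits-cong l (λ {C} {D} sp → trans (∑-map _ (degreeSeqs f (length U ℕ.+ length C) D) _)
          (trans (∑-cong (degreeSeqs f (length U ℕ.+ length C) D) (λ {as} _ → lemma C D as sp))
          (trans (∑-swap (degreeSeqs f (length U ℕ.+ length C) D) (allFuns N (length C)) _)
          (∑-cong (allFuns N (length C)) (λ _ → sym (∑-distribˡ _ (degreeSeqs f (length U ℕ.+ length C) D) _)))))) ⟩
    _ ∎
    where
    lemma : ∀ C D as → Interleaving C D l →
      ∑[ v ∈ allFuns N (length l) ] degreeWeight (suc (length U)) (length C ∷ as) ((u ∷ U) ++ v) * monomial v
        ≈ ∑[ g ∈ allFuns N (length C) ] ((guard (length C) u g * cross u U) * monomial g)
            * (∑[ v ∈ allFuns N (length D) ] degreeWeight (length U ℕ.+ length C) as ((U ++ g) ++ v) * monomial v)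
    lemma C D as sp rewrite ≡.sym (interleaving-length sp) =
      trans (∑-allFuns-+ N (length C) (length D) _)
        (∑-cong (allFuns N (length C)) (λ {g} g∈ →
          trans (∑-cong (allFuns N (length D)) (λ {v} _ → step-weight u U C as g v (allFuns-length N _ g∈)))
            (sym (∑-distribˡ _ (allFuns N (length D)) _))))

  complete : ℕ → Carrier
  complete r = ∑[ g ∈ allFuns N r ] inversionWeight g * monomial g

  -- The subset expansion of q^r = (1 + t)^r.
  ∑-splits-pow : (l : List A) → ∑[ CD ∈ splits l ] pow t (length (proj₁ CD)) ≈ 1# + qm1 (length l)
  ∑-splits-pow []       = refl
  ∑-splits-pow (y ∷ ys) = begin
    _ ≈⟨ ∑-splits-∷ y ys _ ⟩
    _ ≈⟨ +-congʳ (∑-distribˡ t (splits ys) _) ⟨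
    t * s + s                 ≈⟨ solve 2 (λ t s → t :* s :+ s := (con 1 :+ t) :* s) refl _ _ ⟩
    (1# + t) * s              ≈⟨ *-cong q≈1+t (sym (∑-splits-pow ys)) ⟨
    q * (1# + qm1 (length ys)) ≈⟨ distribˡ _ _ _ ⟩
    q * 1# + q * qm1 (length ys) ≈⟨ +-congʳ (trans (*-identityʳ q) q≈1+t) ⟩
    (1# + t) + q * qm1 (length ys) ≈⟨ +-assoc _ _ _ ⟩
    1# + (t + q * qm1 (length ys)) ∎
    where s = ∑[ CD ∈ splits ys ] pow t (length (proj₁ CD))

  -- All nonempty subsets carry the same guard, so together they contribute q^r - 1 times it. The
  -- subset will be the set of children of `u`.
  ∑-splits-guard : (l : List A) (u : Fin N) (g : List (Fin N)) →
    ∑[ CD ∈ splits l ] pow t (length (proj₁ CD)) * guard (length (proj₁ CD)) u g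
      ≈ 1# + qm1 (length l) * guard 1 u g
  ∑-splits-guard []       u g = trans (+-identityʳ _) (trans (*-identityˡ 1#)
    (sym (trans (+-congˡ (zeroˡ _)) (+-identityʳ 1#))))
  ∑-splits-guard (y ∷ ys) u g = begin
    _ ≈⟨ ∑-splits-∷ y ys _ ⟩
    _ ≈⟨ +-cong (∑-cong (splits ys) (λ {(C , D)} _ →
            trans (*-congˡ (guard-suc (length C) g)) (*-assoc _ _ _))) (∑-splits-guard ys u g) ⟩
    (∑[ CD ∈ splits ys ] t * (pow t (length (proj₁ CD)) * i)) + (1# + r * i)
      ≈⟨ +-congʳ (trans (*-congˡ (∑-distribʳ i (splits ys) _)) (∑-distribˡ t (splits ys) _)) ⟨
    t * ((∑[ CD ∈ splits ys ] pow t (length (proj₁ CD))) * i) + (1# + r * i)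
      ≈⟨ +-congʳ (*-congˡ (*-congʳ (∑-splits-pow ys))) ⟩
    t * ((1# + r) * i) + (1# + r * i)
      ≈⟨ solve 3 (λ t r i → t :* ((con 1 :+ r) :* i) :+ (con 1 :+ r :* i)
                   := con 1 :+ (t :+ (con 1 :+ t) :* r) :* i) refl _ _ _ ⟩
    1# + (t + (1# + t) * r) * i
      ≈⟨ +-congˡ (*-congʳ (+-congˡ (*-congʳ q≈1+t))) ⟨
    1# + (t + q * r) * i ∎
    where
    i = guard 1 u g
    r = qm1 (length ys)
    guard-suc : ∀ k g → guard (suc k) u g ≈ guard 1 u g
    guard-suc k []      = refl
    guard-suc k (_ ∷ _) = refl

  crossAll : List (Fin N) → Fin N → Carrier
  crossAll U b = weight (λ a → e a b) U

  inversionWeight-++ : ∀ U g → inversionWeight (U ++ g)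
    ≈ inversionWeight U * (weight (crossAll U) g * inversionWeight g)
  inversionWeight-++ []      g = sym (trans (*-identityˡ _)
    (trans (*-congʳ (weight-const g)) (*-identityˡ _)))
  inversionWeight-++ (u ∷ U) g = begin
    cross u (U ++ g) * inversionWeight (U ++ g)
      ≈⟨ *-cong (weight-++ (e u) U g) (inversionWeight-++ U g) ⟩
    (cross u U * cross u g) * (inversionWeight U * (weight (crossAll U) g * inversionWeight g))
      ≈⟨ solve 5 (λ a b c d e → (a :* b) :* (c :* (d :* e)) := (a :* c) :* ((b :* d) :* e)) refl _ _ _ _ _ ⟩
    (cross u U * inversionWeight U) * ((cross u g * weight (crossAll U) g) * inversionWeight g)
      ≈⟨ *-congˡ (*-congʳ (weight-* (e u) (crossAll U) g)) ⟨
    _ ∎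

  -- The queue `U` acts on the later letters only by rescaling the weight of each letter `b` by
  -- `crossAll U b`, so `∑-cross` applies with the weights `w`.
  ∑-cross-queue : ∀ r U u →
    ∑[ g ∈ allFuns N r ] inversionWeight ((u ∷ U) ++ g) * monomial g
      ≈ ∑[ g ∈ allFuns N r ] ((cross u U * inversionWeight (U ++ g)) * monomial g)
                               * (1# + qm1 r * guard 1 u g)
  ∑-cross-queue r U u = begin
    ∑[ g ∈ allFuns N r ] inversionWeight ((u ∷ U) ++ g) * monomial g
      ≈⟨ ∑-cong (allFuns N r) (λ {g} _ → trans (*-congʳ (*-cong (weight-++ (e u) U g) (inversionWeight-++ U g)))
          (trans (solve 6 (λ a b c d e f → ((a :* b) :* (c :* (d :* e))) :* f := (a :* c) :* (((f :* d) :* e) :* b)) refl _ _ _ _ _ _)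
           (*-congˡ (*-congʳ (*-congʳ (sym (weight-* x (crossAll U) g))))))) ⟩
    ∑[ g ∈ allFuns N r ] y * ((weight w g * inversionWeight g) * cross u g)
      ≈⟨ ∑-distribˡ y (allFuns N r) _ ⟨
    y * (∑[ g ∈ allFuns N r ] (weight w g * inversionWeight g) * cross u g)
      ≈⟨ *-congˡ (∑-cross r w u) ⟩
    y * (∑[ g ∈ allFuns N r ] (weight w g * inversionWeight g) * (1# + qm1 r * guard 1 u g))
      ≈⟨ ∑-distribˡ y (allFuns N r) _ ⟩
    ∑[ g ∈ allFuns N r ] y * ((weight w g * inversionWeight g) * (1# + qm1 r * guard 1 u g))
      ≈⟨ ∑-cong (allFuns N r) (λ {g} _ → trans (*-congˡ (*-congʳ (*-congʳ (weight-* x (crossAll U) g))))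
          (trans (solve 6 (λ a c f d e z → (a :* c) :* (((f :* d) :* e) :* z) := ((a :* (c :* (d :* e))) :* f) :* z) refl _ _ _ _ _ _)
           (*-congʳ (*-congʳ (*-congˡ (sym (inversionWeight-++ U g))))))) ⟩
    _ ∎
    where
    y = cross u U * inversionWeight U
    w = λ b → x b * crossAll U b

  -- An empty queue never reaches a nonempty pool, so only `S = []` survives.
  complete-split-[] : (l : List A) →
    complete (length l)
      ≈ ∑[ (S , E) ∈ splits l ] (pow t (length S) * process (length S) 0 [] S) * complete (length E)
  complete-split-[] l = sym (trans (∑-cong (splits l) (λ {SE} _ → lemma (proj₁ SE) (proj₂ SE))) (∑-splits-[] l _))
    where
    lemma : ∀ S E → (pow t (length S) * process (length S) 0 [] S) * complete (length E)
                      ≈ (if null S then complete (length E) else 0#)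
    lemma []      E = solve 1 (λ z → (con 1 :* (((con 1 :* con 1) :+ con 0) :+ con 0)) :* z := z) refl _
    lemma (_ ∷ S) E = trans (*-congʳ (zeroʳ _)) (zeroˡ _)

  -- The word `g` is cut after the values of the children `C` of `u`; these values extend the queue
  -- and `D` is the next pool. Expanding again and reassociating the splittings rebuilds one step of
  -- the process at `u ∷ U`. The recursion runs on the number `f` of vertices in queue and pool,
  -- since the queue itself may grow.
  complete-split : ∀ f (U : List (Fin N)) (l : List A) → f ≡ length U ℕ.+ length l →
    ∑[ g ∈ allFuns N (length l) ] inversionWeight (U ++ g) * monomial g
      ≈ ∑[ (S , E) ∈ splits l ]
          (pow t (length S) * process (length U ℕ.+ length S) (length U) U S) * complete (length E)
  complete-split f       []      l eq = complete-split-[] l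
  complete-split (suc f) (u ∷ U) l eq = begin
    _ ≈⟨ ∑-cross-queue (length l) U u ⟩
    ∑[ g ∈ allFuns N (length l) ] Z g * (1# + qm1 (length l) * guard 1 u g)
      ≈⟨ ∑-cong (allFuns N (length l)) (λ {g} _ →
           trans (*-congˡ (sym (∑-splits-guard l u g))) (∑-distribˡ (Z g) (splits l) _)) ⟩
    ∑[ g ∈ allFuns N (length l) ] ∑[ (C , D) ∈ splits l ] Z g * (pow t (length C) * guard (length C) u g)
      ≈⟨ ∑-swap (allFuns N (length l)) (splits l) _ ⟩
    ∑[ (C , D) ∈ splits l ] ∑[ g ∈ allFuns N (length l) ] Z g * (pow t (length C) * guard (length C) u g)
      ≈⟨ ∑-splits-cong l pop ⟩
    ∑[ (C , D) ∈ splits l ] ∑[ (S , E) ∈ splits D ] Y C S E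
      ≈⟨ ∑-splits-assoc l Y ⟨
    ∑[ (S , E) ∈ splits l ] ∑[ (C , S′) ∈ splits S ] Y C S′ E
      ≈⟨ ∑-cong (splits l) (λ {(S , E)} _ → collect S E) ⟨
    _ ∎
    where
    Z : List (Fin N) → Carrier
    Z g = (cross u U * inversionWeight (U ++ g)) * monomial g

    G : List A → List (Fin N) → Carrier
    G C g = (guard (length C) u g * cross u U) * monomial g

    P : List A → List A → List (Fin N) → Carrier
    P C S g = process (length U ℕ.+ length C ℕ.+ length S) (length U ℕ.+ length C) (U ++ g) S

    Y : List A → List A → List A → Carrier
    Y C S E = ∑[ g ∈ allFuns N (length C) ]
      (pow t (length C) * G C g) * ((pow t (length S) * P C S g) * complete (length E))

    collect : ∀ S E →
      (pow t (length S) * process (suc (length U ℕ.+ length S)) (suc (length U)) (u ∷ U) S) * complete (length E)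
        ≈ ∑[ (C , S′) ∈ splits S ] Y C S′ E
    collect S E = begin
      _ ≈⟨ *-congʳ (*-congˡ (process-step (length U ℕ.+ length S) u U S)) ⟩
      _ ≈⟨ *-congʳ (∑-distribˡ _ (splits S) _) ⟩
      _ ≈⟨ ∑-distribʳ _ (splits S) _ ⟩
      _ ≈⟨ ∑-splits-cong S (λ {C} {S′} sp → trans (*-congʳ (∑-distribˡ _ (allFuns N (length C)) _))
             (trans (∑-distribʳ _ (allFuns N (length C)) _)
               (∑-cong (allFuns N (length C)) (λ {g} _ → regroup C S′ g sp)))) ⟩
      _ ∎
      where
      regroup : ∀ C S′ g → Interleaving C S′ S →
        (pow t (length S) * (G C g * process (length U ℕ.+ length S) (length U ℕ.+ length C) (U ++ g) S′)) * complete (length E)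
          ≈ (pow t (length C) * G C g) * ((pow t (length S′) * P C S′ g) * complete (length E))
      regroup C S′ g sp = trans
        (*-congʳ (*-cong (trans (reflexive (cong (pow t) (≡.sym (interleaving-length sp)))) (pow-+ t (length C) _))
          (*-congˡ (reflexive (cong (λ f′ → process f′ (length U ℕ.+ length C) (U ++ g) S′)
          (≡.trans (cong (length U ℕ.+_) (≡.sym (interleaving-length sp))) (≡.sym (ℕ.+-assoc (length U) (length C) (length S′)))))))))
        (solve 5 (λ a b c d e → ((a :* b) :* (c :* d)) :* e := (a :* c) :* ((b :* d) :* e)) refl _ _ _ _ _)

    pop : ∀ {C D} → Interleaving C D l →
      ∑[ g ∈ allFuns N (length l) ] Z g * (pow t (length C) * guard (length C) u g)
        ≈ ∑[ (S , E) ∈ splits D ] Y C S E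
    pop {C} {D} sp = begin
      ∑[ g ∈ allFuns N (length l) ] Z g * (pow t (length C) * guard (length C) u g)
        ≡⟨ cong (λ r → ∑[ g ∈ allFuns N r ] Z g * (pow t (length C) * guard (length C) u g)) (interleaving-length sp) ⟨
      ∑[ g ∈ allFuns N (length C ℕ.+ length D) ] Z g * (pow t (length C) * guard (length C) u g)
        ≈⟨ ∑-allFuns-+ N (length C) (length D) _ ⟩
      ∑[ g ∈ allFuns N (length C) ] ∑[ h ∈ allFuns N (length D) ] Z (g ++ h) * (pow t (length C) * guard (length C) u (g ++ h))
        ≈⟨ ∑-cong (allFuns N (length C)) (λ {g} g∈ → trans
             (∑-cong (allFuns N (length D)) (λ {h} _ → factor g h (allFuns-length N _ g∈)))
             (sym (∑-distribˡ _ (allFuns N (length D)) _))) ⟩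
      ∑[ g ∈ allFuns N (length C) ] (pow t (length C) * G C g) *
        (∑[ h ∈ allFuns N (length D) ] inversionWeight ((U ++ g) ++ h) * monomial h)
        ≈⟨ ∑-cong (allFuns N (length C)) (λ {g} g∈ → *-congˡ (next g (allFuns-length N _ g∈))) ⟩
      ∑[ g ∈ allFuns N (length C) ] (pow t (length C) * G C g) *
        (∑[ (S , E) ∈ splits D ] (pow t (length S) * P C S g) * complete (length E))
        ≈⟨ ∑-cong (allFuns N (length C)) (λ _ → ∑-distribˡ _ (splits D) _) ⟩
      _ ≈⟨ ∑-swap (allFuns N (length C)) (splits D) _ ⟩
      _ ∎
      where
      factor : ∀ g h → length g ≡ length C →
        Z (g ++ h) * (pow t (length C) * guard (length C) u (g ++ h))
          ≈ (pow t (length C) * G C g) * (inversionWeight ((U ++ g) ++ h) * monomial h)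
      factor g h |g| rewrite ≡.sym |g| | guard-++ u g h | List.++-assoc U g h =
        trans (*-congʳ (*-congˡ (weight-++ x g h)))
          (solve 6 (λ c i mg mh p d → ((c :* i) :* (mg :* mh)) :* (p :* d)
             := (p :* ((d :* c) :* mg)) :* (i :* mh)) refl _ _ _ _ _ _)

      queue-length : ∀ g → length g ≡ length C → length (U ++ g) ≡ length U ℕ.+ length C
      queue-length g |g| = ≡.trans (List.length-++ U) (cong (length U ℕ.+_) |g|)

      next : ∀ g → length g ≡ length C →
        ∑[ h ∈ allFuns N (length D) ] inversionWeight ((U ++ g) ++ h) * monomial h
          ≈ ∑[ (S , E) ∈ splits D ] (pow t (length S) * P C S g) * complete (length E)
      next g |g| = trans
        (complete-split f (U ++ g) D (≡.trans (ℕ.suc-injective eq)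
          (≡.trans (cong (length U ℕ.+_) (≡.sym (interleaving-length sp)))
            (≡.trans (≡.sym (ℕ.+-assoc (length U) _ _)) (cong (ℕ._+ length D) (≡.sym (queue-length g |g|)))))))
        (reflexive (cong (λ k → ∑[ (S , E) ∈ splits D ] (pow t (length S) * process (k ℕ.+ length S) k (U ++ g) S) * complete (length E))
          (queue-length g |g|)))

  -- For l of length n - 1 this is the common value of the three sides of the theorem.
  bfsSum : List A → Carrier
  bfsSum l = ∑[ as ∈ degreeSeqs (suc (length l)) 1 l ]
               ∑[ v ∈ allFuns N (suc (length l)) ] degreeWeight 1 as v * monomial v

  -- The case of a queue with one vertex, the first letter of the word. Its own variable `x a` is
  -- not part of `process` and is supplied here.
  complete-suc : (l : List A) →
    complete (suc (length l)) ≈ ∑[ (S , E) ∈ splits l ] (pow t (length S) * bfsSum S) * complete (length E)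
  complete-suc l = begin
    _ ≈⟨ ∑-allFuns-suc N (length l) _ ⟩
    ∑[ a ∈ allFin N ] ∑[ g ∈ allFuns N (length l) ] inversionWeight (a ∷ g) * (x a * monomial g)
      ≈⟨ ∑-cong (allFin N) (λ {a} _ → trans (∑-cong (allFuns N (length l)) (λ {g} _ →
           solve 3 (λ a b c → a :* (b :* c) := b :* (a :* c)) refl _ _ _))
           (sym (∑-distribˡ (x a) (allFuns N (length l)) _))) ⟩
    ∑[ a ∈ allFin N ] x a * (∑[ g ∈ allFuns N (length l) ] inversionWeight (a ∷ g) * monomial g)
      ≈⟨ ∑-cong (allFin N) (λ {a} _ → trans (*-congˡ (complete-split _ (a ∷ []) l ≡.refl)) (∑-distribˡ (x a) (splits l) _)) ⟩
    ∑[ a ∈ allFin N ] ∑[ (S , E) ∈ splits l ]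
      x a * ((pow t (length S) * process (suc (length S)) 1 (a ∷ []) S) * complete (length E))
      ≈⟨ ∑-swap (allFin N) (splits l) _ ⟩
    _ ≈⟨ ∑-cong (splits l) (λ {(S , E)} _ → trans
           (∑-cong (allFin N) (λ _ → solve 4 (λ x p f c → x :* ((p :* f) :* c) := p :* (x :* f) :* c) refl _ _ _ _))
           (trans (sym (∑-distribʳ _ (allFin N) _)) (*-congʳ (trans (sym (∑-distribˡ _ (allFin N) _)) (*-congˡ (root S)))))) ⟩
    _ ∎
    where
    root : ∀ S → ∑[ a ∈ allFin N ] x a * process (suc (length S)) 1 (a ∷ []) S ≈ bfsSum S
    root S = begin
      _ ≈⟨ ∑-cong (allFin N) (λ {a} _ → trans (∑-distribˡ _ degs _) (∑-cong degs (λ _ → ∑-distribˡ _ (allFuns N (length S)) _))) ⟩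
      _ ≈⟨ ∑-swap (allFin N) degs _ ⟩
      _ ≈⟨ ∑-cong degs (λ _ → trans (∑-cong (allFin N) (λ _ → ∑-cong (allFuns N (length S)) (λ _ →
             solve 3 (λ a b c → a :* (b :* c) := b :* (a :* c)) refl _ _ _))) (sym (∑-allFuns-suc N (length S) _))) ⟩
      _ ∎
      where degs = degreeSeqs (suc (length S)) 1 S

-- Subsets of `Fin n` as sublists of `allFin n`

=ᶠ-refl : (i : Fin n) → (i =ᶠ i) ≡ true
=ᶠ-refl i with i Fin.≟ i
... | yes _  = ≡.refl
... | no i≢i = ⊥-elim (i≢i ≡.refl)

=ᶠ-≢ : {i j : Fin n} → i ≢ j → (i =ᶠ j) ≡ false
=ᶠ-≢ {i = i} {j} i≢j with i Fin.≟ j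
... | yes i≡j = ⊥-elim (i≢j i≡j)
... | no _    = ≡.refl

=ᶠ⇒≡ : {i j : Fin n} → (i =ᶠ j) ≡ true → i ≡ j
=ᶠ⇒≡ {i = i} {j} eq with i Fin.≟ j
... | yes i≡j = i≡j

member : List (Fin n) → Fin n → Bool
member C i = any (λ j → i =ᶠ j) C

∈⇒member : {i : Fin n} {C : List (Fin n)} → i ∈ C → member C i ≡ true
∈⇒member {i = i} (here ≡.refl) rewrite =ᶠ-refl i = ≡.refl
∈⇒member {i = i} {j ∷ C} (there i∈C) with i =ᶠ j
... | true  = ≡.refl
... | false = ∈⇒member i∈C

member⇒∈ : {i : Fin n} (C : List (Fin n)) → member C i ≡ true → i ∈ C
member⇒∈ {i = i} (j ∷ C) eq with i =ᶠ j in i=j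
... | true  = here (=ᶠ⇒≡ i=j)
... | false = there (member⇒∈ C eq)

∉⇒member : {i : Fin n} (C : List (Fin n)) → i ∉ C → member C i ≡ false
∉⇒member C i∉C = Bool.¬-not (λ eq → i∉C (member⇒∈ C eq))

filterᵇ-cong : {p p′ : A → Bool} (l : List A) → (∀ {a} → a ∈ l → p a ≡ p′ a) →
               filterᵇ p l ≡ filterᵇ p′ l
filterᵇ-cong []       eq = ≡.refl
filterᵇ-cong {p = p} {p′} (a ∷ l) eq with p a | p′ a | eq (here ≡.refl)
... | true  | _ | ≡.refl = cong (a ∷_) (filterᵇ-cong l (eq ∘ there))
... | false | _ | ≡.refl = filterᵇ-cong l (eq ∘ there)

filterᵇ-member : {D l : List (Fin n)} → Unique l → D ⊆ l → filterᵇ (member D) l ≡ D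
filterᵇ-member []       []              = ≡.refl
filterᵇ-member {D = D} (y∉ ∷ u) (y ∷ʳ s)
  rewrite ∉⇒member D (λ y∈D → All.lookup y∉ (lookup s y∈D) ≡.refl) = filterᵇ-member u s
filterᵇ-member {D = y ∷ D} (y∉ ∷ u) (≡.refl ∷ s)
  rewrite =ᶠ-refl y = cong (y ∷_) (≡.trans (filterᵇ-cong _ skip) (filterᵇ-member u s))
  where
  skip : ∀ {i} → i ∈ _ → member (y ∷ D) i ≡ member D i
  skip i∈l rewrite =ᶠ-≢ (All.lookup y∉ i∈l ∘ ≡.sym) = ≡.refl

-- Order is what could be lost: listing a subset returns its elements in increasing order, and a
-- sublist of `allFin n` is already in that order.
elems-toSubset : {C : List (Fin n)} → C ⊆ allFin n → elems (toSubset C) ≡ C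
elems-toSubset {n} {C} C⊆ = ≡.trans
  (filterᵇ-cong (allFin n) (λ {i} _ → Vec.lookup∘tabulate (member C) i))
  (filterᵇ-member (allFin⁺ n) C⊆)

toSubset-nonempty : (i : Fin n) (C : List (Fin n)) → Nonempty (toSubset (i ∷ C))
toSubset-nonempty i C = i , Vec.lookup⇒[]= i (toSubset (i ∷ C))
  (≡.trans (Vec.lookup∘tabulate (member (i ∷ C)) i) (∈⇒member {i = i} {i ∷ C} (here ≡.refl)))

tabulate-true : (f : Fin n → Bool) → (∀ i → f i ≡ true) → Vec.tabulate f ≡ ⊤
tabulate-true {zero}  f eq = ≡.refl
tabulate-true {suc n} f eq = cong₂ Vec._∷_ (eq Fin.zero) (tabulate-true (f ∘ Fin.suc) (eq ∘ Fin.suc))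

toSubset-allFin : toSubset (allFin n) ≡ ⊤
toSubset-allFin {n} = tabulate-true _ (λ i → ∈⇒member {i = i} (∈-allFin i))

interleaving-⊆ˡ : {C D l : List A} → Interleaving C D l → C ⊆ l
interleaving-⊆ˡ []         = []
interleaving-⊆ˡ (consˡ sp) = ≡.refl ∷ interleaving-⊆ˡ sp
interleaving-⊆ˡ (consʳ sp) = _ ∷ʳ interleaving-⊆ˡ sp

interleaving-⊆ʳ : {C D l : List A} → Interleaving C D l → D ⊆ l
interleaving-⊆ʳ []         = []
interleaving-⊆ʳ (consˡ sp) = _ ∷ʳ interleaving-⊆ʳ sp
interleaving-⊆ʳ (consʳ sp) = ≡.refl ∷ interleaving-⊆ʳ sp

-- Set partitions

inserts : A → List (List A) → List (List (List A))
inserts y p = ([ y ] ∷ p) ∷ insertEach y p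

picks : List (List A) → List (List A × List (List A))
picks []      = []
picks (b ∷ p) = (b , p) ∷ map (map₂ (b ∷_)) (picks p)

-- A marked block of a partition; the empty block stands for a block still to be created.
marks : List (List A) → List (List A × List (List A))
marks p = ([] , p) ∷ picks p

-- For a set partition this is the number of elements minus the number of blocks, the exponent of q
-- - 1 in the definition of cumulants.
excess : List (List A) → ℕ
excess []      = 0
excess (b ∷ p) = (length b ∸ 1) ℕ.+ excess p

-- Nonempty blocks belong to the invariant because of the truncated subtraction in `excess`: an
-- element added to an empty block would not change the excess.
PartitionOf : ℕ → List (List A) → Set
PartitionOf r p = All (λ b → 0 ℕ.< length b) p × r ≡ length p ℕ.+ excess p

insertEach-partition : (y : A) {r : ℕ} (p : List (List A)) → PartitionOf r p →
  ∀ {p′} → p′ ∈ insertEach y p → PartitionOf (suc r) p′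
insertEach-partition y ((a ∷ b) ∷ p) (b>0 ∷ p>0 , eq) (here ≡.refl) =
  (s≤s z≤n ∷ p>0) , ≡.trans (cong suc eq) (≡.sym (ℕ.+-suc (suc (length p)) _))
insertEach-partition y (b ∷ p) (b>0 ∷ p>0 , eq) (there p′∈) with ∈-map⁻ (b ∷_) p′∈
... | p″ , p″∈ , ≡.refl with insertEach-partition y p (p>0 , ≡.refl) p″∈
...   | p″>0 , eq″ = (b>0 ∷ p″>0) , (begin
  suc _                                                   ≡⟨ cong suc eq ⟩
  suc (suc (length p ℕ.+ (k ℕ.+ excess p)))               ≡⟨ cong (suc ∘ suc) (x∙yz≈y∙xz (length p) k (excess p)) ⟩
  suc (suc (k ℕ.+ (length p ℕ.+ excess p)))               ≡⟨ cong suc (ℕ.+-suc k _) ⟨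
  suc (k ℕ.+ suc (length p ℕ.+ excess p))                 ≡⟨ cong (λ s → suc (k ℕ.+ s)) eq″ ⟩
  suc (k ℕ.+ (length p″ ℕ.+ excess p″))                   ≡⟨ cong suc (x∙yz≈y∙xz k (length p″) (excess p″)) ⟩
  suc (length p″ ℕ.+ (k ℕ.+ excess p″))                   ∎)
  where
  open ≡.≡-Reasoning
  open import Algebra.Properties.CommutativeSemigroup ℕ.+-commutativeSemigroup using (x∙yz≈y∙xz)
  k = length b ∸ 1

setPartitions-partition : (l : List A) → ∀ {p} → p ∈ setPartitions l → PartitionOf (length l) p
setPartitions-partition []       (here ≡.refl) = [] , ≡.refl
setPartitions-partition (y ∷ ys) p∈
  with find (∈-concatMap⁻ (inserts y) {xs = setPartitions ys} p∈)
... | p′ , p′∈ , here ≡.refl = map₁ (s≤s z≤n ∷_) (map₂ (cong suc) (setPartitions-partition ys p′∈))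
... | p′ , p′∈ , there p∈′   = insertEach-partition y p′ (setPartitions-partition ys p′∈) p∈′

module Partitions {c ℓ : Level} (R : CommutativeRing c ℓ) where
  open CommutativeRing R
  open Sums R
  open SetoidReasoning setoid
  open NatSolver commutativeSemiring using (solve; _:=_; _:+_; _:*_; con)

  ∑-picks-insertEach : (y : A) (p : List (List A)) (f : List A → List (List A) → Carrier) →
    ∑[ r ∈ insertEach y p ] ∑[ (b , s) ∈ picks r ] f b s
      ≈ ∑[ (b , r) ∈ picks p ] (f (y ∷ b) r + (∑[ s ∈ insertEach y r ] f b s))
  ∑-picks-insertEach y []      f = refl
  ∑-picks-insertEach y (b ∷ p) f = begin
    _ ≈⟨ +-cong (+-congˡ (∑-map _ (picks p) _)) (∑-map _ (insertEach y p) _) ⟩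
    _ ≈⟨ +-congˡ (∑-cong (insertEach y p) (λ {r} _ → +-congˡ (∑-map _ (picks r) _))) ⟩
    _ ≈⟨ +-congˡ (∑-+ (insertEach y p) _ _) ⟨
    _ ≈⟨ +-congˡ (+-congˡ (∑-picks-insertEach y p (λ b′ r → f b′ (b ∷ r)))) ⟩
    (f (y ∷ b) p + s₁) + (s₂ + (∑[ (b′ , r) ∈ picks p ] (f (y ∷ b′) (b ∷ r) + (∑[ s ∈ insertEach y r ] f b′ (b ∷ s)))))
      ≈⟨ solve 4 (λ a b c d → (a :+ b) :+ (c :+ d) := (a :+ c) :+ (b :+ d)) refl _ _ _ _ ⟩
    (f (y ∷ b) p + s₂) + (s₁ + (∑[ (b′ , r) ∈ picks p ] (f (y ∷ b′) (b ∷ r) + (∑[ s ∈ insertEach y r ] f b′ (b ∷ s)))))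
      ≈⟨ +-congˡ (∑-+ (picks p) _ _) ⟩
    _ ≈⟨ +-congˡ (∑-cong (picks p) (λ {(b′ , r)} _ → trans
           (solve 3 (λ a b c → a :+ (b :+ c) := b :+ (a :+ c)) refl _ _ _)
           (+-congˡ (+-congˡ (sym (∑-map (b ∷_) (insertEach y r) (f b′))))))) ⟩
    _ ≈⟨ +-congˡ (∑-map _ (picks p) _) ⟨
    _ ∎
    where
    s₁ = ∑[ (b′ , r) ∈ picks p ] f b′ ((y ∷ b) ∷ r)
    s₂ = ∑[ r ∈ insertEach y p ] f b r

  -- Inserting `y` commutes with marking a block: `y` enters either the marked block or the rest.
  -- The mark `[]` makes the new singleton `[ y ]` an instance of the first case.
  ∑-marks-inserts : (y : A) (p : List (List A)) (f : List A → List (List A) → Carrier) →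
    ∑[ r ∈ inserts y p ] ∑[ (b , s) ∈ marks r ] f b s
      ≈ ∑[ (b , r) ∈ marks p ] (f (y ∷ b) r + (∑[ s ∈ inserts y r ] f b s))
  ∑-marks-inserts y p f = begin
    _ ≈⟨ +-cong (+-congˡ (+-congˡ (∑-map _ (picks p) _)))
           (trans (sym (∑-+ (insertEach y p) _ _)) (+-congˡ (∑-picks-insertEach y p f))) ⟩
    (a₁ + (a₂ + s₁)) + (s₂ + (∑[ (b , r) ∈ picks p ] (f (y ∷ b) r + (∑[ s ∈ insertEach y r ] f b s))))
      ≈⟨ solve 5 (λ a b c d e → (a :+ (b :+ c)) :+ (d :+ e) := (b :+ (a :+ d)) :+ (c :+ e)) refl _ _ _ _ _ ⟩
    (a₂ + (a₁ + s₂)) + (s₁ + (∑[ (b , r) ∈ picks p ] (f (y ∷ b) r + (∑[ s ∈ insertEach y r ] f b s))))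
      ≈⟨ +-congˡ (trans (∑-+ (picks p) _ _) (∑-cong (picks p) (λ _ →
           solve 3 (λ a b c → a :+ (b :+ c) := b :+ (a :+ c)) refl _ _ _))) ⟩
    _ ∎
    where
    a₁ = f [] ([ y ] ∷ p)
    a₂ = f [ y ] p
    s₁ = ∑[ (b , r) ∈ picks p ] f b ([ y ] ∷ r)
    s₂ = ∑[ r ∈ insertEach y p ] f [] r

  ∑-marks-setPartitions : (l : List A) (f : List A → List (List A) → Carrier) →
    ∑[ p ∈ setPartitions l ] ∑[ (b , r) ∈ marks p ] f b r
      ≈ ∑[ (C , D) ∈ splits l ] ∑[ p ∈ setPartitions D ] f C p
  ∑-marks-setPartitions []       f = refl
  ∑-marks-setPartitions (y ∷ ys) f = begin
    _ ≈⟨ ∑-concatMap (inserts y) (setPartitions ys) _ ⟩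
    _ ≈⟨ ∑-cong (setPartitions ys) (λ {p} _ → ∑-marks-inserts y p f) ⟩
    _ ≈⟨ ∑-marks-setPartitions ys (λ b r → f (y ∷ b) r + (∑[ s ∈ inserts y r ] f b s)) ⟩
    _ ≈⟨ ∑-cong (splits ys) (λ {CD} _ → ∑-+ (setPartitions (proj₂ CD)) _ _) ⟨
    _ ≈⟨ ∑-+ (splits ys) _ _ ⟨
    _ ≈⟨ +-congˡ (∑-cong (splits ys) (λ {CD} _ → ∑-concatMap (inserts y) (setPartitions (proj₂ CD)) _)) ⟨
    _ ≈⟨ ∑-splits-∷ y ys _ ⟨
    _ ∎

  blockProd : (List A → Carrier) → List (List A) → Carrier
  blockProd w p = ∏ p w

  ∑-insertEach-prod : (w : List A → Carrier) (y : A) (p : List (List A)) →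
    ∑ (insertEach y p) (blockProd w) ≈ ∑[ (b , r) ∈ picks p ] w (y ∷ b) * blockProd w r
  ∑-insertEach-prod w y []      = refl
  ∑-insertEach-prod w y (b ∷ p) = +-congˡ (begin
    _ ≈⟨ ∑-map (b ∷_) (insertEach y p) _ ⟩
    _ ≈⟨ ∑-distribˡ (w b) (insertEach y p) _ ⟨
    _ ≈⟨ *-congˡ (∑-insertEach-prod w y p) ⟩
    _ ≈⟨ ∑-distribˡ (w b) (picks p) _ ⟩
    _ ≈⟨ ∑-cong (picks p) (λ _ → solve 3 (λ a b c → a :* (b :* c) := b :* (a :* c)) refl _ _ _) ⟩
    _ ≈⟨ ∑-map _ (picks p) _ ⟨
    _ ∎)

  -- Removing `y` from its block leaves a marked partition of `ys`, with mark `[]` if `y` was alone,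
  -- so `∑-marks-setPartitions` applies.
  ∑-setPartitions-∷ : (w : List A → Carrier) (y : A) (ys : List A) →
    ∑ (setPartitions (y ∷ ys)) (blockProd w)
      ≈ ∑[ (C , D) ∈ splits ys ] w (y ∷ C) * ∑ (setPartitions D) (blockProd w)
  ∑-setPartitions-∷ w y ys = begin
    _ ≈⟨ ∑-concatMap (inserts y) (setPartitions ys) _ ⟩
    _ ≈⟨ ∑-cong (setPartitions ys) (λ {p} _ → +-congˡ (∑-insertEach-prod w y p)) ⟩
    _ ≈⟨ ∑-marks-setPartitions ys (λ b r → w (y ∷ b) * blockProd w r) ⟩
    _ ≈⟨ ∑-cong (splits ys) (λ {CD} _ → ∑-distribˡ _ (setPartitions (proj₂ CD)) _) ⟨
    _ ∎

  +-cancelʳ : ∀ {a b d} → a + d ≈ b + d → a ≈ b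
  +-cancelʳ {a} {b} {d} eq = begin
    a              ≈⟨ drop′ a ⟨
    (a + d) - d    ≈⟨ +-congʳ eq ⟩
    (b + d) - d    ≈⟨ drop′ b ⟩
    b              ∎
    where
    drop′ : ∀ z → (z + d) - d ≈ z
    drop′ z = trans (+-assoc z d _) (trans (+-congˡ (-‿inverseʳ d)) (+-identityʳ z))

  -- The splittings that send the head to the right have a shorter left part, so their terms agree
  -- and can be subtracted. Repeating this down the list leaves only the splitting with everything
  -- on the left.
  splits-cancel : (l : List A) (f g : List A → List A → Carrier) →
    ∑[ (C , D) ∈ splits l ] f C D ≈ ∑[ (C , D) ∈ splits l ] g C D →
    (∀ {C D} → Interleaving C D l → length C ℕ.< length l → f C D ≈ g C D) →
    f l [] ≈ g l []
  splits-cancel []       f g eq _   = trans (sym (+-identityʳ _)) (trans eq (+-identityʳ _))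
  splits-cancel (y ∷ ys) f g eq f≈g = splits-cancel ys (f ∘ (y ∷_)) (g ∘ (y ∷_))
    (+-cancelʳ (begin
      _ ≈⟨ ∑-splits-∷ y ys _ ⟨
      _ ≈⟨ eq ⟩
      _ ≈⟨ ∑-splits-∷ y ys _ ⟩
      _ ≈⟨ +-congˡ (∑-splits-cong ys (λ sp → sym (f≈g (consʳ sp) (s≤s (length≤ sp))))) ⟩
      _ ∎))
    (λ sp lt → f≈g (consˡ sp) (s≤s lt))
    where
    length≤ : ∀ {C D} → Interleaving C D ys → length C ℕ.≤ length ys
    length≤ {C} sp = subst (length C ℕ.≤_) (interleaving-length sp) (ℕ.m≤m+n _ _)

-- The recursion satisfied by cumulants

module Cumulant {c ℓ : Level} (R : CommutativeRing c ℓ) (q : CommutativeRing.Carrier R)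
               (N : ℕ) (x : Fin N → CommutativeRing.Carrier R) where
  open CommutativeRing R
  open Poly R q N x
  open Sums R
  open Partitions R
  open Process R q N x
  open SetoidReasoning setoid
  open NatSolver commutativeSemiring using (solve; _:=_; _:+_; _:*_; con)

  pow-cancel : (∀ a b → t * a ≈ t * b → a ≈ b) → ∀ r {a b} → pow t r * a ≈ pow t r * b → a ≈ b
  pow-cancel reg zero    eq = trans (sym (*-identityˡ _)) (trans eq (*-identityˡ _))
  pow-cancel reg (suc r) eq = pow-cancel reg r (reg _ _ (trans (sym (*-assoc _ _ _)) (trans eq (*-assoc _ _ _))))

  module _ {n : ℕ} (κ : Subset n → Carrier) where
    -- Sharing out (q-1)^(|B|-|π|) as one factor per element of a block except one makes the
    -- defining relation multiplicative over blocks.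
    blockWeight : List (Fin n) → Carrier
    blockWeight C = pow t (length C ∸ 1) * κ (toSubset C)

    blockProd-blockWeight : ∀ p →
      blockProd blockWeight p ≈ pow t (excess p) * prodR (map (λ C → κ (toSubset C)) p)
    blockProd-blockWeight []      = sym (*-identityˡ 1#)
    blockProd-blockWeight (C ∷ p) = trans (*-congˡ (blockProd-blockWeight p)) (trans
      (solve 4 (λ a b c d → (a :* b) :* (c :* d) := (a :* c) :* (b :* d)) refl _ _ _ _)
      (*-congʳ (sym (pow-+ t (length C ∸ 1) (excess p)))))

    module _ (isκ : IsCumulant n κ) where
      -- The defining relation of `κ`, extended to the empty list, where both sides are 1. The
      -- extension is needed because the complement of the first block may be empty.
      ∑-partitions-complete : ∀ D → D ⊆ allFin n →
        ∑ (setPartitions D) (blockProd blockWeight) ≈ complete (length D)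
      ∑-partitions-complete []      _  = +-congʳ (sym (*-identityˡ 1#))
      ∑-partitions-complete D@(i ∷ D′) D⊆ = begin
        ∑ (setPartitions D) (blockProd blockWeight)
          ≈⟨ ∑-cong (setPartitions D) (λ {p} p∈ → trans (blockProd-blockWeight p)
               (*-congʳ (reflexive (cong (pow t) (excess≡ (setPartitions-partition D p∈)))))) ⟩
        ∑[ p ∈ setPartitions D ] pow t (length D ∸ length p) * prodR (map (λ C → κ (toSubset C)) p)
          ≡⟨ cong (λ E → ∑[ p ∈ setPartitions E ] pow t (length E ∸ length p) * prodR (map (λ C → κ (toSubset C)) p))
                  (elems-toSubset D⊆) ⟨
        _ ≈⟨ isκ (toSubset D) (toSubset-nonempty i D′) ⟨
        LLTset (toSubset D)
          ≡⟨ cong (λ E → ∑[ g ∈ allFuns N (length E) ] pow q (invList (map toℕ g)) * monomial g) (elems-toSubset D⊆) ⟩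
        ∑[ g ∈ allFuns N (length D) ] pow q (invList (map toℕ g)) * monomial g
          ≈⟨ ∑-cong (allFuns N (length D)) (λ {g} _ → *-congʳ (pow-invList g)) ⟩
        complete (length D) ∎
        where
        excess≡ : ∀ {p} → PartitionOf (length D) p → excess p ≡ length D ∸ length p
        excess≡ {p} (_ , eq) = ≡.trans (≡.sym (ℕ.m+n∸m≡n (length p) (excess p))) (cong (_∸ length p) (≡.sym eq))

      complete-suc-κ : ∀ i C → (i ∷ C) ⊆ allFin n →
        complete (suc (length C))
          ≈ ∑[ (S , E) ∈ splits C ] (pow t (length S) * κ (toSubset (i ∷ S))) * complete (length E)
      complete-suc-κ i C iC⊆ = begin
        _ ≈⟨ ∑-partitions-complete (i ∷ C) iC⊆ ⟨
        _ ≈⟨ ∑-setPartitions-∷ blockWeight i C ⟩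
        _ ≈⟨ ∑-splits-cong C (λ {S} {E} sp → *-congˡ (∑-partitions-complete E
               (⊆-trans (interleaving-⊆ʳ sp) (⊆-trans (i ∷ʳ ⊆-refl) iC⊆)))) ⟩
        _ ∎

      -- `complete-suc` and `complete-suc-κ` are the same recursion. By strong induction on the
      -- length of `C` their terms agree for all proper sublists, `splits-cancel` isolates the top
      -- term, and its factor (q-1)^|C| is cancelled.
      κ≈bfsSum : (∀ a b → t * a ≈ t * b → a ≈ b) →
        ∀ f i C → length C ℕ.≤ f → (i ∷ C) ⊆ allFin n → κ (toSubset (i ∷ C)) ≈ bfsSum C
      κ≈bfsSum reg f i C C≤f iC⊆ = pow-cancel reg (length C)
        (trans (sym (trans (*-congˡ complete-0) (*-identityʳ _)))
          (trans (splits-cancel C _ _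
             (trans (sym (complete-suc-κ i C iC⊆)) (complete-suc C)) (smaller f C≤f))
            (trans (*-congˡ complete-0) (*-identityʳ _))))
        where
        complete-0 : complete 0 ≈ 1#
        complete-0 = trans (+-identityʳ _) (*-identityˡ _)

        smaller : ∀ f → length C ℕ.≤ f → ∀ {S E} → Interleaving S E C → length S ℕ.< length C →
          (pow t (length S) * κ (toSubset (i ∷ S))) * complete (length E)
            ≈ (pow t (length S) * bfsSum S) * complete (length E)
        smaller zero    C≤f sp lt = ⊥-elim (ℕ.n≮0 (ℕ.<-≤-trans lt C≤f))
        smaller (suc f) C≤f sp lt = *-congʳ (*-congˡ (κ≈bfsSum reg f i _
          (ℕ.≤-pred (ℕ.<-≤-trans lt C≤f)) (⊆-trans (≡.refl ∷ interleaving-⊆ˡ sp) iC⊆)))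

-- Parking functions

counts : (M : ℕ) → List (Fin M) → List ℕ
counts M f = map (λ i → count (λ c → toℕ c ≡ᵇ i) f) (upTo M)

positive : ℕ → Bool
positive zero    = false
positive (suc _) = true

-- For degrees in search order and initial `h = 1`, the height of a column is the position just past
-- the queue, where the first child of the vertex would stand; the flag says whether there is one.
columnsOf : ℕ → List ℕ → List (ℕ × Bool)
columnsOf h []       = []
columnsOf h (a ∷ as) = (h , positive a) ∷ columnsOf (h ℕ.+ a) as

runs : List ℕ → List Step
runs = concatMap (λ a → replicate a nS ++ [ eS ])

mergeEN-north : ∀ a s → mergeEN (replicate a nS ++ s) ≡ replicate a nS ++ mergeEN s
mergeEN-north zero    s = ≡.refl
mergeEN-north (suc a) s = cong (nS ∷_) (mergeEN-north a s)

columns-north : ∀ h a s → columns h (replicate a nS ++ s) ≡ columns (h ℕ.+ a) s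
columns-north h zero    s = cong (λ h′ → columns h′ s) (≡.sym (ℕ.+-identityʳ h))
columns-north h (suc a) s = ≡.trans (columns-north (suc h) a s) (cong (λ h′ → columns h′ s) (≡.sym (ℕ.+-suc h a)))

-- An east step becomes diagonal exactly when the following run of north steps is nonempty. So each
-- column goes with the run after it: the initial `eS` takes the first run, and the last east step
-- takes the appended run of length 0.
columns-runs : ∀ h as → columns h (mergeEN (eS ∷ runs as)) ≡ columnsOf h (as ++ [ 0 ])
columns-runs h []           = ≡.refl
columns-runs h (zero ∷ as)  = cong ((h , false) ∷_)
  (≡.trans (columns-runs h as) (cong (λ h′ → columnsOf h′ (as ++ [ 0 ])) (≡.sym (ℕ.+-identityʳ h))))
columns-runs h (suc a ∷ as) = cong ((h , true) ∷_) (begin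
  columns (suc h) (mergeEN ((replicate a nS ++ [ eS ]) ++ runs as))
    ≡⟨ cong (columns (suc h) ∘ mergeEN) (List.++-assoc (replicate a nS) [ eS ] (runs as)) ⟩
  columns (suc h) (mergeEN (replicate a nS ++ eS ∷ runs as))
    ≡⟨ cong (columns (suc h)) (mergeEN-north a _) ⟩
  columns (suc h) (replicate a nS ++ mergeEN (eS ∷ runs as))
    ≡⟨ columns-north (suc h) a _ ⟩
  columns (suc (h ℕ.+ a)) (mergeEN (eS ∷ runs as))
    ≡⟨ cong (λ h′ → columns h′ (mergeEN (eS ∷ runs as))) (ℕ.+-suc h a) ⟨
  columns (h ℕ.+ suc a) (mergeEN (eS ∷ runs as))
    ≡⟨ columns-runs (h ℕ.+ suc a) as ⟩
  columnsOf (h ℕ.+ suc a) (as ++ [ 0 ]) ∎)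
  where open ≡.≡-Reasoning

columns-schröderOf : ∀ m f → columns 0 (schröderOf m f) ≡ columnsOf 1 (counts m f ++ [ 0 ])
columns-schröderOf m f = ≡.trans
  (cong (λ s → columns 1 (mergeEN (eS ∷ s))) (≡.sym (List.concatMap-map _ _ (upTo m))))
  (columns-runs 1 (counts m f))

indexedFrom : ℕ → List A → List (ℕ × A)
indexedFrom i []       = []
indexedFrom i (a ∷ as) = (i , a) ∷ indexedFrom (suc i) as

indexed≡indexedFrom : (xs : List A) → indexed xs ≡ indexedFrom 0 xs
indexed≡indexedFrom xs = go xs id 0 (λ _ → ≡.refl)
  where
  go : (xs : List A) (f : ℕ → ℕ) (i : ℕ) → (∀ j → f j ≡ i ℕ.+ j) →
       zip (applyUpTo f (length xs)) xs ≡ indexedFrom i xs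
  go []       f i eq = ≡.refl
  go (a ∷ as) f i eq = cong₂ _∷_ (cong (_, a) (≡.trans (eq 0) (ℕ.+-identityʳ i)))
    (go as (f ∘ suc) (suc i) (λ j → ≡.trans (eq (suc j)) (ℕ.+-suc i j)))

-- Carries the position along, so that a count over indices can be cut where the word is cut.
countFrom : (ℕ → ℕ → Bool) → ℕ → List ℕ → ℕ
countFrom p j []      = 0
countFrom p j (b ∷ v) = (if p j b then 1 else 0) ℕ.+ countFrom p (suc j) v

count-∷ : (p : A → Bool) (a : A) (as : List A) →
          count p (a ∷ as) ≡ (if p a then 1 else 0) ℕ.+ count p as
count-∷ p a as with p a
... | true  = ≡.refl
... | false = ≡.refl

count-nth : (p : ℕ → ℕ → Bool) (v : List ℕ) →
            count (λ b → p b (nth v b)) (upTo (length v)) ≡ countFrom p 0 v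
count-nth p v = go p v id 0 (λ _ → ≡.refl) (λ b → nth v b) (λ _ → ≡.refl)
  where
  go : ∀ p v (f : ℕ → ℕ) (i : ℕ) → (∀ j → f j ≡ i ℕ.+ j) → (g : ℕ → ℕ) → (∀ j → g (f j) ≡ nth v j) →
       count (λ b → p b (g b)) (applyUpTo f (length v)) ≡ countFrom p i v
  go p []      f i f≡ g g≡ = ≡.refl
  go p (b ∷ v) f i f≡ g g≡ = ≡.trans (count-∷ (λ b → p b (g b)) (f 0) _)
    (cong₂ ℕ._+_ (cong₂ (λ i b → if p i b then 1 else 0) (≡.trans (f≡ 0) (ℕ.+-identityʳ i)) (g≡ 0))
      (go p v (f ∘ suc) (suc i) (λ j → ≡.trans (f≡ (suc j)) (ℕ.+-suc i j)) g (g≡ ∘ suc)))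

countFrom-++ : ∀ p j v w → countFrom p j (v ++ w) ≡ countFrom p j v ℕ.+ countFrom p (j ℕ.+ length v) w
countFrom-++ p j []      w = cong (λ j → countFrom p j w) (≡.sym (ℕ.+-identityʳ j))
countFrom-++ p j (b ∷ v) w
  rewrite countFrom-++ p (suc j) v w | ℕ.+-suc j (length v)
  = ≡.sym (ℕ.+-assoc (if p j b then 1 else 0) _ _)

module _ (i h u : ℕ) where
  window : ℕ → ℕ → Bool
  window j b = (i <ᵇ j) ∧ (j <ᵇ h) ∧ (b <ᵇ u)

  countFrom-before : ∀ j v → j ℕ.+ length v ℕ.≤ suc i → countFrom window j v ≡ 0
  countFrom-before j []      _  = ≡.refl
  countFrom-before j (b ∷ v) le
    rewrite ≥⇒<ᵇ-false {i} {j} (ℕ.≤-pred (ℕ.≤-trans (s≤s (ℕ.m≤m+n j (length v))) (ℕ.≤-trans (ℕ.≤-reflexive (≡.sym (ℕ.+-suc j (length v)))) le)))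
    = countFrom-before (suc j) v (ℕ.≤-trans (ℕ.≤-reflexive (≡.sym (ℕ.+-suc j (length v)))) le)

  countFrom-after : ∀ j v → h ℕ.≤ j → countFrom window j v ≡ 0
  countFrom-after j []      le = ≡.refl
  countFrom-after j (b ∷ v) le rewrite ≥⇒<ᵇ-false le with i <ᵇ j
  ... | true  = countFrom-after (suc j) v (ℕ.m≤n⇒m≤1+n le)
  ... | false = countFrom-after (suc j) v (ℕ.m≤n⇒m≤1+n le)

  countFrom-inside : ∀ k j v → i ℕ.< j → j ℕ.+ k ≡ h →
    countFrom window j v ≡ count (λ b → b <ᵇ u) (take k v)
  countFrom-inside zero    j v       _   eq =
    countFrom-after j v (ℕ.≤-reflexive (≡.trans (≡.sym eq) (ℕ.+-identityʳ j)))
  countFrom-inside (suc k) j []      _   eq = ≡.refl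
  countFrom-inside (suc k) j (b ∷ v) i<j eq
    rewrite <⇒<ᵇ-true i<j
          | <⇒<ᵇ-true {j} {h} (subst (j ℕ.<_) eq (ℕ.m<m+n j (s≤s z≤n)))
          | count-∷ (λ b → b <ᵇ u) b (take k v)
    = cong (_ ℕ.+_) (countFrom-inside k (suc j) v (ℕ.m<n⇒m<1+n i<j) (≡.trans (≡.sym (ℕ.+-suc j k)) eq))

-- The boxes of the column of `u` below the path correspond to the `k` positions after it, those of
-- the other queue vertices.
count-window : ∀ k pre u w →
  let v = pre ++ u ∷ w in
  count (λ b → (length pre <ᵇ b) ∧ (b <ᵇ length pre ℕ.+ suc k) ∧ (nth v b <ᵇ u)) (upTo (length v))
    ≡ count (λ b → b <ᵇ u) (take k w)
count-window k pre u w = begin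
  count (λ b → p b (nth v b)) (upTo (length v))       ≡⟨ count-nth p v ⟩
  countFrom p 0 v                                     ≡⟨ cong (countFrom p 0) (List.++-assoc pre [ u ] w) ⟨
  countFrom p 0 ((pre ++ [ u ]) ++ w)                 ≡⟨ countFrom-++ p 0 (pre ++ [ u ]) w ⟩
  countFrom p 0 (pre ++ [ u ]) ℕ.+ countFrom p (length (pre ++ [ u ])) w
    ≡⟨ cong₂ ℕ._+_ (countFrom-before i h u 0 (pre ++ [ u ]) (ℕ.≤-reflexive |pre|)) (cong (λ j → countFrom p j w) |pre|) ⟩
  countFrom p (suc i) w
    ≡⟨ countFrom-inside i h u k (suc i) w ℕ.≤-refl (≡.sym (ℕ.+-suc i k)) ⟩
  count (λ b → b <ᵇ u) (take k w)                     ∎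
  where
  open ≡.≡-Reasoning
  v = pre ++ u ∷ w
  i = length pre
  h = i ℕ.+ suc k
  p = window i h u
  |pre| : length (pre ++ [ u ]) ≡ suc i
  |pre| = ≡.trans (List.length-++ pre) (ℕ.+-comm i 1)

nth-++ : ∀ v w j → nth (v ++ w) (length v ℕ.+ j) ≡ nth w j
nth-++ []      w j = ≡.refl
nth-++ (_ ∷ v) w j = nth-++ v w j

-- Degree sequences that empty a queue of k vertices and a pool of r vertices simultaneously.
data Exhausts : ℕ → ℕ → List ℕ → Set where
  done : Exhausts 0 0 []
  pop  : ∀ {k r a as} → Exhausts (k ℕ.+ a) r as → Exhausts (suc k) (a ℕ.+ r) (a ∷ as)

degreeSeqs-exhausts : ∀ f k (l : List A) {as} → f ≡ k ℕ.+ length l → as ∈ degreeSeqs f k l →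
                      Exhausts k (length l) as
degreeSeqs-exhausts zero    zero    []  eq (here ≡.refl) = done
degreeSeqs-exhausts (suc f) (suc k) l   eq as∈
  with find (∈-concatMap⁻ (λ (C , D) → map (length C ∷_) (degreeSeqs f (k ℕ.+ length C) D)) {xs = splits l} as∈)
... | (C , D) , CD∈ , p with ∈-map⁻ (length C ∷_) p
...   | as′ , as′∈ , ≡.refl =
  subst (λ r → Exhausts (suc k) r _) (interleaving-length sp)
    (pop (degreeSeqs-exhausts f (k ℕ.+ length C) D
      (≡.trans (ℕ.suc-injective eq) (≡.trans (cong (k ℕ.+_) (≡.sym (interleaving-length sp))) (≡.sym (ℕ.+-assoc k _ _)))) as′∈))
  where sp = splits-interleaving l CD∈

bump : Fin M → List ℕ → List ℕ
bump Fin.zero    (a ∷ as) = suc a ∷ as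
bump (Fin.suc i) (a ∷ as) = a ∷ bump i as
bump _           []       = []

counts-∷ : (c : Fin M) (f : List (Fin M)) → counts M (c ∷ f) ≡ bump c (counts M f)
counts-∷ {M} c f = begin
  counts M (c ∷ f)
    ≡⟨ List.map-cong (λ i → count-∷ (λ c → toℕ c ≡ᵇ i) c f) (upTo M) ⟩
  map (λ i → (if toℕ c ≡ᵇ i then 1 else 0) ℕ.+ g i) (upTo M)
    ≡⟨ List.map-upTo _ M ⟩
  applyUpTo (λ i → (if toℕ c ≡ᵇ i then 1 else 0) ℕ.+ g i) M
    ≡⟨ applyUpTo-bump c g ⟩
  bump c (applyUpTo g M)
    ≡⟨ cong (bump c) (List.map-upTo g M) ⟨
  bump c (counts M f) ∎
  where
  open ≡.≡-Reasoning
  g : ℕ → ℕ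
  g i = count (λ c → toℕ c ≡ᵇ i) f

  applyUpTo-bump : ∀ {M} (c : Fin M) g →
    applyUpTo (λ i → (if toℕ c ≡ᵇ i then 1 else 0) ℕ.+ g i) M ≡ bump c (applyUpTo g M)
  applyUpTo-bump Fin.zero    g = ≡.refl
  applyUpTo-bump (Fin.suc c) g = cong (g 0 ∷_) (applyUpTo-bump c (g ∘ suc))

-- Part sizes chosen as in `degreeSeqs`, but for a fixed number of parts and without a queue that
-- could run empty.
countSeqs : ℕ → List A → List (List ℕ)
countSeqs zero    []      = [] ∷ []
countSeqs zero    (_ ∷ _) = []
countSeqs (suc M) l       = concatMap (λ (C , D) → map (length C ∷_) (countSeqs M D)) (splits l)

-- `s` is the number of cars that prefer one of the first `i` places.
parkingFrom : ℕ → ℕ → List ℕ → Bool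
parkingFrom i s []       = true
parkingFrom i s (a ∷ as) = (suc i ≤ᵇ s ℕ.+ a) ∧ parkingFrom (suc i) (s ℕ.+ a) as

isPF≡parkingFrom : ∀ m f → isPF m f ≡ parkingFrom 0 0 (counts m f)
isPF≡parkingFrom m f = ≡.trans (go m id 0 (λ _ → ≡.refl))
  (cong (λ s → parkingFrom 0 s (counts m f)) (S0 f))
  where
  S : ℕ → List (Fin m) → ℕ
  S i f = count (λ c → toℕ c <ᵇ i) f

  S0 : ∀ f → S 0 f ≡ 0
  S0 []      = ≡.refl
  S0 (c ∷ f) = ≡.trans (count-∷ (λ c → toℕ c <ᵇ 0) c f) (S0 f)

  split< : ∀ i j → (if i <ᵇ suc j then 1 else 0) ≡ (if i <ᵇ j then 1 else 0) ℕ.+ (if i ≡ᵇ j then 1 else 0)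
  split< zero    zero    = ≡.refl
  split< zero    (suc j) = ≡.refl
  split< (suc i) zero    = ≡.refl
  split< (suc i) (suc j) = split< i j

  S-suc : ∀ i f → S (suc i) f ≡ S i f ℕ.+ count (λ c → toℕ c ≡ᵇ i) f
  S-suc i []      = ≡.refl
  S-suc i (c ∷ f)
    rewrite count-∷ (λ c → toℕ c <ᵇ suc i) c f | count-∷ (λ c → toℕ c <ᵇ i) c f | count-∷ (λ c → toℕ c ≡ᵇ i) c f
          | split< (toℕ c) i | S-suc i f = interchange (if toℕ c <ᵇ i then 1 else 0) _ _ _
    where open import Algebra.Properties.CommutativeSemigroup ℕ.+-commutativeSemigroup using (interchange)

  go : ∀ r (g : ℕ → ℕ) i → (∀ j → g j ≡ i ℕ.+ j) →
    all (λ i → i ≤ᵇ S i f) (map suc (applyUpTo g r))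
      ≡ parkingFrom i (S i f) (map (λ i → count (λ c → toℕ c ≡ᵇ i) f) (applyUpTo g r))
  go zero    g i eq = ≡.refl
  go (suc r) g i eq rewrite ≡.trans (eq 0) (ℕ.+-identityʳ i) | ≡.sym (S-suc i f) =
    cong (_ ∧_) (go r (g ∘ suc) (suc i) (λ j → ≡.trans (eq (suc j)) (ℕ.+-suc i j)))

allFin-suc : ∀ M → allFin (suc M) ≡ Fin.zero ∷ map Fin.suc (allFin M)
allFin-suc M = cong (Fin.zero ∷_) (≡.sym (List.map-tabulate id Fin.suc))

module Parking {c ℓ : Level} (R : CommutativeRing c ℓ) (q : CommutativeRing.Carrier R)
               (N : ℕ) (x : Fin N → CommutativeRing.Carrier R) where
  open CommutativeRing R
  open Poly R q N x
  open Sums R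
  open Process R q N x
  open SetoidReasoning setoid

  ∑-countSeqs-∷ : ∀ M (y : A) (l : List A) (φ : List ℕ → Carrier) →
    ∑ (countSeqs M (y ∷ l)) φ ≈ ∑[ i ∈ allFin M ] ∑[ as ∈ countSeqs M l ] φ (bump i as)
  ∑-countSeqs-∷ zero    y l φ = refl
  ∑-countSeqs-∷ (suc M) y l φ = begin
    _ ≈⟨ unfold (y ∷ l) φ ⟩
    _ ≈⟨ ∑-splits-∷ y l _ ⟩
    _ ≈⟨ +-cong (sym (unfold l (φ ∘ bump Fin.zero)))
           (trans (∑-cong (splits l) (λ {CD} _ → ∑-countSeqs-∷ M y (proj₂ CD) _)) (∑-swap (splits l) (allFin M) _)) ⟩
    _ ≈⟨ +-congˡ (trans (∑-cong (allFin M) (λ {i} _ → sym (unfold l (φ ∘ bump (Fin.suc i))))) (sym (∑-map Fin.suc (allFin M) _))) ⟩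
    _ ≡⟨ cong (λ is → ∑[ i ∈ is ] ∑[ as ∈ countSeqs (suc M) l ] φ (bump i as)) (allFin-suc M) ⟨
    _ ∎
    where
    unfold : ∀ l (φ : List ℕ → Carrier) → ∑ (countSeqs (suc M) l) φ
      ≈ ∑[ (C , D) ∈ splits l ] ∑[ as ∈ countSeqs M D ] φ (length C ∷ as)
    unfold l φ = trans (∑-concatMap _ (splits l) φ) (∑-cong (splits l) (λ {CD} _ → ∑-map _ (countSeqs M (proj₂ CD)) φ))

  -- Both sides grow by one element of `l` at a time: a car chooses its place, or an element joins
  -- one of the `M` parts.
  ∑-counts : ∀ M (l : List A) (φ : List ℕ → Carrier) →
    ∑[ f ∈ allFuns M (length l) ] φ (counts M f) ≈ ∑ (countSeqs M l) φ
  ∑-counts {A} M [] φ = trans (+-identityʳ _)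
    (trans (reflexive (cong φ (List.map-upTo _ M))) (sym (no-cars M φ)))
    where
    no-cars : ∀ M φ → ∑ (countSeqs {A} M []) φ ≈ φ (applyUpTo (λ _ → 0) M)
    no-cars zero    φ = +-identityʳ _
    no-cars (suc M) φ = trans (trans (∑-++ (map (0 ∷_) (countSeqs {A} M [])) [] φ) (+-identityʳ _))
      (trans (∑-map (0 ∷_) (countSeqs {A} M []) φ) (no-cars M (φ ∘ (0 ∷_))))
  ∑-counts M (y ∷ l) φ = begin
    _ ≈⟨ ∑-allFuns-suc M (length l) _ ⟩
    _ ≈⟨ ∑-cong (allFin M) (λ {c} _ → ∑-cong (allFuns M (length l)) (λ {f} _ → reflexive (cong φ (counts-∷ c f)))) ⟩
    _ ≈⟨ ∑-cong (allFin M) (λ {c} _ → ∑-counts M l (φ ∘ bump c)) ⟩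
    _ ≈⟨ ∑-countSeqs-∷ M y l φ ⟨
    _ ∎

  -- The surplus `s - i = k` is the queue length minus one. Hence the next parking inequality says
  -- that the queue is still nonempty after the pop, and where it fails `degreeSeqs` has no
  -- continuation. The counts are the degrees of all vertices but the last one popped, which has no
  -- children: this is the appended 0.
  ∑-parking : ∀ M i s k (l : List A) (φ : List ℕ → Carrier) → s ≡ i ℕ.+ k → k ℕ.+ length l ≡ M →
    ∑[ as ∈ countSeqs M l ] (if parkingFrom i s as then φ (as ++ [ 0 ]) else 0#)
      ≈ ∑ (degreeSeqs (suc M) (suc k) l) φ
  ∑-parking zero    i s zero [] φ _  _  = refl
  ∑-parking (suc M) i s k    l  φ s≡ k≡ = begin
    _ ≈⟨ ∑-concatMap _ (splits l) _ ⟩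
    _ ≈⟨ ∑-splits-cong l (λ {C} {D} sp → trans (∑-map _ (countSeqs M D) _)
           (trans (term C D (k ℕ.+ length C) ≡.refl sp) (sym (∑-map _ (degreeSeqs (suc M) (k ℕ.+ length C) D) _)))) ⟩
    _ ≈⟨ ∑-concatMap _ (splits l) _ ⟨
    _ ∎
    where
    heights : ∀ a {k′} → k ℕ.+ a ≡ suc k′ → s ℕ.+ a ≡ suc i ℕ.+ k′
    heights a {k′} eq = ≡.trans (cong (ℕ._+ a) s≡) (≡.trans (ℕ.+-assoc i k a) (≡.trans (cong (i ℕ.+_) eq) (ℕ.+-suc i k′)))

    term : ∀ C D k′ → k ℕ.+ length C ≡ k′ → Interleaving C D l →
      ∑[ as ∈ countSeqs M D ]
        (if (suc i ≤ᵇ s ℕ.+ length C) ∧ parkingFrom (suc i) (s ℕ.+ length C) as then φ (length C ∷ (as ++ [ 0 ])) else 0#)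
        ≈ ∑[ as ∈ degreeSeqs (suc M) k′ D ] φ (length C ∷ as)
    term C D zero eq sp
      rewrite ≥⇒<ᵇ-false {i} {s ℕ.+ length C} (ℕ.≤-reflexive (≡.trans (cong (ℕ._+ length C) s≡) (≡.trans (ℕ.+-assoc i k _) (≡.trans (cong (i ℕ.+_) eq) (ℕ.+-identityʳ i))))) =
      ∑-zero (countSeqs M D)
    term C D (suc k′) eq sp
      rewrite <⇒<ᵇ-true {i} {s ℕ.+ length C} (ℕ.≤-trans (s≤s (ℕ.m≤m+n i k′)) (ℕ.≤-reflexive (≡.sym (heights (length C) eq)))) =
      ∑-parking M (suc i) (s ℕ.+ length C) k′ D (φ ∘ (length C ∷_)) (heights (length C) eq)
        (ℕ.suc-injective (≡.trans (cong (ℕ._+ length D) (≡.sym eq)) (≡.trans (ℕ.+-assoc k _ _) (≡.trans (cong (k ℕ.+_) (interleaving-length sp)) k≡))))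

  module _ (n : ℕ) (v : List ℕ) where
    descends : ℕ × ℕ × Bool → Bool
    descends (i , h , d) = not d ∨ (nth v h <ᵇ nth v i)

    inversions : ℕ × ℕ × Bool → ℕ → Bool
    inversions (i , h , d) b = (i <ᵇ b) ∧ (b <ᵇ h) ∧ (nth v b <ᵇ nth v i)

    columnWeight : ℕ × ℕ × Bool → Carrier
    columnWeight col = (if descends col then 1# else 0#) * pow q (count (inversions col) (upTo n))

    columnWeights : ∀ cols →
      (if all descends cols then pow q (length (concatMap (λ col → filterᵇ (inversions col) (upTo n)) cols)) else 0#)
        ≈ prodR (map columnWeight cols)
    columnWeights []           = refl
    columnWeights (col ∷ cols) with descends col
    ... | false = sym (trans (*-congʳ (zeroˡ _)) (zeroˡ _))
    ... | true  rewrite List.length-++ (filterᵇ (inversions col) (upTo n)) {concatMap (λ col → filterᵇ (inversions col) (upTo n)) cols}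
      with all descends cols | columnWeights cols
    ...   | true  | ih = trans (pow-+ q (count (inversions col) (upTo n)) _) (*-cong (sym (*-identityˡ _)) ih)
    ...   | false | ih = sym (trans (*-congˡ (sym ih)) (zeroʳ _))

  -- After `u` come the `k` remaining queue vertices and then its children. A `d` box compares `u`
  -- with the position right after the queue, its first child, and the boxes below it compare `u`
  -- with the queue.
  columnWeight≈ : ∀ {k r a as} (pre : List (Fin N)) u w → Exhausts (k ℕ.+ a) r as → length w ≡ k ℕ.+ (a ℕ.+ r) →
    columnWeight (length (pre ++ u ∷ w)) (map toℕ (pre ++ u ∷ w)) (length pre , length pre ℕ.+ suc k , positive a)
      ≈ guard a u (drop k w) * cross u (take k w)
  columnWeight≈ {k} {r} {a} pre u w ex |w| = *-cong (first a |w|) second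
    where
    v = map toℕ (pre ++ u ∷ w)
    i = length pre
    h = i ℕ.+ suc k
    total = length (pre ++ u ∷ w)

    v≡ : v ≡ map toℕ pre ++ toℕ u ∷ map toℕ w
    v≡ = List.map-++ toℕ pre (u ∷ w)

    nth-v : ∀ j → nth v (i ℕ.+ j) ≡ nth (toℕ u ∷ map toℕ w) j
    nth-v j = ≡.trans (cong₂ (λ v i → nth v (i ℕ.+ j)) v≡ (≡.sym (List.length-map toℕ pre))) (nth-++ (map toℕ pre) _ j)

    nth-i : nth v i ≡ toℕ u
    nth-i = ≡.trans (cong (nth v) (≡.sym (ℕ.+-identityʳ i))) (nth-v 0)

    head-guard : ∀ k (w : List (Fin N)) → k ℕ.< length w →
      (if nth (map toℕ w) k <ᵇ toℕ u then 1# else 0#) ≈ guard 1 u (drop k w)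
    head-guard zero    (b ∷ w) _        = refl
    head-guard (suc k) (b ∷ w) (s≤s lt) = head-guard k w lt

    first : ∀ a → length w ≡ k ℕ.+ (a ℕ.+ r) →
      (if descends total v (i , h , positive a) then 1# else 0#) ≈ guard a u (drop k w)
    first zero    _   = refl
    -- A child exists, so position `k` lies inside `w`. Beyond the end `nth` returns 0, which could
    -- pass the comparison with `u`.
    first (suc a) |w| rewrite nth-i | nth-v (suc k) = trans
      (head-guard k w (subst (k ℕ.<_) (≡.sym |w|) (ℕ.m<m+n k (s≤s z≤n)))) (guard-suc (drop k w))
      where
      guard-suc : ∀ g → guard 1 u g ≈ guard (suc a) u g
      guard-suc []      = refl
      guard-suc (_ ∷ _) = refl

    second : pow q (count (inversions total v (i , h , positive a)) (upTo total)) ≈ cross u (take k w)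
    second = trans (reflexive (cong (pow q) (≡.trans
      (cong₂ (λ y n → count (λ b → (i <ᵇ b) ∧ (b <ᵇ h) ∧ (nth v b <ᵇ y)) (upTo n)) nth-i
        (≡.trans (≡.sym (List.length-map toℕ (pre ++ u ∷ w))) (cong length v≡)))
      (≡.trans (cong (λ v → count (λ b → (i <ᵇ b) ∧ (b <ᵇ h) ∧ (nth v b <ᵇ toℕ u)) (upTo (length (map toℕ pre ++ toℕ u ∷ map toℕ w)))) v≡)
      (≡.trans (cong (λ i → count (λ b → (i <ᵇ b) ∧ (b <ᵇ i ℕ.+ suc k) ∧ (nth (map toℕ pre ++ toℕ u ∷ map toℕ w) b <ᵇ toℕ u)) (upTo (length (map toℕ pre ++ toℕ u ∷ map toℕ w)))) (≡.sym (List.length-map toℕ pre)))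
      (≡.trans (count-window k (map toℕ pre) (toℕ u) (map toℕ w)) (cong (count (λ b → b <ᵇ toℕ u)) (List.take-map k w))))))))
      (pow-count u (take k w))

  columnWeights≈degreeWeight : ∀ {k r as} (pre w : List (Fin N)) → Exhausts k r as → length w ≡ k ℕ.+ r →
    prodR (map (columnWeight (length (pre ++ w)) (map toℕ (pre ++ w)))
               (indexedFrom (length pre) (columnsOf (length pre ℕ.+ k) as)))
      ≈ degreeWeight k as w
  columnWeights≈degreeWeight pre w done _ = refl
  columnWeights≈degreeWeight pre (u ∷ w) (pop {k} {r} {a} {as} ex) |w| =
    *-cong (columnWeight≈ pre u w ex (ℕ.suc-injective |w|)) (trans (reflexive (cong₃
        (λ g i h → prodR (map (columnWeight (length g) (map toℕ g)) (indexedFrom i (columnsOf h as))))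
        (≡.sym (List.++-assoc pre [ u ] w)) (≡.sym |pre|)
        (≡.trans (ℕ.+-assoc (length pre) (suc k) a) (≡.trans (ℕ.+-suc (length pre) (k ℕ.+ a)) (cong (ℕ._+ (k ℕ.+ a)) (≡.sym |pre|))))))
      (columnWeights≈degreeWeight (pre ++ [ u ]) w ex (≡.trans (ℕ.suc-injective |w|) (≡.sym (ℕ.+-assoc k a r)))))
    where
    |pre| : length (pre ++ [ u ]) ≡ suc (length pre)
    |pre| = ≡.trans (List.length-++ pre) (ℕ.+-comm (length pre) 1)
    cong₃ : ∀ {X Y Z : Set} {W′ : Set c} (f : X → Y → Z → W′) {a a′ b b′ d d′} → a ≡ a′ → b ≡ b′ → d ≡ d′ → f a b d ≡ f a′ b′ d′
    cong₃ f ≡.refl ≡.refl ≡.refl = ≡.refl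

  columnSum : ℕ → List (ℕ × Bool) → Carrier
  columnSum n cols = ∑[ g ∈ allFuns N n ]
    (if all (descends n (map toℕ g)) (indexed cols)
     then pow q (length (concatMap (λ col → filterᵇ (inversions n (map toℕ g) col) (upTo n)) (indexed cols))) * monomial g
     else 0#)

  columnSum≈ : ∀ n {r as} → Exhausts 1 r as → n ≡ suc r →
    columnSum n (columnsOf 1 as) ≈ ∑[ v ∈ allFuns N n ] degreeWeight 1 as v * monomial v
  columnSum≈ n {as = as} ex eq = ∑-cong (allFuns N n) (λ {g} g∈ → begin
    _ ≈⟨ if-* (all (descends n (map toℕ g)) (indexed (columnsOf 1 as))) ⟨
    _ ≈⟨ *-congʳ (columnWeights n (map toℕ g) (indexed (columnsOf 1 as))) ⟩
    _ ≡⟨ cong₂ (λ m cols → prodR (map (columnWeight m (map toℕ g)) cols) * monomial g)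
           (≡.sym (allFuns-length N n g∈)) (indexed≡indexedFrom (columnsOf 1 as)) ⟩
    _ ≈⟨ *-congʳ (columnWeights≈degreeWeight [] g ex (≡.trans (allFuns-length N n g∈) eq)) ⟩
    _ ∎)
    where
    if-* : ∀ b {y z} → (if b then y else 0#) * z ≈ (if b then y * z else 0#)
    if-* true  = refl
    if-* false = zeroˡ _

  parkingSum≈bfsSum : (l : List A) →
    ∑[ f ∈ parkingFunctions (length l) ] LLTμ (suc (length l)) (schröderOf (length l) f) ≈ bfsSum l
  parkingSum≈bfsSum l = begin
    _ ≈⟨ ∑-filterᵇ (isPF m) (allFuns m m) _ ⟩
    _ ≈⟨ ∑-cong (allFuns m m) (λ {f} _ → reflexive (cong₂ (λ b cols → if b then columnSum (suc m) cols else 0#)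
           (isPF≡parkingFrom m f) (columns-schröderOf m f))) ⟩
    _ ≈⟨ ∑-counts m l (λ as → if parkingFrom 0 0 as then columnSum (suc m) (columnsOf 1 (as ++ [ 0 ])) else 0#) ⟩
    _ ≈⟨ ∑-parking m 0 0 0 l (columnSum (suc m) ∘ columnsOf 1) ≡.refl ≡.refl ⟩
    _ ≈⟨ ∑-cong (degreeSeqs (suc m) 1 l) (λ as∈ → columnSum≈ (suc m) (degreeSeqs-exhausts (suc m) 1 l ≡.refl as∈) ≡.refl) ⟩
    _ ∎
    where m = length l

≡ᵇ-refl : ∀ m → (m ≡ᵇ m) ≡ true
≡ᵇ-refl zero    = ≡.refl
≡ᵇ-refl (suc m) = ≡ᵇ-refl m

≡ᵇ-≢ : ∀ {m n} → m ≢ n → (m ≡ᵇ n) ≡ false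
≡ᵇ-≢ {m} {n} m≢n with m ≡ᵇ n in eq
... | false = ≡.refl
... | true  = ⊥-elim (m≢n (ℕ.≡ᵇ⇒≡ m n (subst T (≡.sym eq) _)))

-- Vertical strips of plane trees

data Shape : Set where
  node : List Shape → Shape

mutual
  -- Each strip ends at exactly one leaf, so this is also the number of strips.
  leaves : Shape → ℕ
  leaves (node [])       = 1
  leaves (node (t ∷ ts)) = leaves t ℕ.+ forestLeaves ts

  forestLeaves : List Shape → ℕ
  forestLeaves []       = 0
  forestLeaves (t ∷ ts) = leaves t ℕ.+ forestLeaves ts

mutual
  size : Shape → ℕ
  size (node ts) = suc (forestSize ts)

  forestSize : List Shape → ℕ
  forestSize []       = 0
  forestSize (t ∷ ts) = size t ℕ.+ forestSize ts

extendTop : ℕ → List VStrip → List VStrip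
extendTop d []       = [ strip d 1 ]
extendTop d (s ∷ ss) = strip d (suc (len s)) ∷ ss

mutual
  strips : Shape → ℕ → List VStrip
  strips (node [])       d = [ strip d 1 ]
  strips (node (t ∷ ts)) d = extendTop d (strips t (suc d)) ++ forestStrips ts (suc d)

  forestStrips : List Shape → ℕ → List VStrip
  forestStrips []       d = []
  forestStrips (t ∷ ts) d = strips t d ++ forestStrips ts d

strips-top : ∀ t d → ∃₂ λ j ss → strips t d ≡ strip d (suc j) ∷ ss
strips-top (node [])       d = 0 , [] , ≡.refl
strips-top (node (t ∷ ts)) d with strips t (suc d) | strips-top t (suc d)
... | .(strip (suc d) (suc j) ∷ ss) | j , ss , ≡.refl = suc j , ss ++ forestStrips ts (suc d) , ≡.refl

mutual
  length-strips : ∀ t d → length (strips t d) ≡ leaves t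
  length-strips (node [])       d = ≡.refl
  length-strips (node (t ∷ ts)) d = ≡.trans (List.length-++ (extendTop d (strips t (suc d))))
    (cong₂ ℕ._+_ (≡.trans extend-length (length-strips t (suc d))) (length-forestStrips ts (suc d)))
    where
    extend-length : length (extendTop d (strips t (suc d))) ≡ length (strips t (suc d))
    extend-length with strips t (suc d) | strips-top t (suc d)
    ... | _ | j , ss , ≡.refl = ≡.refl

  length-forestStrips : ∀ ts d → length (forestStrips ts d) ≡ forestLeaves ts
  length-forestStrips []       d = ≡.refl
  length-forestStrips (t ∷ ts) d =
    ≡.trans (List.length-++ (strips t d)) (cong₂ ℕ._+_ (length-strips t d) (length-forestStrips ts d))

-- strip index and depth
Node : Set
Node = ℕ × ℕ

mutual
  -- A new strip begins after each leaf, so with the start `m = 1` the strip index of a vertex is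
  -- one more than the number of leaves visited before it.
  preorder : ℕ → ℕ → Shape → List Node
  preorder m d (node ts) = (m , d) ∷ forestPreorder m (suc d) ts

  forestPreorder : ℕ → ℕ → List Shape → List Node
  forestPreorder m d []       = []
  forestPreorder m d (t ∷ ts) = preorder m d t ++ forestPreorder (m ℕ.+ leaves t) d ts

shifted : ℕ → Node → ℕ
shifted k (m , d) = k ℕ.* d ℕ.+ m

cell : ℕ → Node → ℕ × ℕ
cell k ν = proj₁ ν , shifted k ν

cells-extend : ∀ k m d t ss →
  cellsFrom k m (extendTop d (strips t (suc d)) ++ ss) ≡ cell k (m , d) ∷ cellsFrom k m (strips t (suc d) ++ ss)
cells-extend k m d t ss with strips t (suc d) | strips-top t (suc d)
... | _ | j , ss′ , ≡.refl = cong₂ (λ e cs → (m , k ℕ.* e ℕ.+ m) ∷ cs ++ cellsFrom k (suc m) (ss′ ++ ss)) (ℕ.+-identityʳ d)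
  (begin
    map f (applyUpTo suc (suc j))      ≡⟨ List.map-applyUpTo suc f (suc j) ⟩
    applyUpTo (f ∘ suc) (suc j)        ≡⟨ List.map-upTo (f ∘ suc) (suc j) ⟨
    map (f ∘ suc) (upTo (suc j))       ≡⟨ List.map-cong (λ i → cong (λ e → m , k ℕ.* e ℕ.+ m) (ℕ.+-suc d i)) (upTo (suc j)) ⟩
    stripCells k m (strip (suc d) (suc j)) ∎)
  where
  open ≡.≡-Reasoning
  f : ℕ → ℕ × ℕ
  f i = m , k ℕ.* (d ℕ.+ i) ℕ.+ m

mutual
  cells-strips : ∀ k m d t ss →
    cellsFrom k m (strips t d ++ ss) ≡ map (cell k) (preorder m d t) ++ cellsFrom k (m ℕ.+ leaves t) ss
  cells-strips k m d (node [])       ss = cong₂ (λ e m′ → (m , k ℕ.* e ℕ.+ m) ∷ cellsFrom k m′ ss)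
    (ℕ.+-identityʳ d) (ℕ.+-comm 1 m)
  cells-strips k m d (node (t ∷ ts)) ss = begin
    cellsFrom k m ((extendTop d (strips t (suc d)) ++ forestStrips ts (suc d)) ++ ss)
      ≡⟨ cong (cellsFrom k m) (List.++-assoc (extendTop d (strips t (suc d))) _ ss) ⟩
    cellsFrom k m (extendTop d (strips t (suc d)) ++ (forestStrips ts (suc d) ++ ss))
      ≡⟨ cells-extend k m d t _ ⟩
    cell k (m , d) ∷ cellsFrom k m (strips t (suc d) ++ (forestStrips ts (suc d) ++ ss))
      ≡⟨ cong (λ s → cell k (m , d) ∷ cellsFrom k m s) (List.++-assoc (strips t (suc d)) _ ss) ⟨
    cell k (m , d) ∷ cellsFrom k m (forestStrips (t ∷ ts) (suc d) ++ ss)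
      ≡⟨ cong (cell k (m , d) ∷_) (cells-forestStrips k m (suc d) (t ∷ ts) ss) ⟩
    _ ∎
    where open ≡.≡-Reasoning

  cells-forestStrips : ∀ k m d ts ss →
    cellsFrom k m (forestStrips ts d ++ ss) ≡ map (cell k) (forestPreorder m d ts) ++ cellsFrom k (m ℕ.+ forestLeaves ts) ss
  cells-forestStrips k m d []       ss = cong (λ m → cellsFrom k m ss) (≡.sym (ℕ.+-identityʳ m))
  cells-forestStrips k m d (t ∷ ts) ss = begin
    cellsFrom k m ((strips t d ++ forestStrips ts d) ++ ss)
      ≡⟨ cong (cellsFrom k m) (List.++-assoc (strips t d) _ ss) ⟩
    cellsFrom k m (strips t d ++ (forestStrips ts d ++ ss))
      ≡⟨ cells-strips k m d t _ ⟩
    map (cell k) (preorder m d t) ++ cellsFrom k (m ℕ.+ leaves t) (forestStrips ts d ++ ss)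
      ≡⟨ cong (map (cell k) (preorder m d t) ++_) (cells-forestStrips k (m ℕ.+ leaves t) d ts ss) ⟩
    map (cell k) (preorder m d t) ++ (map (cell k) (forestPreorder (m ℕ.+ leaves t) d ts) ++ cellsFrom k (m ℕ.+ leaves t ℕ.+ forestLeaves ts) ss)
      ≡⟨ List.++-assoc (map (cell k) (preorder m d t)) _ _ ⟨
    (map (cell k) (preorder m d t) ++ map (cell k) (forestPreorder (m ℕ.+ leaves t) d ts)) ++ cellsFrom k (m ℕ.+ leaves t ℕ.+ forestLeaves ts) ss
      ≡⟨ cong₂ (λ cs m → cs ++ cellsFrom k m ss) (≡.sym (List.map-++ (cell k) (preorder m d t) _)) (ℕ.+-assoc m (leaves t) _) ⟩
    _ ∎
    where open ≡.≡-Reasoning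

cellsOf-strips : ∀ t → cellsOf (strips t 0) ≡ map (cell (leaves t)) (preorder 1 0 t)
cellsOf-strips t = begin
  cellsFrom (length (strips t 0)) 1 (strips t 0)
    ≡⟨ cong₂ (λ k ss → cellsFrom k 1 ss) (length-strips t 0) (≡.sym (List.++-identityʳ (strips t 0))) ⟩
  cellsFrom (leaves t) 1 (strips t 0 ++ [])                  ≡⟨ cells-strips (leaves t) 1 0 t [] ⟩
  map (cell (leaves t)) (preorder 1 0 t) ++ []               ≡⟨ List.++-identityʳ _ ⟩
  map (cell (leaves t)) (preorder 1 0 t)                     ∎
  where open ≡.≡-Reasoning

Within : ℕ → ℕ → ℕ → Node → Set
Within lo hi d (m′ , d′) = lo ℕ.≤ m′ × m′ ℕ.< hi × d ℕ.≤ d′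

leaves>0 : ∀ t → 0 ℕ.< leaves t
leaves>0 (node [])       = s≤s z≤n
leaves>0 (node (t ∷ ts)) = ℕ.<-≤-trans (leaves>0 t) (ℕ.m≤m+n _ _)

within-weaken : ∀ {lo lo′ hi hi′ d d′ ν} → lo′ ℕ.≤ lo → hi ℕ.≤ hi′ → d′ ℕ.≤ d → Within lo hi d ν → Within lo′ hi′ d′ ν
within-weaken p q r (a , b , c) = ℕ.≤-trans p a , ℕ.<-≤-trans b q , ℕ.≤-trans r c

mutual
  preorder-within : ∀ m d t → All (Within m (m ℕ.+ leaves t) d) (preorder m d t)
  preorder-within m d (node ts) = (ℕ.≤-refl , ℕ.m<m+n m (leaves>0 (node ts)) , ℕ.≤-refl)
    ∷ descendants-within m d ts

  descendants-within : ∀ m d ts → All (Within m (m ℕ.+ leaves (node ts)) d) (forestPreorder m (suc d) ts)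
  descendants-within m d []       = []
  descendants-within m d (t ∷ ts) = All.map (within-weaken ℕ.≤-refl ℕ.≤-refl (ℕ.n≤1+n d)) (forestPreorder-within m (suc d) (t ∷ ts))

  forestPreorder-within : ∀ m d ts → All (Within m (m ℕ.+ forestLeaves ts) d) (forestPreorder m d ts)
  forestPreorder-within m d []       = []
  forestPreorder-within m d (t ∷ ts) = All.++⁺
    (All.map (within-weaken ℕ.≤-refl (ℕ.+-monoʳ-≤ m (ℕ.m≤m+n _ _)) ℕ.≤-refl) (preorder-within m d t))
    (All.map (within-weaken (ℕ.m≤m+n m _) (ℕ.≤-reflexive (ℕ.+-assoc m (leaves t) _)) ℕ.≤-refl)
      (forestPreorder-within (m ℕ.+ leaves t) d ts))

module _ (k : ℕ) where
  Below : Node → Node → Set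
  Below α β = proj₁ α ≡ proj₁ β × shifted k β ≡ shifted k α ℕ.+ k

  -- `admissible` looks only at neighbours in the list. Under this condition no other pair of cells
  -- is vertically adjacent in a strip, so the test equals a product over all ordered pairs, which
  -- does not depend on the listing.
  data StripOrdered : List Node → Set where
    []  : StripOrdered []
    one : ∀ α → StripOrdered [ α ]
    _∷_ : ∀ {α β νs} →
      (proj₁ α ≡ proj₁ β → shifted k β ≡ shifted k α ℕ.+ k) × All (¬_ ∘ Below α) νs × All (λ γ → ¬ Below γ α) (β ∷ νs) →
      StripOrdered (β ∷ νs) → StripOrdered (α ∷ β ∷ νs)

  module _ (k>0 : 0 ℕ.< k) where
    not-above : ∀ {m d m′ d′} → m ≢ m′ ⊎ d ℕ.≤ d′ → ¬ Below (m′ , d′) (m , d)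
    not-above (inj₁ m≢m′) (≡.refl , _)  = m≢m′ ≡.refl
    not-above {m} {d} {_} {d′} (inj₂ d≤d′) (≡.refl , eq) = ℕ.<⇒≢
      (ℕ.≤-<-trans (ℕ.+-monoˡ-≤ m (ℕ.*-monoʳ-≤ k d≤d′)) (ℕ.m<m+n _ k>0)) eq

    not-below : ∀ {m d m′ d′} → m ≢ m′ ⊎ suc (suc d) ℕ.≤ d′ → ¬ Below (m , d) (m′ , d′)
    not-below (inj₁ m≢m′) (≡.refl , _)  = m≢m′ ≡.refl
    not-below {m} {d} {_} {d′} (inj₂ d<d′) (≡.refl , eq) = ℕ.<⇒≢ lt (≡.sym eq)
      where
      open ℕ.≤-Reasoning
      lt : k ℕ.* d ℕ.+ m ℕ.+ k ℕ.< k ℕ.* d′ ℕ.+ m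
      lt = begin-strict
        k ℕ.* d ℕ.+ m ℕ.+ k          ≡⟨ ℕ.+-comm _ k ⟩
        k ℕ.+ (k ℕ.* d ℕ.+ m)        ≡⟨ ℕ.+-assoc k _ m ⟨
        k ℕ.+ k ℕ.* d ℕ.+ m          ≡⟨ cong (ℕ._+ m) (ℕ.*-suc k d) ⟨
        k ℕ.* suc d ℕ.+ m            <⟨ ℕ.+-monoˡ-< m (ℕ.m<n+m _ k>0) ⟩
        k ℕ.+ k ℕ.* suc d ℕ.+ m      ≡⟨ cong (ℕ._+ m) (ℕ.*-suc k (suc d)) ⟨
        k ℕ.* suc (suc d) ℕ.+ m      ≤⟨ ℕ.+-monoˡ-≤ m (ℕ.*-monoʳ-≤ k d<d′) ⟩
        k ℕ.* d′ ℕ.+ m               ∎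

    shifted-suc : ∀ m d → shifted k (m , suc d) ≡ shifted k (m , d) ℕ.+ k
    shifted-suc m d = ≡.trans (cong (ℕ._+ m) (ℕ.*-suc k d)) (≡.trans (ℕ.+-assoc k _ m) (ℕ.+-comm k _))

    leaf-ordered : ∀ m d νs → All (λ ν → suc m ℕ.≤ proj₁ ν) νs → StripOrdered νs → StripOrdered ((m , d) ∷ νs)
    leaf-ordered m d []       _           _   = one _
    leaf-ordered m d (ν ∷ νs) (m< ∷ rest) ord =
      (⊥-elim ∘ ℕ.<⇒≢ m< , All.map (not-below ∘ inj₁ ∘ ℕ.<⇒≢) rest , All.map (not-above ∘ inj₁ ∘ ℕ.<⇒≢) (m< ∷ rest)) ∷ ord

    mutual
      -- An inner vertex is followed by its first child, on the same strip; every later cell lies on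
      -- another strip or at least two levels deeper. A leaf is followed only by cells of later
      -- strips.
      preorder-ordered : ∀ m d t νs → All (λ ν → m ℕ.+ leaves t ℕ.≤ proj₁ ν) νs → StripOrdered νs →
                         StripOrdered (preorder m d t ++ νs)
      preorder-ordered m d (node [])                    νs νs≥ ord =
        leaf-ordered m d νs (All.map (ℕ.≤-trans (ℕ.≤-reflexive (ℕ.+-comm 1 m))) νs≥) ord
      preorder-ordered m d (node ts₀@(t@(node ss) ∷ ts)) νs νs≥ ord =
        ( (λ _ → shifted-suc m d)
        , All.++⁺ (All.++⁺ (All.map (λ (_ , _ , le) → not-below (inj₂ le)) (forestPreorder-within m (suc (suc d)) ss))
            (All.map (λ (le , _ , _) → not-below (inj₁ (ℕ.<⇒≢ (ℕ.<-≤-trans (ℕ.m<m+n m (leaves>0 t)) le))))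
              (forestPreorder-within (m ℕ.+ leaves t) (suc d) ts)))
            (All.map (λ le → not-below (inj₁ (later le))) νs≥)
        , All.++⁺ (All.map (λ (_ , _ , le) → not-above (inj₂ (ℕ.≤-trans (ℕ.n≤1+n d) le))) (forestPreorder-within m (suc d) ts₀))
            (All.map (λ le → not-above (inj₁ (later le))) νs≥) )
        ∷ forestPreorder-ordered m (suc d) ts₀ νs νs≥ ord
        where
        later : ∀ {m′} → m ℕ.+ leaves (node ts₀) ℕ.≤ m′ → m ≢ m′
        later le = ℕ.<⇒≢ (ℕ.<-≤-trans (ℕ.m<m+n m (leaves>0 (node ts₀))) le)

      forestPreorder-ordered : ∀ m d ts νs → All (λ ν → m ℕ.+ forestLeaves ts ℕ.≤ proj₁ ν) νs → StripOrdered νs →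
                               StripOrdered (forestPreorder m d ts ++ νs)
      forestPreorder-ordered m d []       νs νs≥ ord = ord
      forestPreorder-ordered m d (t ∷ ts) νs νs≥ ord =
        subst StripOrdered (≡.sym (List.++-assoc (preorder m d t) _ νs))
          (preorder-ordered m d t _
            (All.++⁺ (All.map proj₁ (forestPreorder-within (m ℕ.+ leaves t) d ts))
               (All.map (ℕ.≤-trans (ℕ.≤-trans (ℕ.m≤m+n _ (forestLeaves ts)) (ℕ.≤-reflexive (ℕ.+-assoc m _ _)))) νs≥))
            (forestPreorder-ordered (m ℕ.+ leaves t) d ts νs
              (All.map (ℕ.≤-trans (ℕ.≤-reflexive (ℕ.+-assoc m _ _))) νs≥) ord))

forestSize-++ : ∀ ts us → forestSize (ts ++ us) ≡ forestSize ts ℕ.+ forestSize us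
forestSize-++ []       us = ≡.refl
forestSize-++ (t ∷ ts) us = ≡.trans (cong (size t ℕ.+_) (forestSize-++ ts us)) (≡.sym (ℕ.+-assoc (size t) _ _))

mutual
  length-preorder : ∀ m d t → length (preorder m d t) ≡ size t
  length-preorder m d (node ts) = cong suc (length-forestPreorder m (suc d) ts)

  length-forestPreorder : ∀ m d ts → length (forestPreorder m d ts) ≡ forestSize ts
  length-forestPreorder m d []       = ≡.refl
  length-forestPreorder m d (t ∷ ts) = ≡.trans (List.length-++ (preorder m d t))
    (cong₂ ℕ._+_ (length-preorder m d t) (length-forestPreorder (m ℕ.+ leaves t) d ts))

-- Breadth-first order of a plane tree

bfsDegrees : ℕ → List Shape → List ℕ
bfsDegrees (suc f) (node ts ∷ Q) = length ts ∷ bfsDegrees f (Q ++ ts)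
bfsDegrees _       _             = []

Item : Set
Item = ℕ × ℕ × Shape

root : Item → Node
root (m , d , _) = m , d

shape : Item → Shape
shape (_ , _ , t) = t

itemPreorder : Item → List Node
itemPreorder (m , d , t) = preorder m d t

descendants : Item → List Node
descendants (m , d , node ts) = forestPreorder m (suc d) ts

at : ℕ → List (ℕ × Shape) → List Item
at d = map (λ (m , t) → m , d , t)

kids : ℕ → List Shape → List (ℕ × Shape)
kids m []       = []
kids m (t ∷ ts) = (m , t) ∷ kids (m ℕ.+ leaves t) ts

shapes-kids : ∀ d m ts → map shape (at d (kids m ts)) ≡ ts
shapes-kids d m []       = ≡.refl
shapes-kids d m (t ∷ ts) = cong (t ∷_) (shapes-kids d (m ℕ.+ leaves t) ts)

preorder-kids : ∀ d m ts → concatMap itemPreorder (at d (kids m ts)) ≡ forestPreorder m d ts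
preorder-kids d m []       = ≡.refl
preorder-kids d m (t ∷ ts) = cong (preorder m d t ++_) (preorder-kids d (m ℕ.+ leaves t) ts)

-- The nodes that enter the queue later, in order of entry. Keeping them apart from the queue makes
-- the queue, the children of the popped node and all remaining nodes consecutive segments of the
-- list.
deeper : ℕ → List Item → List Node
deeper (suc f) ((m , d , node ts) ∷ Q) =
  map root (at (suc d) (kids m ts)) ++ deeper f (Q ++ at (suc d) (kids m ts))
deeper _       _                       = []

bfsNodes : ℕ → List Item → List Node
bfsNodes f Q = map root Q ++ deeper f Q

bfsNodes-pop : ∀ f m d ts Q →
  bfsNodes (suc f) ((m , d , node ts) ∷ Q) ≡ (m , d) ∷ bfsNodes f (Q ++ at (suc d) (kids m ts))
bfsNodes-pop f m d ts Q = cong ((m , d) ∷_) (≡.trans (≡.sym (List.++-assoc (map root Q) _ _))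
  (cong (_++ deeper f (Q ++ at (suc d) (kids m ts))) (≡.sym (List.map-++ root Q _))))

pop-size : ∀ {f} m d ts Q → forestSize (map shape ((m , d , node ts) ∷ Q)) ℕ.≤ suc f →
           forestSize (map shape (Q ++ at (suc d) (kids m ts))) ℕ.≤ f
pop-size m d ts Q (s≤s le) = ℕ.≤-trans (ℕ.≤-reflexive (≡.trans
  (cong forestSize (≡.trans (List.map-++ shape Q _) (cong (map shape Q ++_) (shapes-kids (suc d) m ts))))
  (≡.trans (forestSize-++ (map shape Q) ts) (ℕ.+-comm (forestSize (map shape Q)) _)))) le

bfsNodes-↭ : ∀ f Q → forestSize (map shape Q) ℕ.≤ f → bfsNodes f Q ↭ concatMap itemPreorder Q
bfsNodes-↭ zero    []                      _  = ↭-refl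
bfsNodes-↭ zero    ((_ , _ , node _) ∷ Q)  ()
bfsNodes-↭ (suc f) []                      _  = ↭-refl
bfsNodes-↭ (suc f) ((m , d , node ts) ∷ Q) le = begin
  bfsNodes (suc f) ((m , d , node ts) ∷ Q)                        ≡⟨ bfsNodes-pop f m d ts Q ⟩
  (m , d) ∷ bfsNodes f (Q ++ K)                                   ↭⟨ prep (m , d) (bfsNodes-↭ f (Q ++ K) (pop-size m d ts Q le)) ⟩
  (m , d) ∷ concatMap itemPreorder (Q ++ K)                       ≡⟨ cong ((m , d) ∷_) (List.concatMap-++ itemPreorder Q K) ⟩
  (m , d) ∷ (concatMap itemPreorder Q ++ concatMap itemPreorder K) ↭⟨ prep (m , d) (Perm.++-comm (concatMap itemPreorder Q) _) ⟩
  (m , d) ∷ (concatMap itemPreorder K ++ concatMap itemPreorder Q)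
    ≡⟨ cong (λ ns → (m , d) ∷ (ns ++ concatMap itemPreorder Q)) (preorder-kids (suc d) m ts) ⟩
  _ ∎
  where
  open Perm.PermutationReasoning
  K = at (suc d) (kids m ts)

deeper-all : ∀ {P : Node → Set} f Q → All (All P ∘ descendants) Q → All P (deeper f Q)
deeper-all zero    Q                       _          = []
deeper-all (suc f) []                      _          = []
deeper-all {P} (suc f) ((m , d , node ts) ∷ Q) (desc ∷ all) = All.++⁺
  (kids-roots m ts desc) (deeper-all f (Q ++ at (suc d) (kids m ts)) (All.++⁺ all (kids-descendants m ts desc)))
  where
  kids-roots : ∀ m ts → All P (forestPreorder m (suc d) ts) → All P (map root (at (suc d) (kids m ts)))
  kids-roots m []                 ps       = []
  kids-roots m (t@(node us) ∷ ts) (p ∷ ps) = p ∷ kids-roots _ ts (All.++⁻ʳ (forestPreorder m (suc (suc d)) us) ps)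

  kids-descendants : ∀ m ts → All P (forestPreorder m (suc d) ts) → All (All P ∘ descendants) (at (suc d) (kids m ts))
  kids-descendants m []                 ps       = []
  kids-descendants m (t@(node us) ∷ ts) (p ∷ ps) =
    All.++⁻ˡ (forestPreorder m (suc (suc d)) us) ps ∷ kids-descendants _ ts (All.++⁻ʳ (forestPreorder m (suc (suc d)) us) ps)

-- The subtree at `(m , t)` occupies the strip indices from `m` up to, but excluding,
-- `m + leaves t`. These intervals lie between `lo` and `hi`, disjoint and in increasing order.
data Increasing : ℕ → List (ℕ × Shape) → ℕ → Set where
  []  : ∀ {lo hi} → lo ℕ.≤ hi → Increasing lo [] hi
  _∷_ : ∀ {lo hi m t L} → lo ℕ.≤ m → Increasing (m ℕ.+ leaves t) L hi → Increasing lo ((m , t) ∷ L) hi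

kids-increasing : ∀ m ts → Increasing m (kids m ts) (m ℕ.+ forestLeaves ts)
kids-increasing m []       = [] (ℕ.m≤m+n m 0)
kids-increasing m (t ∷ ts) = ℕ.≤-refl ∷ subst (Increasing _ _) (ℕ.+-assoc m _ _) (kids-increasing (m ℕ.+ leaves t) ts)

increasing-weaken : ∀ {lo lo′ L hi} → lo′ ℕ.≤ lo → Increasing lo L hi → Increasing lo′ L hi
increasing-weaken le ([] le′)   = [] (ℕ.≤-trans le le′)
increasing-weaken le (le′ ∷ inc) = ℕ.≤-trans le le′ ∷ inc

increasing-++ : ∀ {lo mid L L′ hi} → Increasing lo L mid → Increasing mid L′ hi → Increasing lo (L ++ L′) hi
increasing-++ ([] le)     inc′ = increasing-weaken le inc′
increasing-++ (le ∷ inc) inc′ = le ∷ increasing-++ inc inc′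

increasing-split : ∀ {lo hi} L {m t L′} → Increasing lo (L ++ (m , t) ∷ L′) hi →
                   Increasing lo L m × Increasing (m ℕ.+ leaves t) L′ hi
increasing-split []      (le ∷ inc) = [] le , inc
increasing-split (_ ∷ L) (le ∷ inc) = map₁ (le ∷_) (increasing-split L inc)

increasing-≤ : ∀ {lo L hi} → Increasing lo L hi → lo ℕ.≤ hi
increasing-≤ ([] le)              = le
increasing-≤ (_∷_ {m = m} le inc) = ℕ.≤-trans le (ℕ.≤-trans (ℕ.m≤m+n m _) (increasing-≤ inc))

increasing-bounds : ∀ {lo L hi} → Increasing lo L hi → All (λ (m , _) → lo ℕ.≤ m × m ℕ.< hi) L
increasing-bounds ([] _)                        = []
increasing-bounds (_∷_ {m = m} {t = t} le inc) =
  (le , ℕ.<-≤-trans (ℕ.m<m+n m (leaves>0 t)) (increasing-≤ inc))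
  ∷ All.map (map₁ (ℕ.≤-trans (ℕ.≤-trans le (ℕ.m≤m+n m _)))) (increasing-bounds inc)

-- The children divide the interval of their parent among themselves; a leaf gives its interval up.
increasing-pop : ∀ {lo hi m} L ts {L′} → Increasing lo (L ++ (m , node ts) ∷ L′) hi →
                 Increasing lo ((L ++ kids m ts) ++ L′) hi
increasing-pop {m = m} L ts inc with increasing-split L inc
... | incˡ , incʳ = increasing-++ (increasing-++ incˡ (kids-increasing m ts)) (increasing-weaken (le ts) incʳ)
  where
  le : ∀ ts → m ℕ.+ forestLeaves ts ℕ.≤ m ℕ.+ leaves (node ts)
  le []       = ℕ.+-monoʳ-≤ m z≤n
  le (_ ∷ ts) = ℕ.≤-refl

-- Shifted contents of cells in the queue

module Positions (k : ℕ) where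
  -- A cell β after α: Near cells can form an inversion with α, First is the next cell of its
  -- strip, and Far cells do not interact with it.
  Near First Far : Node → Node → Set
  Near  α β = proj₁ α ≢ proj₁ β × shifted k α ℕ.< shifted k β × shifted k β ℕ.< shifted k α ℕ.+ k
  First α β = proj₁ α ≡ proj₁ β × shifted k β ≡ shifted k α ℕ.+ k
  Far   α β = shifted k α ℕ.+ k ℕ.< shifted k β

  -- Strip indices run from 1 to `k`, so shifted contents order cells by depth and then by strip
  -- index. The open window of length `k` after a cell reaches the later strips of its own level and
  -- the earlier strips of the next level.
  near-same : ∀ {m m′ d} → 1 ℕ.≤ m → m ℕ.< m′ → m′ ℕ.≤ k → Near (m , d) (m′ , d)
  near-same {m} {m′} {d} 1≤m m<m′ m′≤k = ℕ.<⇒≢ m<m′ , ℕ.+-monoʳ-< (k ℕ.* d) m<m′ , (begin-strict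
    k ℕ.* d ℕ.+ m′       ≤⟨ ℕ.+-monoʳ-≤ (k ℕ.* d) m′≤k ⟩
    k ℕ.* d ℕ.+ k        <⟨ ℕ.+-monoˡ-< k (ℕ.m<m+n (k ℕ.* d) 1≤m) ⟩
    k ℕ.* d ℕ.+ m ℕ.+ k  ∎)
    where open ℕ.≤-Reasoning

  next-depth : ∀ m d → k ℕ.* suc d ℕ.+ m ≡ k ℕ.* d ℕ.+ m ℕ.+ k
  next-depth m d = ≡.trans (cong (ℕ._+ m) (ℕ.*-suc k d)) (≡.trans (ℕ.+-assoc k _ m) (ℕ.+-comm k _))

  near-next : ∀ {m m′ d} → m′ ℕ.< m → 1 ℕ.≤ m′ → m ℕ.≤ k → Near (m , d) (m′ , suc d)
  near-next {m} {m′} {d} m′<m 1≤m′ m≤k = (ℕ.<⇒≢ m′<m ∘ ≡.sym) , (begin-strict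
    k ℕ.* d ℕ.+ m        ≤⟨ ℕ.+-monoʳ-≤ (k ℕ.* d) m≤k ⟩
    k ℕ.* d ℕ.+ k        <⟨ ℕ.m<m+n _ 1≤m′ ⟩
    k ℕ.* d ℕ.+ k ℕ.+ m′ ≡⟨ cong (ℕ._+ m′) (≡.trans (ℕ.+-comm _ k) (≡.sym (ℕ.*-suc k d))) ⟩
    k ℕ.* suc d ℕ.+ m′   ∎) , (begin-strict
    k ℕ.* suc d ℕ.+ m′   <⟨ ℕ.+-monoʳ-< (k ℕ.* suc d) m′<m ⟩
    k ℕ.* suc d ℕ.+ m    ≡⟨ next-depth m d ⟩
    k ℕ.* d ℕ.+ m ℕ.+ k  ∎)
    where open ℕ.≤-Reasoning

  far-next : ∀ {m m′ d d′} → m ℕ.< m′ → suc d ℕ.≤ d′ → Far (m , d) (m′ , d′)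
  far-next {m} {m′} {d} {d′} m<m′ d<d′ = begin-strict
    k ℕ.* d ℕ.+ m ℕ.+ k    ≡⟨ next-depth m d ⟨
    k ℕ.* suc d ℕ.+ m      <⟨ ℕ.+-mono-≤-< (ℕ.*-monoʳ-≤ k d<d′) m<m′ ⟩
    k ℕ.* d′ ℕ.+ m′        ∎
    where open ℕ.≤-Reasoning

  far-below : ∀ {m m′ d d′} → m ℕ.≤ k → 1 ℕ.≤ m′ → suc (suc d) ℕ.≤ d′ → Far (m , d) (m′ , d′)
  far-below {m} {m′} {d} {d′} m≤k 1≤m′ d<d′ = begin-strict
    k ℕ.* d ℕ.+ m ℕ.+ k    ≡⟨ next-depth m d ⟨
    k ℕ.* suc d ℕ.+ m      ≤⟨ ℕ.+-monoʳ-≤ (k ℕ.* suc d) m≤k ⟩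
    k ℕ.* suc d ℕ.+ k      ≡⟨ ℕ.+-comm _ k ⟩
    k ℕ.+ k ℕ.* suc d      ≡⟨ ℕ.*-suc k (suc d) ⟨
    k ℕ.* suc (suc d)      ≤⟨ ℕ.*-monoʳ-≤ k d<d′ ⟩
    k ℕ.* d′               <⟨ ℕ.m<m+n _ 1≤m′ ⟩
    k ℕ.* d′ ℕ.+ m′        ∎
    where open ℕ.≤-Reasoning

zip-++ : (xs ys : List A) (w : List B) →
         zip (xs ++ ys) w ≡ zip xs (take (length xs) w) ++ zip ys (drop (length xs) w)
zip-++ []       ys w       = ≡.refl
zip-++ {B = B} (x ∷ xs) ys []      = ≡.sym (zip-[] ys)
  where
  zip-[] : (ys : List A) → zip ys ([] {A = B}) ≡ []
  zip-[] []      = ≡.refl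
  zip-[] (_ ∷ _) = ≡.refl
zip-++ (x ∷ xs) ys (b ∷ w) = cong ((x , b) ∷_) (zip-++ xs ys w)

-- The queue consists of the vertices A at depth d followed by the vertices B at depth d + 1;
-- in the order B, A their strip indices increase.
queue : ℕ → List (ℕ × Shape) → List (ℕ × Shape) → List Item
queue d A B = at d A ++ at (suc d) B

queue-pop : ∀ d A B K → queue d A B ++ at (suc d) K ≡ queue d A (B ++ K)
queue-pop d A B K = ≡.trans (List.++-assoc (at d A) _ _) (cong (at d A ++_) (≡.sym (List.map-++ _ B K)))

-- For the popped cell `(m , d)`, `A` lies on later strips of its level and `B` on earlier strips of
-- the next, so the whole queue is inside its window. The first child sits exactly at distance `k`,
-- and all remaining cells lie beyond.
module PopPositions (k f d m : ℕ) (ts : List Shape) (A B : List (ℕ × Shape)) {lo hi : ℕ}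
           (1≤lo : 1 ℕ.≤ lo) (hi≤ : hi ℕ.≤ suc k) (inc : Increasing lo (B ++ (m , node ts) ∷ A) hi) where
  open Positions k

  private
    incˡ = proj₁ (increasing-split B inc)
    incʳ = proj₂ (increasing-split B inc)

  1≤m : 1 ℕ.≤ m
  1≤m = ℕ.≤-trans 1≤lo (increasing-≤ incˡ)

  m≤k : m ℕ.≤ k
  m≤k = ℕ.≤-pred (ℕ.≤-trans (ℕ.<-≤-trans (ℕ.m<m+n m (leaves>0 (node ts))) (increasing-≤ incʳ)) hi≤)

  m<A : All (λ (m′ , _) → m ℕ.< m′ × m′ ℕ.≤ k) A
  m<A = All.map (λ (le , lt) → ℕ.<-≤-trans (ℕ.m<m+n m (leaves>0 (node ts))) le , ℕ.≤-pred (ℕ.≤-trans lt hi≤))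
    (increasing-bounds incʳ)

  B<m : All (λ (m′ , _) → 1 ℕ.≤ m′ × m′ ℕ.< m) B
  B<m = All.map (map₁ (ℕ.≤-trans 1≤lo)) (increasing-bounds incˡ)

  queue-near : All (Near (m , d)) (map root (queue d A B))
  queue-near = All.map⁺ (All.++⁺
    (All.map⁺ (All.map (λ (m<m′ , m′≤k) → near-same 1≤m m<m′ m′≤k) m<A))
    (All.map⁺ (All.map (λ (1≤m′ , m′<m) → near-next m′<m 1≤m′ m≤k) B<m)))

  later-kids-far : ∀ t us → All (Far (m , d)) (map root (at (suc d) (kids (m ℕ.+ leaves t) us)))
  later-kids-far t us = All.map⁺ (All.map⁺ (All.map
    (λ (le , _) → far-next (ℕ.<-≤-trans (ℕ.m<m+n m (leaves>0 t)) le) ℕ.≤-refl)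
    (increasing-bounds (kids-increasing (m ℕ.+ leaves t) us))))

  deeper-far : All (Far (m , d)) (deeper f (queue d A B ++ at (suc d) (kids m ts)))
  deeper-far = deeper-all f _ (All.++⁺ (All.++⁺
    (All.map⁺ (All.map (λ {(m′ , t)} (lt , _) → same-depth m′ t lt) m<A))
    (All.map⁺ (All.map (λ {(m′ , t)} (1≤m′ , _) → next-depth′ m′ t 1≤m′) B<m)))
    (All.map⁺ (All.map (λ {(m′ , t)} (le , _) → next-depth′ m′ t (ℕ.≤-trans 1≤m le)) (increasing-bounds (kids-increasing m ts)))))
    where
    same-depth : ∀ m′ t → m ℕ.< m′ → All (Far (m , d)) (descendants (m′ , d , t))
    same-depth m′ (node us) lt = All.map (λ (le , _ , d<) → far-next (ℕ.<-≤-trans lt le) d<)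
      (forestPreorder-within m′ (suc d) us)

    next-depth′ : ∀ m′ t → 1 ℕ.≤ m′ → All (Far (m , d)) (descendants (m′ , suc d , t))
    next-depth′ m′ (node us) 1≤m′ = All.map (λ (le , _ , d<) → far-below m≤k (ℕ.≤-trans 1≤m′ le) d<)
      (forestPreorder-within m′ (suc (suc d)) us)

-- LLT polynomials of plane trees

module StripLLT {c ℓ : Level} (R : CommutativeRing c ℓ) (q : CommutativeRing.Carrier R)
               (N : ℕ) (x : Fin N → CommutativeRing.Carrier R) where
  open CommutativeRing R
  open Poly R q N x
  open Sums R
  open Process R q N x
  open SetoidReasoning setoid
  open NatSolver commutativeSemiring using (solve; _:=_; _:+_; _:*_; con)

  ∏² : List A → (A → A → Carrier) → Carrier
  ∏² xs f = ∏ xs (λ a → ∏ xs (f a))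

  ∏²-∷ : (a : A) (xs : List A) (f : A → A → Carrier) →
         ∏² (a ∷ xs) f ≈ ((f a a * ∏ xs (f a)) * ∏ xs (λ b → f b a)) * ∏² xs f
  ∏²-∷ a xs f = trans (*-congˡ (∏-* xs _ _)) (sym (*-assoc _ _ _))

  ∏²-↭ : {xs ys : List A} → xs ↭ ys → (f : A → A → Carrier) → ∏² xs f ≈ ∏² ys f
  ∏²-↭ {xs = xs} p f = trans (∏-cong xs (λ a → ∏-↭ p (f a))) (∏-↭ p _)

  -- Relisting the cells permutes the letters of a filling along with them. Invariance of `φ` is
  -- what the transposition of two cells requires.
  ∑-allFuns-↭ : {cs cs′ : List A} → cs ↭ cs′ → (φ : List (A × Fin N) → Carrier) →
    (∀ {z z′} → z ↭ z′ → φ z ≈ φ z′) →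
    ∑[ g ∈ allFuns N (length cs) ] φ (zip cs g) ≈ ∑[ g ∈ allFuns N (length cs′) ] φ (zip cs′ g)
  ∑-allFuns-↭ Perm.refl              φ inv = refl
  ∑-allFuns-↭ {cs = c ∷ cs} {.c ∷ cs′} (Perm.prep _ p) φ inv = trans (∑-allFuns-suc N (length cs) _)
    (trans (∑-cong (allFin N) (λ {a} _ → ∑-allFuns-↭ p (φ ∘ ((c , a) ∷_)) (λ z↭ → inv (prep _ z↭))))
      (sym (∑-allFuns-suc N (length cs′) _)))
  ∑-allFuns-↭ {cs = c ∷ d ∷ cs} {.d ∷ .c ∷ cs′} (Perm.swap _ _ p) φ inv = begin
    _ ≈⟨ ∑-allFuns-suc N (suc (length cs)) _ ⟩
    _ ≈⟨ ∑-cong (allFin N) (λ _ → ∑-allFuns-suc N (length cs) _) ⟩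
    _ ≈⟨ ∑-swap (allFin N) (allFin N) _ ⟩
    _ ≈⟨ ∑-cong (allFin N) (λ {b} _ → ∑-cong (allFin N) (λ {a} _ → trans
           (∑-allFuns-↭ p (λ z → φ ((c , a) ∷ (d , b) ∷ z)) (λ z↭ → inv (prep _ (prep _ z↭))))
           (∑-cong (allFuns N (length cs′)) (λ _ → inv (Perm.swap _ _ ↭-refl))))) ⟩
    _ ≈⟨ ∑-cong (allFin N) (λ _ → ∑-allFuns-suc N (length cs′) _) ⟨
    _ ≈⟨ ∑-allFuns-suc N (suc (length cs′)) _ ⟨
    _ ∎
  ∑-allFuns-↭ (Perm.trans p p′)      φ inv = trans (∑-allFuns-↭ p φ inv) (∑-allFuns-↭ p′ φ inv)

  Filled : Set
  Filled = Node × Fin N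

  pow-filterᵇ : (p : A → Bool) (xs : List A) → pow q (length (filterᵇ p xs)) ≈ ∏ xs (λ a → if p a then q else 1#)
  pow-filterᵇ p []       = refl
  pow-filterᵇ p (a ∷ as) with p a
  ... | true  = *-congˡ (pow-filterᵇ p as)
  ... | false = trans (pow-filterᵇ p as) (sym (*-identityˡ _))

  pow-concatMap : (p : A → B → Bool) (ys : List B) (xs : List A) →
    pow q (length (concatMap (λ a → filterᵇ (p a) ys) xs)) ≈ ∏ xs (λ a → ∏ ys (λ b → if p a b then q else 1#))
  pow-concatMap p ys []       = refl
  pow-concatMap p ys (a ∷ as) = trans
    (reflexive (cong (pow q) (List.length-++ (filterᵇ (p a) ys))))
    (trans (pow-+ q (length (filterᵇ (p a) ys)) _) (*-cong (pow-filterᵇ (p a) ys) (pow-concatMap p ys as)))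

  ∏-zip-1 : ∀ {P : Node → Set} (f : Filled → Carrier) → (∀ {β} → P β → ∀ v → f (β , v) ≈ 1#) →
            ∀ {νs} → All P νs → ∀ w → ∏ (zip νs w) f ≈ 1#
  ∏-zip-1 f f≈1 []       w       = refl
  ∏-zip-1 f f≈1 (p ∷ ps) []      = refl
  ∏-zip-1 f f≈1 (p ∷ ps) (v ∷ w) = trans (*-cong (f≈1 p v) (∏-zip-1 f f≈1 ps w)) (*-identityˡ 1#)

  module Interactions (k : ℕ) (k>0 : 0 ℕ.< k) where
    open Positions k

    -- Admissibility and the inversion statistic as factors attached to ordered pairs of filled
    -- cells. Their product over all pairs is the same for every listing of the cells.
    strictness inversion : Filled → Filled → Carrier
    strictness ((m , d) , u) ((m′ , d′) , v) =
      if (m ≡ᵇ m′) ∧ (shifted k (m′ , d′) ≡ᵇ shifted k (m , d) ℕ.+ k) then ι u v else 1#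
    inversion (α , u) (β , v) =
      if (shifted k α <ᵇ shifted k β) ∧ (shifted k β <ᵇ shifted k α ℕ.+ k) ∧ (u ≻ v) then q else 1#

    interaction : Filled → Filled → Carrier
    interaction z z′ = strictness z z′ * inversion z z′

    filledCell : Filled → FCell
    filledCell ((m , d) , u) = m , shifted k (m , d) , toℕ u

    fill-zip : ∀ νs (g : List (Fin N)) → fill (map (cell k) νs) g ≡ map filledCell (zip νs g)
    fill-zip []       g       = ≡.refl
    fill-zip (ν ∷ νs) []      = ≡.refl
    fill-zip (ν ∷ νs) (u ∷ g) = cong (filledCell (ν , u) ∷_) (fill-zip νs g)

    strictness-not-below : ∀ α β u v → ¬ Below k α β → strictness (α , u) (β , v) ≈ 1#
    strictness-not-below (m , d) (m′ , d′) u v ¬below with m ≡ᵇ m′ in eq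
    ... | false = refl
    ... | true with shifted k (m′ , d′) ≡ᵇ shifted k (m , d) ℕ.+ k in eq′
    ...   | false = refl
    ...   | true  = ⊥-elim (¬below (ℕ.≡ᵇ⇒≡ m m′ (subst T (≡.sym eq) _) , ℕ.≡ᵇ⇒≡ _ _ (subst T (≡.sym eq′) _)))

    strictness-first : ∀ α β u v → Below k α β → strictness (α , u) (β , v) ≈ ι u v
    strictness-first (m , d) _ u v (≡.refl , eq) rewrite ≡ᵇ-refl m | eq | ≡ᵇ-refl (k ℕ.* d ℕ.+ m ℕ.+ k) = refl

    strictness-self : ∀ α u → strictness (α , u) (α , u) ≈ 1#
    strictness-self α u = strictness-not-below α α u u (not-above k k>0 (inj₂ ℕ.≤-refl))

    admissible-one : ∀ α (u : Fin N) → 1# ≈ ∏² ((α , u) ∷ []) strictness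
    admissible-one α u = sym (trans (*-congʳ (*-congʳ (strictness-self α u)))
      (solve 0 ((con 1 :* con 1) :* con 1 := con 1) refl))

    -- By `StripOrdered` the head of the list has a nontrivial strictness factor at most with the
    -- next cell, which is the pair that `admissible` tests.
    admissible≈ : ∀ {νs} → StripOrdered k νs → ∀ g →
      (if admissible (map filledCell (zip νs g)) then 1# else 0#) ≈ ∏² (zip νs g) strictness
    admissible≈ []      g       = refl
    admissible≈ (one α) []      = refl
    admissible≈ (one α) (u ∷ []) = admissible-one α u
    admissible≈ (one α) (u ∷ _ ∷ _) = admissible-one α u
    admissible≈ (_ ∷ _) []      = refl
    admissible≈ (_∷_ {α} _ _) (u ∷ []) = admissible-one α u
    admissible≈ (_∷_ {α@(m , d)} {β@(m′ , d′)} {νs} (fst , ¬below , ¬above) ord) (u ∷ v ∷ g) = sym (begin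
      _ ≈⟨ ∏²-∷ (α , u) (zip (β ∷ νs) (v ∷ g)) strictness ⟩
      _ ≈⟨ *-cong (*-cong (*-cong (strictness-self α u)
             (*-congˡ (∏-zip-1 _ (λ {γ} ¬b v → strictness-not-below α γ u v ¬b) ¬below g)))
             (∏-zip-1 (λ z → strictness z (α , u)) (λ {γ} ¬a v → strictness-not-below γ α v u ¬a) ¬above (v ∷ g)))
             (sym (admissible≈ ord (v ∷ g))) ⟩
      _ ≈⟨ *-congʳ (solve 1 (λ s → (con 1 :* (s :* con 1)) :* con 1 := s) refl _) ⟩
      _ ≈⟨ *-congʳ first-strictness ⟩
      _ ≈⟨ if-∧ (not (m ≡ᵇ m′) ∨ (u ≻ v)) _ ⟩
      _ ∎)
      where
      first-strictness : strictness (α , u) (β , v) ≈ (if not (m ≡ᵇ m′) ∨ (u ≻ v) then 1# else 0#)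
      first-strictness with m ≡ᵇ m′ in eq
      ... | false = refl
      ... | true rewrite fst (ℕ.≡ᵇ⇒≡ m m′ (subst T (≡.sym eq) _)) | ≡ᵇ-refl (shifted k α ℕ.+ k) = refl
      if-∧ : ∀ b b′ → (if b then 1# else 0#) * (if b′ then 1# else 0#) ≈ (if b ∧ b′ then 1# else 0#)
      if-∧ true  b′ = *-identityˡ _
      if-∧ false b′ = zeroˡ _

    pow-invF : ∀ zs → pow q (invF k (map filledCell zs)) ≈ ∏² zs inversion
    pow-invF zs = trans (pow-concatMap _ (map filledCell zs) (map filledCell zs))
      (trans (∏-map filledCell zs _) (∏-cong zs (λ _ → ∏-map filledCell zs _)))

    interaction-near : ∀ α β u v → Near α β → interaction (α , u) (β , v) ≈ e u v
    interaction-near (m , _) (m′ , _) u v (m≢m′ , s<s′ , s′<s+k)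
      rewrite ≡ᵇ-≢ m≢m′ | <⇒<ᵇ-true s<s′ | <⇒<ᵇ-true s′<s+k = *-identityˡ _

    inversion-1 : ∀ α β u v → shifted k α ℕ.+ k ℕ.≤ shifted k β → inversion (α , u) (β , v) ≈ 1#
    inversion-1 α β u v le rewrite ≥⇒<ᵇ-false le with shifted k α <ᵇ shifted k β
    ... | true  = refl
    ... | false = refl

    interaction-first : ∀ α β u v → First α β → interaction (α , u) (β , v) ≈ ι u v
    interaction-first α β u v fst@(_ , eq) = trans
      (*-cong (strictness-first α β u v fst) (inversion-1 α β u v (ℕ.≤-reflexive (≡.sym eq)))) (*-identityʳ _)

    interaction-far : ∀ α β u v → Far α β → interaction (α , u) (β , v) ≈ 1#
    interaction-far α β u v far = trans
      (*-cong (strictness-not-below α β u v (λ (_ , eq) → ℕ.<⇒≢ far (≡.sym eq))) (inversion-1 α β u v (ℕ.<⇒≤ far)))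
      (*-identityʳ _)

    interaction-back : ∀ α β u v → shifted k α ℕ.≤ shifted k β → interaction (β , v) (α , u) ≈ 1#
    interaction-back α β u v le
      rewrite ≥⇒<ᵇ-false {shifted k β} {shifted k α} le = trans (*-identityʳ _)
        (strictness-not-below β α v u (λ (_ , eq) → ℕ.<⇒≢ (ℕ.≤-<-trans le (ℕ.m<m+n (shifted k β) k>0)) eq))

    ∏-near : ∀ α u {νs} → All (Near α) νs → ∀ w →
      ∏ (zip νs (take (length νs) w)) (interaction (α , u)) ≈ cross u (take (length νs) w)
    ∏-near α u []       w       = refl
    ∏-near α u (n ∷ ns) []      = refl
    ∏-near α u (_∷_ {β} n ns) (v ∷ w) = *-cong (interaction-near α β u v n) (∏-near α u ns w)

    far⇒after : ∀ {α β} → Far α β → shifted k α ℕ.≤ shifted k β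
    far⇒after far = ℕ.<⇒≤ (ℕ.≤-<-trans (ℕ.m≤m+n _ k) far)

    module _ (f d m : ℕ) (ts : List Shape) (A B : List (ℕ × Shape)) {lo hi : ℕ}
             (1≤lo : 1 ℕ.≤ lo) (hi≤ : hi ℕ.≤ suc k) (inc : Increasing lo (B ++ (m , node ts) ∷ A) hi) where
      open PopPositions k f d m ts A B 1≤lo hi≤ inc

      private
        Q = queue d A B
        K = at (suc d) (kids m ts)
        D = deeper f (Q ++ K)

      -- The first child is the cell beneath `u` in its strip and contributes `ι`; every cell after
      -- it is far. Only the guard is left.
      ∏-children : ∀ us u w → All (Far (m , d)) D →
        let νs = map root (at (suc d) (kids m us)) ++ D in length w ≡ length νs →
        ∏ (zip νs w) (interaction ((m , d) , u)) ≈ guard (length us) u w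
      ∏-children []       u w       far _ = ∏-zip-1 _ (λ {β} far v → interaction-far (m , d) β u v far) far w
      ∏-children (t ∷ us) u (v ∷ w) far _ = trans
        (*-cong (interaction-first (m , d) (m , suc d) u v (≡.refl , next-depth m d))
          (∏-zip-1 _ (λ {β} far v → interaction-far (m , d) β u v far) (All.++⁺ (later-kids-far t us) far) w))
        (*-identityʳ _)

      ∏-popped : ∀ u w → length w ≡ length (map root Q ++ (map root K ++ D)) →
        ∏ (zip (map root Q ++ (map root K ++ D)) w) (interaction ((m , d) , u))
          ≈ guard (length ts) u (drop (length Q) w) * cross u (take (length Q) w)
      ∏-popped u w |w| rewrite zip-++ (map root Q) (map root K ++ D) w = begin
        _ ≈⟨ ∏-++ (zip (map root Q) (take (length (map root Q)) w)) _ _ ⟩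
        _ ≈⟨ *-cong (∏-near (m , d) u queue-near w) (∏-children ts u _ deeper-far |rest|) ⟩
        _ ≈⟨ *-comm _ _ ⟩
        _ ≡⟨ cong (λ n → guard (length ts) u (drop n w) * cross u (take n w)) (List.length-map root Q) ⟩
        _ ∎
        where
        |rest| : length (drop (length (map root Q)) w) ≡ length (map root K ++ D)
        |rest| = ≡.trans (List.length-drop (length (map root Q)) w) (≡.trans (cong (ℕ._∸ length (map root Q)) (≡.trans |w| (List.length-++ (map root Q))))
          (ℕ.m+n∸m≡n (length (map root Q)) _))

      all-after : All (λ β → shifted k (m , d) ℕ.≤ shifted k β) (map root Q ++ (map root K ++ D))
      all-after = All.++⁺ (All.map (λ (_ , lt , _) → ℕ.<⇒≤ lt) queue-near)
        (All.++⁺ (kids-after ts) (All.map (λ {β} → far⇒after {m , d} {β}) deeper-far))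
        where
        kids-after : ∀ us → All (λ β → shifted k (m , d) ℕ.≤ shifted k β) (map root (at (suc d) (kids m us)))
        kids-after []       = []
        kids-after (t ∷ us) = ℕ.≤-trans (ℕ.m≤m+n _ k) (ℕ.≤-reflexive (≡.sym (next-depth m d)))
          ∷ All.map (λ {β} → far⇒after {m , d} {β}) (later-kids-far t us)

      ∏²-pop : ∀ u w → length w ≡ length (map root Q ++ (map root K ++ D)) →
        ∏² (zip ((m , d) ∷ (map root Q ++ (map root K ++ D))) (u ∷ w)) interaction
          ≈ (guard (length ts) u (drop (length Q) w) * cross u (take (length Q) w))
              * ∏² (zip (map root Q ++ (map root K ++ D)) w) interaction
      ∏²-pop u w |w| = trans (∏²-∷ ((m , d) , u) (zip (map root Q ++ (map root K ++ D)) w) interaction)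
        (*-congʳ (trans (*-cong (*-cong (interaction-back (m , d) (m , d) u u ℕ.≤-refl) (∏-popped u w |w|))
          (∏-zip-1 (λ z → interaction z ((m , d) , u)) (λ {β} le v → interaction-back (m , d) β u v le) all-after w))
          (trans (*-identityʳ _) (*-identityˡ _))))

    mutual
      bfs-weight : ∀ f d A B {lo hi} v → 1 ℕ.≤ lo → hi ℕ.≤ suc k → Increasing lo (B ++ A) hi →
        forestSize (map shape (queue d A B)) ℕ.≤ f → length v ≡ length (bfsNodes f (queue d A B)) →
        ∏² (zip (bfsNodes f (queue d A B)) v) interaction
          ≈ degreeWeight (length (queue d A B)) (bfsDegrees f (map shape (queue d A B))) v
      bfs-weight zero    d [] [] v _ _ _ _ _ = refl
      bfs-weight (suc f) d [] [] v _ _ _ _ _ = refl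
      -- Level `d` is used up, so `B` becomes the current level and the next one starts empty.
      bfs-weight f d [] ((m , t) ∷ B) {lo} {hi} v 1≤ ≤k inc le |v|
        rewrite ≡.sym (List.++-identityʳ (at (suc d) B)) =
        bfs-weight-∷ f (suc d) m t B [] v 1≤ ≤k (subst (λ L → Increasing lo L hi) (List.++-identityʳ _) inc) le |v|
      bfs-weight f d ((m , t) ∷ A) B v 1≤ ≤k inc le |v| = bfs-weight-∷ f d m t A B v 1≤ ≤k inc le |v|

      bfs-weight-∷ : ∀ f d m t A B {lo hi} v → 1 ℕ.≤ lo → hi ℕ.≤ suc k → Increasing lo (B ++ (m , t) ∷ A) hi →
        forestSize (map shape (queue d ((m , t) ∷ A) B)) ℕ.≤ f →
        length v ≡ length (bfsNodes f (queue d ((m , t) ∷ A) B)) →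
        ∏² (zip (bfsNodes f (queue d ((m , t) ∷ A) B)) v) interaction
          ≈ degreeWeight (length (queue d ((m , t) ∷ A) B)) (bfsDegrees f (map shape (queue d ((m , t) ∷ A) B))) v
      bfs-weight-∷ zero    d m (node ts) A B v       1≤ ≤k inc () |v|
      bfs-weight-∷ (suc f) d m (node ts) A B (u ∷ w) 1≤ ≤k inc le |v| = trans
        (∏²-pop f d m ts A B 1≤ ≤k inc u w (ℕ.suc-injective |v|))
        (*-congˡ (begin
          _ ≡⟨ cong (λ νs → ∏² (zip νs w) interaction) nodes≡ ⟩
          ∏² (zip (bfsNodes f (queue d A (B ++ kids m ts))) w) interaction
            ≈⟨ bfs-weight f d A (B ++ kids m ts) w 1≤ ≤k (increasing-pop B ts inc)
                 (subst (λ Q → forestSize (map shape Q) ℕ.≤ f) (queue-pop d A B (kids m ts)) (pop-size m d ts (queue d A B) le))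
                 (≡.trans (ℕ.suc-injective |v|) (cong length nodes≡)) ⟩
          _ ≡⟨ cong₂ (λ k as → degreeWeight k as w) |queue| (cong (bfsDegrees f) shapes≡) ⟩
          _ ∎))
        where
        Q = queue d A B
        K = at (suc d) (kids m ts)
        nodes≡ : map root Q ++ (map root K ++ deeper f (Q ++ K)) ≡ bfsNodes f (queue d A (B ++ kids m ts))
        nodes≡ = ≡.trans (List.∷-injectiveʳ (bfsNodes-pop f m d ts Q)) (cong (bfsNodes f) (queue-pop d A B (kids m ts)))
        shapes≡ : map shape (queue d A (B ++ kids m ts)) ≡ map shape Q ++ ts
        shapes≡ = ≡.trans (cong (map shape) (≡.sym (queue-pop d A B (kids m ts))))
          (≡.trans (List.map-++ shape Q K) (cong (map shape Q ++_) (shapes-kids (suc d) m ts)))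
        |queue| : length (queue d A (B ++ kids m ts)) ≡ length Q ℕ.+ length ts
        |queue| = ≡.trans (≡.sym (List.length-map shape (queue d A (B ++ kids m ts)))) (≡.trans (cong length shapes≡)
          (≡.trans (List.length-++ (map shape Q)) (cong (ℕ._+ length ts) (List.length-map shape Q))))

  LLT-strips : ∀ t → LLT (strips t 0)
    ≈ ∑[ v ∈ allFuns N (size t) ] degreeWeight 1 (bfsDegrees (size t) (t ∷ [])) v * monomial v
  LLT-strips t = begin
    _ ≡⟨ cong₂ (λ k cs → ∑[ g ∈ allFuns N (length cs) ]
           (if admissible (fill cs g) then pow q (invF k (fill cs g)) * monomial g else 0#))
           (length-strips t 0) (cellsOf-strips t) ⟩
    _ ≡⟨ cong (λ n → ∑[ g ∈ allFuns N n ]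
           (if admissible (fill (map (cell k) νs) g) then pow q (invF k (fill (map (cell k) νs) g)) * monomial g else 0#))
           (List.length-map (cell k) νs) ⟩
    _ ≈⟨ ∑-cong (allFuns N (length νs)) (λ {g} g∈ → cell-weight g (allFuns-length N _ g∈)) ⟩
    ∑[ g ∈ allFuns N (length νs) ] φ (zip νs g)
      -- The passage from preorder, in which the strips list their cells, to breadth-first order.
      ≈⟨ ∑-allFuns-↭ (↭-sym ↭-bfs) φ (λ p → *-cong (∏²-↭ p interaction) (∏-↭ p _)) ⟩
    ∑[ g ∈ allFuns N (length (bfsNodes (size t) Q)) ] φ (zip (bfsNodes (size t) Q) g)
      ≈⟨ ∑-cong (allFuns N (length (bfsNodes (size t) Q))) (λ {g} g∈ → *-cong
           (bfs-weight (size t) 0 ((1 , t) ∷ []) [] g (s≤s z≤n) ℕ.≤-refl (ℕ.≤-refl ∷ [] ℕ.≤-refl)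
             (ℕ.≤-reflexive (ℕ.+-identityʳ (size t))) (allFuns-length N _ g∈))
           (zip-monomial (bfsNodes (size t) Q) g (≡.sym (allFuns-length N _ g∈)))) ⟩
    _ ≡⟨ cong (λ n → ∑[ v ∈ allFuns N n ] degreeWeight 1 (bfsDegrees (size t) (t ∷ [])) v * monomial v) |bfs| ⟩
    _ ∎
    where
    k = leaves t
    νs = preorder 1 0 t
    Q = (1 , 0 , t) ∷ []
    open Interactions k (leaves>0 t)

    φ : List Filled → Carrier
    φ z = ∏² z interaction * ∏ z (x ∘ proj₂)

    zip-monomial : ∀ (νs : List Node) g → length νs ≡ length g → ∏ (zip νs g) (x ∘ proj₂) ≈ monomial g
    zip-monomial []       []      _  = refl
    zip-monomial (ν ∷ νs) (u ∷ g) eq = *-congˡ (zip-monomial νs g (ℕ.suc-injective eq))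

    ↭-bfs : bfsNodes (size t) Q ↭ νs
    ↭-bfs = subst (bfsNodes (size t) Q ↭_) (List.++-identityʳ νs)
      (bfsNodes-↭ (size t) Q (ℕ.≤-reflexive (ℕ.+-identityʳ (size t))))

    |bfs| : length (bfsNodes (size t) Q) ≡ size t
    |bfs| = ≡.trans (Perm.↭-length ↭-bfs) (length-preorder 1 0 t)

    ordered : StripOrdered k νs
    ordered = subst (StripOrdered k) (List.++-identityʳ νs) (preorder-ordered k (leaves>0 t) 1 0 t [] [] [])

    if-* : ∀ b {y z} → (if b then y * z else 0#) ≈ ((if b then 1# else 0#) * y) * z
    if-* true  = *-congʳ (sym (*-identityˡ _))
    if-* false = sym (trans (*-congʳ (zeroˡ _)) (zeroˡ _))

    cell-weight : ∀ g → length g ≡ length νs →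
      (if admissible (fill (map (cell k) νs) g) then pow q (invF k (fill (map (cell k) νs) g)) * monomial g else 0#)
        ≈ φ (zip νs g)
    cell-weight g |g| rewrite fill-zip νs g = trans (if-* (admissible (map filledCell (zip νs g))))
      (*-cong (trans (*-cong (admissible≈ ordered g) (pow-invF (zip νs g)))
        (trans (sym (∏-* (zip νs g) _ _)) (∏-cong (zip νs g) (λ z → sym (∏-* (zip νs g) _ _)))))
        (sym (zip-monomial νs g (≡.sym |g|))))

-- Boolean tests, filters and duplicate-free lists

true≢false : {b : Bool} → b ≡ true → b ≡ false → A
true≢false ≡.refl ()

any-true⁻ : (p : A → Bool) (xs : List A) → any p xs ≡ true → ∃ λ a → a ∈ xs × p a ≡ true
any-true⁻ p (a ∷ as) eq with p a in pa
... | true  = a , here ≡.refl , pa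
... | false = map₂ (map₁ there) (any-true⁻ p as eq)

any-true⁺ : (p : A → Bool) {xs : List A} {a : A} → a ∈ xs → p a ≡ true → any p xs ≡ true
any-true⁺ p {a ∷ _} (here ≡.refl) eq rewrite eq = ≡.refl
any-true⁺ p {b ∷ _} (there a∈) eq with p b
... | true  = ≡.refl
... | false = any-true⁺ p a∈ eq

all-true⁻ : (p : A → Bool) {xs : List A} {a : A} → all p xs ≡ true → a ∈ xs → p a ≡ true
all-true⁻ p {b ∷ _} eq a∈ with p b in pb
all-true⁻ p eq (here ≡.refl) | true = pb
all-true⁻ p eq (there a∈)  | true = all-true⁻ p eq a∈

all-true⁺ : (p : A → Bool) (xs : List A) → (∀ {a} → a ∈ xs → p a ≡ true) → all p xs ≡ true
all-true⁺ p []       f = ≡.refl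
all-true⁺ p (a ∷ as) f rewrite f (here ≡.refl) = all-true⁺ p as (f ∘ there)

∈-filterᵇ⁺ : (p : A → Bool) {xs : List A} {a : A} → a ∈ xs → p a ≡ true → a ∈ filterᵇ p xs
∈-filterᵇ⁺ p {b ∷ xs} a∈ eq with p b in pb
∈-filterᵇ⁺ p (here ≡.refl) eq | true  = here ≡.refl
∈-filterᵇ⁺ p (there a∈)  eq | true  = there (∈-filterᵇ⁺ p a∈ eq)
∈-filterᵇ⁺ p (here ≡.refl) eq | false = true≢false eq pb
∈-filterᵇ⁺ p (there a∈)  eq | false = ∈-filterᵇ⁺ p a∈ eq

∈-filterᵇ⁻ : (p : A → Bool) {xs : List A} {a : A} → a ∈ filterᵇ p xs → a ∈ xs × p a ≡ true
∈-filterᵇ⁻ p {b ∷ xs} a∈ with p b in pb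
∈-filterᵇ⁻ p (here ≡.refl) | true  = here ≡.refl , pb
∈-filterᵇ⁻ p (there a∈)  | true  = map₁ there (∈-filterᵇ⁻ p a∈)
... | false = map₁ there (∈-filterᵇ⁻ p a∈)

filterᵇ-∧ : (p r : A → Bool) (xs : List A) → filterᵇ r (filterᵇ p xs) ≡ filterᵇ (λ a → p a ∧ r a) xs
filterᵇ-∧ p r []       = ≡.refl
filterᵇ-∧ p r (a ∷ as) with p a
... | false = filterᵇ-∧ p r as
... | true with r a
...   | true  = cong (a ∷_) (filterᵇ-∧ p r as)
...   | false = filterᵇ-∧ p r as

filterᵇ-partition : (p : A → Bool) (xs : List A) → xs ↭ filterᵇ p xs ++ filterᵇ (not ∘ p) xs
filterᵇ-partition p []       = ↭-refl
filterᵇ-partition p (a ∷ as) with p a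
... | true  = prep a (filterᵇ-partition p as)
... | false = ↭-trans (prep a (filterᵇ-partition p as)) (↭-sym (Perm.shift a (filterᵇ p as) _))

Unique-resp-↭ : {xs ys : List A} → xs ↭ ys → Unique xs → Unique ys
Unique-resp-↭ Perm.refl         u                       = u
Unique-resp-↭ (Perm.prep _ p)   (a∉ ∷ u)                = Perm.All-resp-↭ p a∉ ∷ Unique-resp-↭ p u
Unique-resp-↭ (Perm.swap _ _ p) ((a≢b ∷ a∉) ∷ (b∉ ∷ u)) =
  ((a≢b ∘ ≡.sym) ∷ Perm.All-resp-↭ p b∉) ∷ (Perm.All-resp-↭ p a∉ ∷ Unique-resp-↭ p u)
Unique-resp-↭ (Perm.trans p p′) u                       = Unique-resp-↭ p′ (Unique-resp-↭ p u)

unique-∉ : {a : A} {xs : List A} → Unique (a ∷ xs) → a ∉ xs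
unique-∉ (a∉ ∷ _) a∈ = All.lookup a∉ a∈ ≡.refl

unique-disjoint : {a : A} (xs : List A) {ys : List A} → Unique (xs ++ ys) → a ∈ xs → a ∉ ys
unique-disjoint (_ ∷ xs) u       (here ≡.refl) a∈ys = unique-∉ u (∈-++⁺ʳ xs a∈ys)
unique-disjoint (_ ∷ xs) (_ ∷ u) (there a∈)  a∈ys = unique-disjoint xs u a∈ a∈ys

-- Breadth-first search

Adjacency : ℕ → Set
Adjacency n = Fin n → Fin n → Bool

chosen rest : Adjacency n → Fin n → List (Fin n) → List (Fin n)
chosen a u l = filterᵇ (a u) l
rest   a u l = filterᵇ (not ∘ a u) l

-- Whether each component of the graph induced on U ++ l is a tree containing exactly one vertex of U.
bfsOk : ℕ → Adjacency n → List (Fin n) → List (Fin n) → Bool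
bfsOk _       a []      l = null l
bfsOk zero    a (_ ∷ _) l = false
bfsOk (suc f) a (u ∷ U) l = not (any (a u) U) ∧ bfsOk f a (U ++ chosen a u l) (rest a u l)

searchDegrees : ℕ → Adjacency n → List (Fin n) → List (Fin n) → List ℕ
searchDegrees (suc f) a (u ∷ U) l =
  length (chosen a u l) ∷ searchDegrees f a (U ++ chosen a u l) (rest a u l)
searchDegrees _       a _       l = []

pop-↭ : (a : Adjacency n) (u : Fin n) (U l : List (Fin n)) →
        U ++ l ↭ (U ++ chosen a u l) ++ rest a u l
pop-↭ a u U l = ↭-trans (Perm.++⁺ˡ U (filterᵇ-partition (a u) l))
  (Perm.↭-reflexive (≡.sym (List.++-assoc U _ _)))

pop-length : (a : Adjacency n) (u : Fin n) (U l : List (Fin n)) →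
  length U ℕ.+ length l ≡ length (U ++ chosen a u l) ℕ.+ length (rest a u l)
pop-length a u U l = ≡.trans (≡.sym (List.length-++ U)) (≡.trans (Perm.↭-length (pop-↭ a u U l)) (List.length-++ (U ++ chosen a u l)))

module _ (a : Adjacency n) (f : ℕ) (u : Fin n) (U l : List (Fin n))
         (ok : bfsOk (suc f) a (u ∷ U) l ≡ true) where
  no-sibling : ∀ {w} → w ∈ U → a u w ≡ false
  no-sibling w∈U with any (a u) U in eq
  ... | false = Bool.¬-not (λ auw → true≢false (any-true⁺ (a u) w∈U auw) eq)

  ok-next : bfsOk f a (U ++ chosen a u l) (rest a u l) ≡ true
  ok-next with any (a u) U
  ... | false = ok

∈-pop : (a : Adjacency n) (u : Fin n) (U l : List (Fin n)) {w : Fin n} → w ∈ U ++ l → w ∈ (U ++ chosen a u l) ++ rest a u l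
∈-pop a u U l = Perm.∈-resp-↭ (pop-↭ a u U l)

∉-popped : {u w : Fin n} {xs : List (Fin n)} → w ∈ u ∷ xs → w ≢ u → w ∈ xs
∉-popped (here eq)  w≢u = ⊥-elim (w≢u eq)
∉-popped (there w∈) _   = w∈

module _ {n : ℕ} {a a′ : Adjacency n} where
  chosen-cong : ∀ u l → (∀ {w} → w ∈ l → a u w ≡ a′ u w) →
                chosen a u l ≡ chosen a′ u l × rest a u l ≡ rest a′ u l
  chosen-cong u l eq = filterᵇ-cong l eq , filterᵇ-cong l (cong not ∘ eq)

  any-cong : ∀ {p p′ : Fin n → Bool} U → (∀ {w} → w ∈ U → p w ≡ p′ w) → any p U ≡ any p′ U
  any-cong []      eq = ≡.refl
  any-cong (w ∷ U) eq = cong₂ _∨_ (eq (here ≡.refl)) (any-cong U (eq ∘ there))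

  -- Popped vertices drop out of the search together with their edges; this lets such edges be
  -- deleted from the graph.
  search-cong : ∀ f U l → (∀ {v w} → v ∈ U ++ l → w ∈ U ++ l → a v w ≡ a′ v w) →
    bfsOk f a U l ≡ bfsOk f a′ U l × searchDegrees f a U l ≡ searchDegrees f a′ U l
  search-cong zero    []      l eq = ≡.refl , ≡.refl
  search-cong (suc f) []      l eq = ≡.refl , ≡.refl
  search-cong zero    (_ ∷ _) l eq = ≡.refl , ≡.refl
  search-cong (suc f) (u ∷ U) l eq
    rewrite any-cong U (λ w∈ → eq (here ≡.refl) (there (∈-++⁺ˡ w∈)))
          | ≡.sym (proj₁ (chosen-cong u l (λ w∈ → eq (here ≡.refl) (there (∈-++⁺ʳ U w∈)))))
          | ≡.sym (proj₂ (chosen-cong u l (λ w∈ → eq (here ≡.refl) (there (∈-++⁺ʳ U w∈)))))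
    = map₁ (cong (not (any (a′ u) U) ∧_)) (map₂ (cong (_ ∷_)) (search-cong f (U ++ chosen a u l) (rest a u l)
        (λ v∈ w∈ → eq (there (back v∈)) (there (back w∈)))))
    where
    back : ∀ {v} → v ∈ (U ++ chosen a u l) ++ rest a u l → v ∈ U ++ l
    back = Perm.∈-resp-↭ (↭-sym (pop-↭ a u U l))

≡-or-≢ : (v u : Fin n) → v ≡ u ⊎ v ≢ u
≡-or-≢ v u with v Fin.≟ u
... | yes v≡u = inj₁ v≡u
... | no v≢u  = inj₂ v≢u

-- Colourings that separate the two sides of an edge of a forest

module Colouring {n : ℕ} (a : Adjacency n) (symmetric : ∀ u w → a u w ≡ a w u) (loopless : ∀ u → a u u ≡ false) where
  Colour : Set
  Colour = Fin n → Bool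

  Respects : Colour → List (Fin n) → Set
  Respects χ V = ∀ v w → v ∈ V → w ∈ V → a v w ≡ true → χ v ≡ χ w

  override : Fin n → Bool → Colour → Colour
  override u b χ w = if w =ᶠ u then b else χ w

  override-≡ : ∀ u b χ → override u b χ u ≡ b
  override-≡ u b χ rewrite =ᶠ-refl u = ≡.refl

  override-≢ : ∀ {u w} b χ → w ≢ u → override u b χ w ≡ χ w
  override-≢ b χ w≢u rewrite =ᶠ-≢ w≢u = ≡.refl

  popped-edge : ∀ f u U l → bfsOk (suc f) a (u ∷ U) l ≡ true →
                ∀ {w} → w ∈ u ∷ U ++ l → a u w ≡ true → w ∈ chosen a u l
  popped-edge f u U l ok (here ≡.refl) auw = true≢false auw (loopless u)
  popped-edge f u U l ok (there w∈) auw with ∈-++⁻ U w∈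
  ... | inj₁ w∈U = true≢false auw (no-sibling a f u U l ok w∈U)
  ... | inj₂ w∈l = ∈-filterᵇ⁺ (a u) w∈l auw

  queue-≢ : ∀ (u : Fin n) U l → Unique (u ∷ U ++ l) → ∀ {w} → w ∈ U ++ l → w ≢ u
  queue-≢ u U l uniq w∈ ≡.refl = unique-∉ uniq w∈

  chosen-∈ : ∀ u U l {w} → w ∈ chosen a u l → w ∈ U ++ l
  chosen-∈ u U l w∈ = ∈-++⁺ʳ U (proj₁ (∈-filterᵇ⁻ (a u) {l} w∈))

  unique-pop : ∀ (u : Fin n) U l → Unique (u ∷ U ++ l) → Unique ((U ++ chosen a u l) ++ rest a u l)
  unique-pop u U l (_ ∷ uniq) = Unique-resp-↭ (pop-↭ a u U l) uniq

  -- Each component holds exactly one queue vertex, whose colour can spread over it. The recursion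
  -- gives the children of `u` the colour `β u`, and `override` then colours `u` to match.
  extend-colour : ∀ f U l → bfsOk f a U l ≡ true → Unique (U ++ l) → (β : Colour) →
    Σ Colour λ χ → (∀ {u} → u ∈ U → χ u ≡ β u) × Respects χ (U ++ l)
  extend-colour f       []      [] ok uniq β = β , (λ ()) , λ _ _ ()
  extend-colour (suc f) (u ∷ U) l  ok uniq β
    with extend-colour f (U ++ chosen a u l) (rest a u l) (ok-next a f u U l ok) (unique-pop u U l uniq)
           (λ w → if member (chosen a u l) w then β u else β w)
  ... | χ , χ≡β , respects = override u (β u) χ , agrees , respects′
    where
    agrees : ∀ {w} → w ∈ u ∷ U → override u (β u) χ w ≡ β w
    agrees (here ≡.refl) = override-≡ u (β u) χ
    agrees {w} (there w∈U) = ≡.trans (override-≢ (β u) χ (queue-≢ u U l uniq (∈-++⁺ˡ w∈U)))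
      (≡.trans (χ≡β (∈-++⁺ˡ w∈U)) (cong (λ b → if b then β u else β w) (∉⇒member (chosen a u l)
        (λ w∈C → unique-disjoint (u ∷ U) uniq (there w∈U) (proj₁ (∈-filterᵇ⁻ (a u) {l} w∈C))))))

    neighbour : ∀ {w} → w ∈ u ∷ U ++ l → a u w ≡ true → override u (β u) χ w ≡ β u
    neighbour {w} w∈ auw = ≡.trans (override-≢ (β u) χ (queue-≢ u U l uniq (chosen-∈ u U l w∈C)))
      (≡.trans (χ≡β (∈-++⁺ʳ U w∈C)) (cong (λ b → if b then β u else β w) (∈⇒member w∈C)))
      where w∈C = popped-edge f u U l ok w∈ auw

    respects′ : Respects (override u (β u) χ) (u ∷ U ++ l)
    respects′ v w v∈ w∈ avw with ≡-or-≢ v u | ≡-or-≢ w u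
    ... | inj₁ ≡.refl | _        = ≡.trans (override-≡ u (β u) χ) (≡.sym (neighbour w∈ avw))
    ... | inj₂ _     | inj₁ ≡.refl = ≡.trans (neighbour v∈ (≡.trans (symmetric u v) avw)) (≡.sym (override-≡ u (β u) χ))
    ... | inj₂ v≢u   | inj₂ w≢u   = ≡.trans (override-≢ (β u) χ v≢u)
      (≡.trans (respects _ _ (∈-pop a u U l (∉-popped v∈ v≢u)) (∈-pop a u U l (∉-popped w∈ w≢u)) avw) (≡.sym (override-≢ (β u) χ w≢u)))

  SameEdge : Fin n → Fin n → Fin n → Fin n → Set
  SameEdge v w v′ w′ = (v′ ≡ v × w′ ≡ w) ⊎ (v′ ≡ w × w′ ≡ v)

  -- The colour may change only along the edge `v w`. Asking for `false` on the queue makes the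
  -- induction work: a popped vertex can be coloured `false` together with all its children, which
  -- are in the next queue.
  Cut : List (Fin n) → List (Fin n) → Fin n → Fin n → Set
  Cut U V v w = Σ Colour λ χ → (∀ {u} → u ∈ U → χ u ≡ false) × χ v ≢ χ w ×
    (∀ v′ w′ → v′ ∈ V → w′ ∈ V → a v′ w′ ≡ true → SameEdge v w v′ w′ ⊎ χ v′ ≡ χ w′)

  cut-sym : ∀ {U V v w} → Cut U V v w → Cut U V w v
  cut-sym (χ , χU , χv≢χw , sep) = χ , χU , χv≢χw ∘ ≡.sym , λ v′ w′ v∈ w∈ avw → flip (sep v′ w′ v∈ w∈ avw)
    where
    flip : ∀ {v w v′ w′} {P : Set} → SameEdge v w v′ w′ ⊎ P → SameEdge w v v′ w′ ⊎ P
    flip (inj₁ (inj₁ s)) = inj₁ (inj₂ s)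
    flip (inj₁ (inj₂ s)) = inj₁ (inj₁ s)
    flip (inj₂ p)        = inj₂ p

  -- In the queue after the pop only `w` receives `true`; this spreads over the part of the tree
  -- that hangs from `u` by the edge to `w`.
  root-cut : ∀ f u U l → bfsOk (suc f) a (u ∷ U) l ≡ true → Unique (u ∷ U ++ l) →
    ∀ {w} → w ∈ u ∷ U ++ l → a u w ≡ true → Cut (u ∷ U) (u ∷ U ++ l) u w
  root-cut f u U l ok uniq {w} w∈ auw
    with extend-colour f (U ++ chosen a u l) (rest a u l) (ok-next a f u U l ok) (unique-pop u U l uniq) (_=ᶠ w)
  ... | χ , χ≡ , respects = override u false χ , black , differ , separates
    where
    w∈C : w ∈ chosen a u l
    w∈C = popped-edge f u U l ok w∈ auw

    w≢u : w ≢ u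
    w≢u = queue-≢ u U l uniq (chosen-∈ u U l w∈C)

    black : ∀ {v} → v ∈ u ∷ U → override u false χ v ≡ false
    black (here ≡.refl) = override-≡ u false χ
    black {v} (there v∈U) = ≡.trans (override-≢ false χ (queue-≢ u U l uniq (∈-++⁺ˡ v∈U)))
      (≡.trans (χ≡ (∈-++⁺ˡ v∈U)) (=ᶠ-≢ {i = v} {w} λ { ≡.refl → unique-disjoint (u ∷ U) uniq (there v∈U) (proj₁ (∈-filterᵇ⁻ (a u) {l} w∈C)) }))

    χw : override u false χ w ≡ true
    χw = ≡.trans (override-≢ false χ w≢u) (≡.trans (χ≡ (∈-++⁺ʳ U w∈C)) (=ᶠ-refl w))

    differ : override u false χ u ≢ override u false χ w
    differ eq = true≢false χw (≡.trans (≡.sym eq) (override-≡ u false χ))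

    neighbour : ∀ {w′} → w′ ∈ u ∷ U ++ l → a u w′ ≡ true → w′ ≢ w → override u false χ w′ ≡ false
    neighbour w′∈ auw′ w′≢w = ≡.trans (override-≢ false χ (queue-≢ u U l uniq (chosen-∈ u U l w′∈C)))
      (≡.trans (χ≡ (∈-++⁺ʳ U w′∈C)) (=ᶠ-≢ w′≢w))
      where w′∈C = popped-edge f u U l ok w′∈ auw′

    separates : ∀ v′ w′ → v′ ∈ u ∷ U ++ l → w′ ∈ u ∷ U ++ l → a v′ w′ ≡ true →
                SameEdge u w v′ w′ ⊎ override u false χ v′ ≡ override u false χ w′
    separates v′ w′ v′∈ w′∈ av′w′ with ≡-or-≢ v′ u | ≡-or-≢ w′ u
    ... | inj₁ ≡.refl | inj₁ ≡.refl = inj₂ ≡.refl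
    ... | inj₁ ≡.refl | inj₂ _ with ≡-or-≢ w′ w
    ...   | inj₁ ≡.refl = inj₁ (inj₁ (≡.refl , ≡.refl))
    ...   | inj₂ w′≢w  = inj₂ (≡.trans (override-≡ u false χ) (≡.sym (neighbour w′∈ av′w′ w′≢w)))
    separates v′ w′ v′∈ w′∈ av′w′ | inj₂ _ | inj₁ ≡.refl with ≡-or-≢ v′ w
    ...   | inj₁ ≡.refl = inj₁ (inj₂ (≡.refl , ≡.refl))
    ...   | inj₂ v′≢w  = inj₂ (≡.trans (neighbour v′∈ (≡.trans (symmetric u v′) av′w′) v′≢w) (≡.sym (override-≡ u false χ)))
    separates v′ w′ v′∈ w′∈ av′w′ | inj₂ v′≢u | inj₂ w′≢u = inj₂ (≡.trans (override-≢ false χ v′≢u)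
      (≡.trans (respects _ _ (∈-pop a u U l (∉-popped v′∈ v′≢u)) (∈-pop a u U l (∉-popped w′∈ w′≢u)) av′w′) (≡.sym (override-≢ false χ w′≢u))))

  -- If `u` is not an end of the edge, a cut for the next queue is `false` on all neighbours of `u`,
  -- so `u` can be coloured `false` without a new colour change.
  edge-cut : ∀ f U l → bfsOk f a U l ≡ true → Unique (U ++ l) →
    ∀ {v w} → v ∈ U ++ l → w ∈ U ++ l → a v w ≡ true → Cut U (U ++ l) v w
  edge-cut f       []      [] ok uniq ()
  edge-cut (suc f) (u ∷ U) l  ok uniq {v} {w} v∈ w∈ avw with ≡-or-≢ v u | ≡-or-≢ w u
  ... | inj₁ ≡.refl | _        = root-cut f u U l ok uniq w∈ avw
  ... | inj₂ _     | inj₁ ≡.refl = cut-sym {u ∷ U} {u ∷ U ++ l} (root-cut f u U l ok uniq v∈ (≡.trans (symmetric u v) avw))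
  ... | inj₂ v≢u   | inj₂ w≢u
    with edge-cut f (U ++ chosen a u l) (rest a u l) (ok-next a f u U l ok) (unique-pop u U l uniq)
           (∈-pop a u U l (∉-popped v∈ v≢u)) (∈-pop a u U l (∉-popped w∈ w≢u)) avw
  ...   | χ , χU , χv≢χw , sep = override u false χ , black
        , (λ eq → χv≢χw (≡.trans (≡.sym (override-≢ false χ v≢u)) (≡.trans eq (override-≢ false χ w≢u))))
        , separates
    where
    black : ∀ {v} → v ∈ u ∷ U → override u false χ v ≡ false
    black (here ≡.refl) = override-≡ u false χ
    black (there v∈U) = ≡.trans (override-≢ false χ (queue-≢ u U l uniq (∈-++⁺ˡ v∈U))) (χU (∈-++⁺ˡ v∈U))

    neighbour : ∀ {w′} → w′ ∈ u ∷ U ++ l → a u w′ ≡ true → override u false χ w′ ≡ false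
    neighbour w′∈ auw′ = ≡.trans (override-≢ false χ (queue-≢ u U l uniq (chosen-∈ u U l w′∈C))) (χU (∈-++⁺ʳ U w′∈C))
      where w′∈C = popped-edge f u U l ok w′∈ auw′

    separates : ∀ v′ w′ → v′ ∈ u ∷ U ++ l → w′ ∈ u ∷ U ++ l → a v′ w′ ≡ true →
                SameEdge v w v′ w′ ⊎ override u false χ v′ ≡ override u false χ w′
    separates v′ w′ v′∈ w′∈ av′w′ with ≡-or-≢ v′ u | ≡-or-≢ w′ u
    ... | inj₁ ≡.refl | _        = inj₂ (≡.trans (override-≡ u false χ) (≡.sym (neighbour w′∈ av′w′)))
    ... | inj₂ _     | inj₁ ≡.refl = inj₂ (≡.trans (neighbour v′∈ (≡.trans (symmetric u v′) av′w′)) (≡.sym (override-≡ u false χ)))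
    ... | inj₂ v′≢u  | inj₂ w′≢u with sep v′ w′ (∈-pop a u U l (∉-popped v′∈ v′≢u)) (∈-pop a u U l (∉-popped w′∈ w′≢u)) av′w′
    ...   | inj₁ same = inj₁ same
    ...   | inj₂ eq   = inj₂ (≡.trans (override-≢ false χ v′≢u) (≡.trans eq (≡.sym (override-≢ false χ w′≢u))))

  ok-reachable : ∀ f U l → bfsOk f a U l ≡ true →
    ∀ {w} → w ∈ l → ∃ λ u → u ∈ U × Star (λ v w → a v w ≡ true) u w
  ok-reachable f       []      [] ok ()
  ok-reachable (suc f) (u ∷ U) l  ok {w} w∈ with a u w in auw
  ... | true  = u , here ≡.refl , auw ◅ ε
  ... | false with ok-reachable f (U ++ chosen a u l) (rest a u l) (ok-next a f u U l ok) (∈-filterᵇ⁺ (not ∘ a u) w∈ (cong not auw))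
  ...   | u′ , u′∈ , path with ∈-++⁻ U u′∈
  ...     | inj₁ u′∈U = u′ , there u′∈U , path
  ...     | inj₂ u′∈C = u , here ≡.refl , proj₂ (∈-filterᵇ⁻ (a u) {l} u′∈C) ◅ path

∧-true⁻ : ∀ {b b′} → (b ∧ b′) ≡ true → b ≡ true × b′ ≡ true
∧-true⁻ {true} {true} eq = ≡.refl , ≡.refl

∨-true⁻ : ∀ {b b′} → (b ∨ b′) ≡ true → b ≡ true ⊎ b′ ≡ true
∨-true⁻ {true}         eq = inj₁ ≡.refl
∨-true⁻ {false} {true} eq = inj₂ ≡.refl

∨-true⁺ˡ : ∀ {b b′} → b ≡ true → (b ∨ b′) ≡ true
∨-true⁺ˡ ≡.refl = ≡.refl

∨-true⁺ʳ : ∀ b {b′} → b′ ≡ true → (b ∨ b′) ≡ true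
∨-true⁺ʳ true  eq   = ≡.refl
∨-true⁺ʳ false ≡.refl = ≡.refl

≡-of-true : ∀ {b b′} → (b ≡ true → b′ ≡ true) → (b′ ≡ true → b ≡ true) → b ≡ b′
≡-of-true {true}  {true}  f g = ≡.refl
≡-of-true {true}  {false} f g = ≡.sym (f ≡.refl)
≡-of-true {false} {true}  f g = g ≡.refl
≡-of-true {false} {false} f g = ≡.refl

-- Adjacency and reachability in edge lists

Joins : Fin n × Fin n → Fin n → Fin n → Set
Joins (i , j) u v = (i ≡ u × j ≡ v) ⊎ (i ≡ v × j ≡ u)

joins : Fin n × Fin n → Fin n → Fin n → Bool
joins (i , j) u v = ((i =ᶠ u) ∧ (j =ᶠ v)) ∨ ((i =ᶠ v) ∧ (j =ᶠ u))

joins⁻ : ∀ (e : Fin n × Fin n) {u v} → joins e u v ≡ true → Joins e u v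
joins⁻ e eq with ∨-true⁻ eq
... | inj₁ eq′ = inj₁ (=ᶠ⇒≡ (proj₁ (∧-true⁻ eq′)) , =ᶠ⇒≡ (proj₂ (∧-true⁻ eq′)))
... | inj₂ eq′ = inj₂ (=ᶠ⇒≡ (proj₁ (∧-true⁻ eq′)) , =ᶠ⇒≡ (proj₂ (∧-true⁻ eq′)))

joins⁺ : ∀ (e : Fin n × Fin n) {u v} → Joins e u v → joins e u v ≡ true
joins⁺ (i , j) (inj₁ (≡.refl , ≡.refl)) rewrite =ᶠ-refl i | =ᶠ-refl j = ≡.refl
joins⁺ (i , j) (inj₂ (≡.refl , ≡.refl)) rewrite =ᶠ-refl i | =ᶠ-refl j = ∨-true⁺ʳ ((i =ᶠ j) ∧ (j =ᶠ i)) ≡.refl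

adj⁻ : (E : Edges n) {u v : Fin n} → adj E u v ≡ true → ∃ λ e → e ∈ E × Joins e u v
adj⁻ E {u} {v} eq with any-true⁻ (λ e → joins e u v) E eq
... | e , e∈ , j = e , e∈ , joins⁻ e j

adj⁺ : (E : Edges n) {e : Fin n × Fin n} {u v : Fin n} → e ∈ E → Joins e u v → adj E u v ≡ true
adj⁺ E {e} {u} {v} e∈ j = any-true⁺ (λ e → joins e u v) e∈ (joins⁺ e j)

joins-sym : ∀ (e : Fin n × Fin n) {u v} → Joins e u v → Joins e v u
joins-sym e (inj₁ eqs) = inj₂ eqs
joins-sym e (inj₂ eqs) = inj₁ eqs

adj-sym : (E : Edges n) (u v : Fin n) → adj E u v ≡ adj E v u
adj-sym E u v = ≡-of-true (half u v) (half v u)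
  where
  half : ∀ u v → adj E u v ≡ true → adj E v u ≡ true
  half u v eq with adj⁻ E eq
  ... | e , e∈ , j = adj⁺ E e∈ (joins-sym e j)

Adjacent : Edges n → Fin n → Fin n → Set
Adjacent E u v = adj E u v ≡ true

-- The means of refuting reachability. It is applied to cuts, once their edge is removed, and to the
-- indicator of a set of vertices that no edge leaves.
reach-colour : (E : Edges n) (χ : Fin n → Bool) → (∀ {e} → e ∈ E → χ (proj₁ e) ≡ χ (proj₂ e)) →
               ∀ k {s w} → reach E k s w ≡ true → χ s ≡ χ w
reach-colour E χ respects zero    eq = cong χ (=ᶠ⇒≡ eq)
reach-colour {n} E χ respects (suc k) {s} {w} eq with ∨-true⁻ {reach E k s w} eq
... | inj₁ eq′ = reach-colour E χ respects k eq′
... | inj₂ eq′ with any-true⁻ (λ u → reach E k s u ∧ adj E u w) (allFin n) eq′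
...   | u , _ , eq″ = ≡.trans (reach-colour E χ respects k (proj₁ (∧-true⁻ eq″))) (edge (adj⁻ E (proj₂ (∧-true⁻ {reach E k s u} eq″))))
  where
  edge : (∃ λ e → e ∈ E × Joins e u w) → χ u ≡ χ w
  edge (e , e∈ , inj₁ (≡.refl , ≡.refl)) = respects e∈
  edge (e , e∈ , inj₂ (≡.refl , ≡.refl)) = ≡.sym (respects e∈)

tally : (Fin n → Bool) → List (Fin n) → ℕ
tally r l = length (filterᵇ r l)

tally-mono : (r r′ : Fin n → Bool) → (∀ w → r w ≡ true → r′ w ≡ true) → ∀ l → tally r l ℕ.≤ tally r′ l
tally-mono r r′ le []      = z≤n
tally-mono r r′ le (w ∷ l) with r w in rw | r′ w in r′w
... | true  | true  = s≤s (tally-mono r r′ le l)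
... | true  | false = true≢false (le w rw) r′w
... | false | true  = ℕ.m≤n⇒m≤1+n (tally-mono r r′ le l)
... | false | false = tally-mono r r′ le l

tally-strict : (r r′ : Fin n → Bool) → (∀ w → r w ≡ true → r′ w ≡ true) →
  ∀ {l w} → w ∈ l → r w ≡ false → r′ w ≡ true → tally r l ℕ.< tally r′ l
tally-strict r r′ le {v ∷ l} (here ≡.refl) rw r′w rewrite rw | r′w = s≤s (tally-mono r r′ le l)
tally-strict r r′ le {v ∷ l} (there w∈)  rw r′w with r v in rv | r′ v in r′v
... | true  | true  = s≤s (tally-strict r r′ le w∈ rw r′w)
... | true  | false = true≢false (le v rv) r′v
... | false | true  = ℕ.m≤n⇒m≤1+n (tally-strict r r′ le w∈ rw r′w)
... | false | false = tally-strict r r′ le w∈ rw r′w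

tally-≤ : (r : Fin n → Bool) (l : List (Fin n)) → tally r l ℕ.≤ length l
tally-≤ r []      = z≤n
tally-≤ r (w ∷ l) with r w
... | true  = s≤s (tally-≤ r l)
... | false = ℕ.m≤n⇒m≤1+n (tally-≤ r l)

-- The set of vertices within distance k of s grows strictly until it is closed.
module Saturation {n : ℕ} (E : Edges n) (s : Fin n) where
  Closed : ℕ → Set
  Closed k = ∀ {u w} → reach E k s u ≡ true → Adjacent E u w → reach E k s w ≡ true

  reach-mono : ∀ k w → reach E k s w ≡ true → reach E (suc k) s w ≡ true
  reach-mono k w = ∨-true⁺ˡ

  reach-step : ∀ k {u w} → reach E k s u ≡ true → Adjacent E u w → reach E (suc k) s w ≡ true
  reach-step k {u} {w} ru auw = ∨-true⁺ʳ (reach E k s w)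
    (any-true⁺ (λ u → reach E k s u ∧ adj E u w) (∈-allFin u) (cong₂ _∧_ ru auw))

  grows : ∀ k → Closed k ⊎ k ℕ.< tally (reach E k s) (allFin n)
  grows zero = inj₂ (ℕ.≤-<-trans z≤n (tally-strict (λ _ → false) (reach E 0 s) (λ _ ()) (∈-allFin s) ≡.refl (=ᶠ-refl s)))
  grows (suc k) with any (λ w → reach E (suc k) s w ∧ not (reach E k s w)) (allFin n) in new
  grows (suc k) | false = inj₁ (λ {u} {w} ru auw → reach-step k (old u ru) auw)
    where
    old : ∀ u → reach E (suc k) s u ≡ true → reach E k s u ≡ true
    old u ru with reach E k s u in eq
    ... | true  = ≡.refl
    ... | false = true≢false (any-true⁺ (λ w → reach E (suc k) s w ∧ not (reach E k s w)) (∈-allFin u)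
      (subst (λ b → ((b ∨ any (λ v → reach E k s v ∧ adj E v u) (allFin n)) ∧ not b) ≡ true) (≡.sym eq) (≡.trans (Bool.∧-identityʳ _) ru))) new
  grows (suc k) | true with any-true⁻ (λ w → reach E (suc k) s w ∧ not (reach E k s w)) (allFin n) new
  ... | w , w∈ , eq with ∧-true⁻ {reach E (suc k) s w} eq | grows k
  ...   | rw , not-old | inj₁ closed = inj₁ (λ {u} {v} ru auv → reach-mono k v (closed (old u ru) auv))
    where
    old : ∀ u → reach E (suc k) s u ≡ true → reach E k s u ≡ true
    old u ru with ∨-true⁻ {reach E k s u} ru
    ... | inj₁ ru′ = ru′
    ... | inj₂ eq′ with any-true⁻ (λ v → reach E k s v ∧ adj E v u) (allFin n) eq′
    ...   | v , _ , eq″ = closed (proj₁ (∧-true⁻ eq″)) (proj₂ (∧-true⁻ {reach E k s v} eq″))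
  ...   | rw , not-old | inj₂ k< = inj₂ (ℕ.≤-<-trans k<
    (tally-strict (reach E k s) (reach E (suc k) s) (reach-mono k) w∈ (Bool.¬-not λ r → true≢false not-old (cong not r)) rw))

  -- A ball that kept growing up to radius `n` would hold more than `n` vertices. Hence the bound
  -- `n` in `reach` covers walks of every length.
  closed-n : Closed n
  closed-n with grows n
  ... | inj₁ closed = closed
  ... | inj₂ n<     = ⊥-elim (ℕ.<⇒≱ n< (ℕ.≤-trans (tally-≤ _ (allFin n)) (ℕ.≤-reflexive (List.length-tabulate id))))

  reach-self : ∀ k → reach E k s s ≡ true
  reach-self zero    = =ᶠ-refl s
  reach-self (suc k) = reach-mono k s (reach-self k)

  star-reach : ∀ {w} → Star (Adjacent E) s w → reach E n s w ≡ true
  star-reach path = go (reach-self n) path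
    where
    go : ∀ {u w} → reach E n s u ≡ true → Star (Adjacent E) u w → reach E n s w ≡ true
    go ru ε         = ru
    go ru (auv ◅ p) = go (closed-n ru auv) p

-- Rules out loops and an edge listed in both orientations; `removeEdge` deletes one orientation
-- only.
Ascending : Edges n → Set
Ascending E = ∀ {i j} → (i , j) ∈ E → i Fin.< j

module _ (E : Edges n) (asc : Ascending E) where
  adj-loopless : ∀ u → adj E u u ≡ false
  adj-loopless u = Bool.¬-not loop
    where
    loop : ¬ Adjacent E u u
    loop auu with adj⁻ E auu
    ... | e , e∈ , inj₁ (≡.refl , ≡.refl) = ℕ.<-irrefl ≡.refl (asc e∈)
    ... | e , e∈ , inj₂ (≡.refl , ≡.refl) = ℕ.<-irrefl ≡.refl (asc e∈)

  removeEdge-∈ : ∀ e e′ → e′ ∈ E → e ≢ e′ → e′ ∈ removeEdge e E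
  removeEdge-∈ e e′ e′∈ e≢e′ = ∈-filterᵇ⁺ (λ e′ → not ((proj₁ e =ᶠ proj₁ e′) ∧ (proj₂ e =ᶠ proj₂ e′))) e′∈
    (cong not (Bool.¬-not (λ eq → e≢e′ (cong₂ _,_ (=ᶠ⇒≡ (proj₁ (∧-true⁻ eq))) (=ᶠ⇒≡ (proj₂ (∧-true⁻ {proj₁ e =ᶠ proj₁ e′} eq)))))))

  removeEdge-≢ : ∀ e e′ → e′ ∈ removeEdge e E → e′ ∈ E × e ≢ e′
  removeEdge-≢ e e′ e′∈ with ∈-filterᵇ⁻ (λ e′ → not ((proj₁ e =ᶠ proj₁ e′) ∧ (proj₂ e =ᶠ proj₂ e′))) {E} e′∈
  ... | e′∈E , eq = e′∈E , λ { ≡.refl → true≢false (cong₂ _∧_ (=ᶠ-refl (proj₁ e)) (=ᶠ-refl (proj₂ e))) (≡.trans (≡.sym (Bool.not-involutive _)) (cong not eq)) }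

-- Trees as the graphs on which the search succeeds

module Search {m : ℕ} (E : Edges (suc m)) (asc : Ascending E) where
  private
    V = suc m
    a : Adjacency V
    a = adj E
    r₀ : Fin V
    r₀ = Fin.zero
    pool : List (Fin V)
    pool = map Fin.suc (allFin m)

  open Colouring a (adj-sym E) (adj-loopless E asc)

  all-vertices : ∀ w → w ∈ r₀ ∷ pool
  all-vertices Fin.zero    = here ≡.refl
  all-vertices (Fin.suc i) = there (∈-map⁺ Fin.suc (∈-allFin i))

  unique-vertices : Unique (r₀ ∷ pool)
  unique-vertices = subst Unique (allFin-suc m) (allFin⁺ V)

  ok⇒connected : bfsOk V a [ r₀ ] pool ≡ true → connected E ≡ true
  ok⇒connected ok = all-true⁺ _ (allFin V) (λ {u} _ → all-true⁺ _ (allFin V) (λ {w} _ →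
    Saturation.star-reach E u (Star.reverse (λ {v} {w} avw → ≡.trans (adj-sym E w v) avw) (from-root u) ◅◅ from-root w)))
    where
    from-root : ∀ w → Star (Adjacent E) r₀ w
    from-root w with all-vertices w
    ... | here ≡.refl = ε
    ... | there w∈ with ok-reachable V [ r₀ ] pool ok w∈
    ...   | u , here ≡.refl , path = path

  -- If the ends of an edge stayed connected after its removal, they would have equal colours in the
  -- colouring that cuts this edge.
  ok⇒acyclic : bfsOk V a [ r₀ ] pool ≡ true → acyclic E ≡ true
  ok⇒acyclic ok = all-true⁺ _ E (λ {e} e∈ → cong not (Bool.¬-not (no-cycle e e∈)))
    where
    no-cycle : ∀ e → e ∈ E → ¬ reach (removeEdge e E) V (proj₁ e) (proj₂ e) ≡ true
    no-cycle e@(i , j) e∈ r with edge-cut V [ r₀ ] pool ok unique-vertices (all-vertices i) (all-vertices j) (adj⁺ E e∈ (inj₁ (≡.refl , ≡.refl)))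
    ... | χ , _ , χi≢χj , sep = χi≢χj (reach-colour (removeEdge e E) χ respects V r)
      where
      respects : ∀ {e′} → e′ ∈ removeEdge e E → χ (proj₁ e′) ≡ χ (proj₂ e′)
      respects {i′ , j′} e′∈ with removeEdge-≢ E asc e (i′ , j′) e′∈
      ... | e′∈E , e≢e′ with sep i′ j′ (all-vertices i′) (all-vertices j′) (adj⁺ E e′∈E (inj₁ (≡.refl , ≡.refl)))
      ...   | inj₁ (inj₁ (≡.refl , ≡.refl)) = ⊥-elim (e≢e′ ≡.refl)
      ...   | inj₁ (inj₂ (≡.refl , ≡.refl)) = ⊥-elim (ℕ.<-asym (asc e∈) (asc e′∈E))
      ...   | inj₂ eq                   = eq

  module _ (conn : connected E ≡ true) (acyc : acyclic E ≡ true) where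
    -- Edges with an endpoint among the vertices X already popped.
    Explored : List (Fin V) → Fin V → Fin V → Set
    Explored X u w = Adjacent E u w × (u ∈ X ⊎ w ∈ X)

    explored-sym : ∀ {X u w} → Explored X u w → Explored X w u
    explored-sym {u = u} {w} (auw , inj₁ u∈) = ≡.trans (adj-sym E w u) auw , inj₂ u∈
    explored-sym {u = u} {w} (auw , inj₂ w∈) = ≡.trans (adj-sym E w u) auw , inj₁ w∈

    -- Neither end of the edge has been popped, so explored walks never use it. They survive its
    -- removal and still connect its ends through the root.
    no-cycle-edge : ∀ X {u u′} → u ∉ X → u′ ∉ X → Star (Explored X) r₀ u → Star (Explored X) r₀ u′ → ¬ Adjacent E u u′
    no-cycle-edge X {u} {u′} u∉ u′∉ p p′ auu′ with adj⁻ E auu′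
    ... | e@(i , j) , e∈ , ends = true≢false cyclic (≡.trans (≡.sym (Bool.not-involutive _)) (cong not (all-true⁻ _ acyc e∈)))
      where
      e∉X : ∀ {v w} → Joins e v w → v ∉ X × w ∉ X
      e∉X {v} {w} ends′ = outside (proj₁ (same ends ends′)) , outside (proj₂ (same ends ends′))
        where
        same : Joins e u u′ → Joins e v w → (v ≡ u ⊎ v ≡ u′) × (w ≡ u ⊎ w ≡ u′)
        same (inj₁ (≡.refl , ≡.refl)) (inj₁ (≡.refl , ≡.refl)) = inj₁ ≡.refl , inj₂ ≡.refl
        same (inj₁ (≡.refl , ≡.refl)) (inj₂ (≡.refl , ≡.refl)) = inj₂ ≡.refl , inj₁ ≡.refl
        same (inj₂ (≡.refl , ≡.refl)) (inj₁ (≡.refl , ≡.refl)) = inj₂ ≡.refl , inj₁ ≡.refl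
        same (inj₂ (≡.refl , ≡.refl)) (inj₂ (≡.refl , ≡.refl)) = inj₁ ≡.refl , inj₂ ≡.refl
        outside : ∀ {v} → v ≡ u ⊎ v ≡ u′ → v ∉ X
        outside (inj₁ ≡.refl) = u∉
        outside (inj₂ ≡.refl) = u′∉

      survives : ∀ {v w} → Explored X v w → Adjacent (removeEdge e E) v w
      survives (avw , touched) with adj⁻ E avw
      ... | e′ , e′∈ , ends′ = adj⁺ (removeEdge e E) (removeEdge-∈ E asc e e′ e′∈ λ { ≡.refl → untouched touched (e∉X ends′) }) ends′
        where
        untouched : ∀ {v w} → v ∈ X ⊎ w ∈ X → ¬ (v ∉ X × w ∉ X)
        untouched (inj₁ v∈) (v∉ , _) = v∉ v∈
        untouched (inj₂ w∈) (_ , w∉) = w∉ w∈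

      path : Star (Explored X) u u′
      path = Star.reverse explored-sym p ◅◅ p′

      path-between : Joins e u u′ → Star (Explored X) i j
      path-between (inj₁ (≡.refl , ≡.refl)) = path
      path-between (inj₂ (≡.refl , ≡.refl)) = Star.reverse explored-sym path

      cyclic : reach (removeEdge e E) V i j ≡ true
      cyclic = Saturation.star-reach (removeEdge e E) i (Star.map survives (path-between ends))

    -- `X` holds the popped vertices. An edge between two queue vertices would close a cycle with
    -- the explored walks from the root. If the queue ran dry with labels left, `X` would contain
    -- the root and be closed under adjacency, against connectedness.
    tree⇒bfsOk : ∀ f X U l → f ≡ length U ℕ.+ length l → Unique (X ++ (U ++ l)) →
      (∀ w → w ∈ X ++ (U ++ l)) → r₀ ∉ l →
      (∀ {v} → v ∈ U → Star (Explored X) r₀ v) →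
      (∀ {v w} → v ∈ X → w ∈ l → a v w ≡ false) →
      bfsOk f a U l ≡ true
    tree⇒bfsOk f X [] []      eq uniq every r₀∉ paths sealed = bfsOk-[] f
      where
      bfsOk-[] : ∀ f → bfsOk f a [] [] ≡ true
      bfsOk-[] zero    = ≡.refl
      bfsOk-[] (suc f) = ≡.refl
    tree⇒bfsOk f X [] (w ∷ l) eq uniq every r₀∉ paths sealed = true≢false χr₀ (≡.trans
      (reach-colour E (member X) respects V (all-true⁻ _ (all-true⁻ _ conn (∈-allFin r₀)) (∈-allFin w)))
      (∉⇒member X (λ w∈X → unique-disjoint X uniq w∈X (here ≡.refl))))
      where
      inX : ∀ {v} → v ∉ w ∷ l → v ∈ X
      inX {v} v∉ with ∈-++⁻ X (every v)
      ... | inj₁ v∈X = v∈X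
      ... | inj₂ v∈l = ⊥-elim (v∉ v∈l)

      χr₀ : member X r₀ ≡ true
      χr₀ = ∈⇒member (inX r₀∉)

      step : ∀ {v v′} → Adjacent E v v′ → member X v ≡ true → member X v′ ≡ true
      step {v} {v′} avv′ v∈ with ∈-++⁻ X (every v′)
      ... | inj₁ v′∈X = ∈⇒member v′∈X
      ... | inj₂ v′∈l = true≢false avv′ (sealed (member⇒∈ X v∈) v′∈l)

      respects : ∀ {e} → e ∈ E → member X (proj₁ e) ≡ member X (proj₂ e)
      respects {i , j} e∈ = ≡-of-true (step (adj⁺ E e∈ (inj₁ (≡.refl , ≡.refl)))) (step (adj⁺ E e∈ (inj₂ (≡.refl , ≡.refl))))
    tree⇒bfsOk (suc f) X (u ∷ U) l eq uniq every r₀∉ paths sealed = cong₂ _∧_ (cong not no-siblings)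
      (tree⇒bfsOk f (u ∷ X) (U ++ chosen a u l) (rest a u l)
        (≡.trans (ℕ.suc-injective eq) (pop-length a u U l))
        (Unique-resp-↭ reorder uniq) (λ w → Perm.∈-resp-↭ reorder (every w))
        (λ r₀∈ → r₀∉ (proj₁ (∈-filterᵇ⁻ (not ∘ a u) {l} r₀∈))) paths′ sealed′)
      where
      reorder : X ++ (u ∷ U ++ l) ↭ u ∷ X ++ ((U ++ chosen a u l) ++ rest a u l)
      reorder = ↭-trans (Perm.shift u X (U ++ l)) (prep u (Perm.++⁺ˡ X (pop-↭ a u U l)))

      outside : ∀ {v} → v ∈ u ∷ U → v ∉ X
      outside v∈ v∈X = unique-disjoint X uniq v∈X (∈-++⁺ˡ v∈)

      no-siblings : any (a u) U ≡ false
      no-siblings = Bool.¬-not sibling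
        where
        sibling : ¬ any (a u) U ≡ true
        sibling eq′ with any-true⁻ (a u) U eq′
        ... | u′ , u′∈ , auu′ = no-cycle-edge X (outside (here ≡.refl)) (outside (there u′∈)) (paths (here ≡.refl)) (paths (there u′∈)) auu′

      widen : ∀ {v w} → Explored X v w → Explored (u ∷ X) v w
      widen (avw , inj₁ v∈) = avw , inj₁ (there v∈)
      widen (avw , inj₂ w∈) = avw , inj₂ (there w∈)

      paths′ : ∀ {v} → v ∈ U ++ chosen a u l → Star (Explored (u ∷ X)) r₀ v
      paths′ v∈ with ∈-++⁻ U v∈
      ... | inj₁ v∈U = Star.map widen (paths (there v∈U))
      ... | inj₂ v∈C = Star.map widen (paths (here ≡.refl)) ◅◅ ((proj₂ (∈-filterᵇ⁻ (a u) {l} v∈C) , inj₁ (here ≡.refl)) ◅ ε)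

      sealed′ : ∀ {v w} → v ∈ u ∷ X → w ∈ rest a u l → a v w ≡ false
      sealed′ (here ≡.refl) w∈ = ≡.trans (≡.sym (Bool.not-involutive _)) (cong not (proj₂ (∈-filterᵇ⁻ (not ∘ a u) {l} w∈)))
      sealed′ (there v∈)  w∈ = sealed v∈ (proj₁ (∈-filterᵇ⁻ (not ∘ a u) {l} w∈))

  isTree≡bfsOk : isTree E ≡ bfsOk V a [ r₀ ] pool
  isTree≡bfsOk = ≡-of-true forward (λ ok → cong₂ _∧_ (ok⇒connected ok) (ok⇒acyclic ok))
    where
    forward : isTree E ≡ true → bfsOk V a [ r₀ ] pool ≡ true
    forward tree = tree⇒bfsOk (proj₁ (∧-true⁻ tree)) (proj₂ (∧-true⁻ {connected E} tree)) V [] [ r₀ ] pool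
      (cong suc (≡.sym (≡.trans (List.length-map Fin.suc (allFin m)) (List.length-tabulate id))))
      unique-vertices all-vertices (unique-∉ unique-vertices) (λ { (here ≡.refl) → ε }) (λ ())

-- The plane shape of a tree found by the search

Realises : Edges n → ℕ × Maybe (Fin n) × Fin n → Shape → Set
Realises E (g , p , v) t = ∀ d → stripsAt E g p v d ≡ strips t d

stripsAt-node : ∀ (E : Edges n) g p u d {cs ts} → children E p u ≡ cs →
  Pointwise (λ c t → Realises E (g , just u , c) t) cs ts → stripsAt E (suc g) p u d ≡ strips (node ts) d
stripsAt-node E g p u d eq hs with children E p u
stripsAt-node E g p u d ≡.refl []                     | []     = ≡.refl
stripsAt-node E g p u d ≡.refl (_∷_ {y = t} h hs)     | c ∷ cs
  rewrite h (suc d) with strips t (suc d) | strips-top t (suc d)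
... | _ | j , ss , ≡.refl = cong (λ ss′ → strip d (suc (suc j)) ∷ ss ++ ss′) (forest hs)
  where
  forest : ∀ {cs ts} → Pointwise (λ c t → Realises E (g , just u , c) t) cs ts →
    concatMap (λ c → stripsAt E g (just u) c (suc d)) cs ≡ forestStrips ts (suc d)
  forest []       = ≡.refl
  forest (h ∷ hs) = cong₂ _++_ (h (suc d)) (forest hs)

pointwise-split : {R : A → B → Set} (xs : List A) {ys : List A} {zs : List B} → Pointwise R (xs ++ ys) zs →
  ∃₂ λ us vs → zs ≡ us ++ vs × Pointwise R xs us × Pointwise R ys vs
pointwise-split []       rs       = [] , _ , ≡.refl , [] , rs
pointwise-split (_ ∷ xs) (r ∷ rs) with pointwise-split xs rs
... | us , vs , ≡.refl , rs₁ , rs₂ = _ ∷ us , vs , ≡.refl , r ∷ rs₁ , rs₂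

pointwise-map⁻ : {R : B → C → Set} (f : A → B) (xs : List A) {zs : List C} →
  Pointwise R (map f xs) zs → Pointwise (R ∘ f) xs zs
pointwise-map⁻ f []       []       = []
pointwise-map⁻ f (_ ∷ xs) (r ∷ rs) = r ∷ pointwise-map⁻ f xs rs

module SearchShapes {m : ℕ} (E : Edges (suc m)) (asc : Ascending E) where
  private
    V = suc m
    a : Adjacency V
    a = adj E

  open Colouring a (adj-sym E) (adj-loopless E asc) using (popped-edge)

  Entry : Set
  Entry = ℕ × Maybe (Fin V) × Fin V

  vertex : Entry → Fin V
  vertex = proj₂ ∘ proj₂

  -- W lists the vertices that have not been popped yet.
  Ready : ℕ → List (Fin V) → Entry → Set
  Ready f W (g , p , v) = f ℕ.≤ g × (∀ w → a v w ≡ true → p ≡ just w ⊎ w ∈ W) × (∀ w → p ≡ just w → w ∉ W)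

  module _ (f g : ℕ) (p : Maybe (Fin V)) (u : Fin V) (U l : List (Fin V)) (ok : bfsOk (suc f) a (u ∷ U) l ≡ true)
           (nbrs : ∀ w → a u w ≡ true → p ≡ just w ⊎ w ∈ u ∷ U ++ l) (parent∉ : ∀ w → p ≡ just w → w ∉ u ∷ U ++ l)
           (π : Fin V → Bool) (l≡ : l ≡ filterᵇ π (allFin V)) where
    neighbour-π : ∀ w → a u w ≡ true → p ≢ just w → π w ≡ true
    neighbour-π w auw ¬p with nbrs w auw
    ... | inj₁ p≡ = ⊥-elim (¬p p≡)
    ... | inj₂ w∈ = proj₂ (∈-filterᵇ⁻ π (subst (w ∈_) l≡ (proj₁ (∈-filterᵇ⁻ (a u) {l} (popped-edge f u U l ok w∈ auw)))))

    parent-π : ∀ w → p ≡ just w → π w ≡ false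
    parent-π w p≡ = Bool.¬-not (λ πw → parent∉ w p≡ (there (∈-++⁺ʳ U (subst (w ∈_) (≡.sym l≡) (∈-filterᵇ⁺ π (∈-allFin w) πw)))))

    filter≡chosen : (np : Fin V → Bool) → (∀ w → a u w ≡ true → np w ≡ π w) →
      filterᵇ (λ w → a u w ∧ np w) (allFin V) ≡ chosen a u l
    filter≡chosen np np≡ = ≡.trans (filterᵇ-cong (allFin V) (λ {w} _ → pointwise w))
      (≡.trans (≡.sym (filterᵇ-∧ π (a u) (allFin V))) (cong (filterᵇ (a u)) (≡.sym l≡)))
      where
      pointwise : ∀ w → a u w ∧ np w ≡ π w ∧ a u w
      pointwise w with a u w in auw
      ... | true  = ≡.trans (np≡ w auw) (≡.sym (Bool.∧-identityʳ (π w)))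
      ... | false = ≡.sym (Bool.∧-zeroʳ (π w))

  -- As a filter of `allFin` the pool is listed by increasing label, like `children`. A neighbour
  -- other than the parent has not been popped, and no edge leads from `u` into the queue, so it
  -- lies in the pool; the parent does not.
  children≡chosen : ∀ f p u U l → bfsOk (suc f) a (u ∷ U) l ≡ true →
    (∀ w → a u w ≡ true → p ≡ just w ⊎ w ∈ u ∷ U ++ l) → (∀ w → p ≡ just w → w ∉ u ∷ U ++ l) →
    (π : Fin V → Bool) → l ≡ filterᵇ π (allFin V) → children E p u ≡ chosen a u l
  children≡chosen f nothing  u U l ok nbrs parent∉ π l≡ = filter≡chosen f 0 nothing u U l ok nbrs parent∉ π l≡
    (λ _ → true) (λ w auw → ≡.sym (neighbour-π f 0 nothing u U l ok nbrs parent∉ π l≡ w auw λ ()))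
  children≡chosen f (just q) u U l ok nbrs parent∉ π l≡ = filter≡chosen f 0 (just q) u U l ok nbrs parent∉ π l≡
    (λ w → not (q =ᶠ w)) not-parent
    where
    not-parent : ∀ w → a u w ≡ true → not (q =ᶠ w) ≡ π w
    not-parent w auw with q Fin.≟ w
    ... | yes ≡.refl = ≡.sym (parent-π f 0 (just q) u U l ok nbrs parent∉ π l≡ q ≡.refl)
    ... | no q≢w   = ≡.sym (neighbour-π f 0 (just q) u U l ok nbrs parent∉ π l≡ w auw (q≢w ∘ just-injective))

  -- The recursive call returns shapes for the next queue. Those at its end belong to the children
  -- of `u`, and placing them under a `node` gives the shape at `u`.
  search-shapes : ∀ f Q U l (π : Fin V → Bool) → map vertex Q ≡ U → f ≡ length U ℕ.+ length l →
    bfsOk f a U l ≡ true → Unique (U ++ l) → l ≡ filterᵇ π (allFin V) → All (Ready f (U ++ l)) Q →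
    (∀ {v w} → v ∈ l → a v w ≡ true → w ∈ U ++ l) →
    ∃ λ ts → Pointwise (Realises E) Q ts × forestSize ts ≡ f × bfsDegrees f ts ≡ searchDegrees f a U l
  search-shapes zero    []                    .[] [] π ≡.refl f≡ ok uniq l≡ ready inner = [] , [] , ≡.refl , ≡.refl
  search-shapes (suc f) []                    .[] [] π ≡.refl () ok uniq l≡ ready inner
  search-shapes (suc f) ((zero  , p , u) ∷ Q) _   l  π ≡.refl f≡ ok uniq l≡ ((() , _) ∷ _) inner
  search-shapes (suc f) ((suc g , p , u) ∷ Q) _   l  π ≡.refl f≡ ok uniq l≡ ((s≤s f≤g , nbrs , parent∉) ∷ ready) inner
    with search-shapes f (Q ++ map (λ c → g , just u , c) Ch) (U ++ Ch) (rest a u l) (λ w → π w ∧ not (a u w))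
           (≡.trans (List.map-++ vertex Q _) (cong (U ++_) (≡.trans (≡.sym (List.map-∘ Ch)) (List.map-id Ch))))
           (≡.trans (ℕ.suc-injective f≡) (pop-length a u U l)) (ok-next a f u U l ok) (Unique-resp-↭ (pop-↭ a u U l) (tail uniq))
           (≡.trans (cong (filterᵇ (not ∘ a u)) l≡) (filterᵇ-∧ π (not ∘ a u) (allFin V)))
           (All.++⁺ (old-ready Q (λ v∈ → v∈) ready) (All.map⁺ (All.tabulate new-ready))) inner′
    where
    U = map vertex Q
    Ch = chosen a u l
    W′ = (U ++ Ch) ++ rest a u l

    tail : ∀ {x : Fin V} {xs} → Unique (x ∷ xs) → Unique xs
    tail (_ ∷ uniq) = uniq

    into : ∀ {w} → w ∈ U ++ l → w ∈ W′
    into = ∈-pop a u U l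

    out-of : ∀ {w} → w ∈ W′ → w ∈ U ++ l
    out-of = Perm.∈-resp-↭ (↭-sym (pop-↭ a u U l))

    old-ready : ∀ Q′ → (∀ {v} → v ∈ map vertex Q′ → v ∈ U) → All (Ready (suc f) (u ∷ U ++ l)) Q′ → All (Ready f W′) Q′
    old-ready []                 sub []                                 = []
    old-ready ((g′ , p′ , v) ∷ Q′) sub ((sf≤ , nbrs′ , parent∉′) ∷ readys) =
      (ℕ.≤-trans (ℕ.n≤1+n f) sf≤ , nbrs″ , λ w p≡ w∈ → parent∉′ w p≡ (there (out-of w∈))) ∷ old-ready Q′ (sub ∘ there) readys
      where
      nbrs″ : ∀ w → a v w ≡ true → p′ ≡ just w ⊎ w ∈ W′
      nbrs″ w avw with nbrs′ w avw
      ... | inj₁ p≡          = inj₁ p≡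
      ... | inj₂ (here ≡.refl) = true≢false (≡.trans (adj-sym E u v) avw) (no-sibling a f u U l ok (sub (here ≡.refl)))
      ... | inj₂ (there w∈)  = inj₂ (into w∈)

    new-ready : ∀ {c} → c ∈ Ch → Ready f W′ (g , just u , c)
    new-ready {c} c∈ = f≤g , nbrs′ , λ { _ ≡.refl u∈ → unique-∉ uniq (out-of u∈) }
      where
      nbrs′ : ∀ w → a c w ≡ true → just u ≡ just w ⊎ w ∈ W′
      nbrs′ w acw with inner (proj₁ (∈-filterᵇ⁻ (a u) {l} c∈)) acw
      ... | here ≡.refl = inj₁ ≡.refl
      ... | there w∈  = inj₂ (into w∈)

    inner′ : ∀ {v w} → v ∈ rest a u l → a v w ≡ true → w ∈ W′
    inner′ {v} v∈ avw with ∈-filterᵇ⁻ (not ∘ a u) {l} v∈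
    ... | v∈l , notauv with inner v∈l avw
    ...   | here ≡.refl = true≢false (≡.trans (adj-sym E u v) avw) (≡.trans (≡.sym (Bool.not-involutive _)) (cong not notauv))
    ...   | there w∈  = into w∈
  ... | ts , realised , size≡ , degrees≡ with pointwise-split Q realised
  ...   | us , vs , ≡.refl , realisedQ , realisedC =
      node vs ∷ us
    , (λ d → stripsAt-node E g p u d (children≡chosen f p u (map vertex Q) l ok nbrs parent∉ π l≡) (pointwise-map⁻ _ (chosen a u l) realisedC)) ∷ realisedQ
    , cong suc (≡.trans (ℕ.+-comm (forestSize vs) _) (≡.trans (≡.sym (forestSize-++ us vs)) size≡))
    , cong₂ _∷_ (≡.sym (Pointwise.Pointwise-length (pointwise-map⁻ _ (chosen a u l) realisedC))) degrees≡

  tree-shape : let pool = map Fin.suc (allFin m) in bfsOk V a [ Fin.zero ] pool ≡ true →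
    ∃ λ t → νTree m E ≡ strips t 0 × size t ≡ V × bfsDegrees V [ t ] ≡ searchDegrees V a [ Fin.zero ] pool
  tree-shape ok with search-shapes V [ (V , nothing , Fin.zero) ] [ Fin.zero ] (map Fin.suc (allFin m)) (member (map Fin.suc (allFin m)))
      ≡.refl (cong suc (≡.sym (≡.trans (List.length-map Fin.suc (allFin m)) (List.length-tabulate id)))) ok unique-vertices
      (≡.sym (filterᵇ-member (allFin⁺ V) (subst (map Fin.suc (allFin m) ⊆_) (≡.sym (allFin-suc m)) (Fin.zero ∷ʳ ⊆-refl))))
      ((ℕ.≤-refl , (λ w _ → inj₂ (all-vertices w)) , λ _ ()) ∷ []) (λ {_} {w} _ _ → all-vertices w)
    where open Search E asc
  ... | t ∷ [] , realised ∷ [] , size≡ , degrees≡ = t , realised 0 , ≡.trans (≡.sym (ℕ.+-identityʳ (size t))) size≡ , degrees≡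

-- Sums over graphs on a list of vertices

star : Fin n → List (Fin n) → Edges n
star u = map (u ,_)

-- Every vertex chooses its neighbours among the later ones. The order of the list then affects only
-- the order and orientation of the edges, while the first choice is the neighbourhood that a search
-- from the first vertex sees.
graphs : List (Fin n) → List (Edges n)
graphs []      = [] ∷ []
graphs (u ∷ V) = concatMap (λ CD → map (star u (proj₁ CD) ++_) (graphs V)) (splits V)

pairsOf : List (Fin n) → Edges n
pairsOf []      = []
pairsOf (u ∷ V) = star u V ++ pairsOf V

filter-above : (pre : List (Fin n)) (u : Fin n) (V : List (Fin n)) → AllPairs Fin._<_ (pre ++ u ∷ V) →
               filterᵇ (λ j → toℕ u <ᵇ toℕ j) (pre ++ u ∷ V) ≡ V
filter-above (v ∷ pre) u V (v< ∷ sorted)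
  rewrite ≥⇒<ᵇ-false (ℕ.<⇒≤ (All.lookup v< (∈-++⁺ʳ pre (here ≡.refl)))) = filter-above pre u V sorted
filter-above [] u V (u< ∷ _) rewrite ≥⇒<ᵇ-false (ℕ.≤-refl {toℕ u}) = all-above V u<
  where
  all-above : ∀ V → All (u Fin.<_) V → filterᵇ (λ j → toℕ u <ᵇ toℕ j) V ≡ V
  all-above []      []         = ≡.refl
  all-above (v ∷ V) (u<v ∷ u<) rewrite <⇒<ᵇ-true u<v = cong (v ∷_) (all-above V u<)

pairs≡pairsOf : ∀ n → pairs n ≡ pairsOf (allFin n)
pairs≡pairsOf n = go [] (allFin n) ≡.refl
  where
  sorted : AllPairs Fin._<_ (allFin n)
  sorted = AllPairs.tabulate⁺-< id

  go : ∀ pre V → pre ++ V ≡ allFin n →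
       concatMap (λ i → map (i ,_) (filterᵇ (λ j → toℕ i <ᵇ toℕ j) (allFin n))) V ≡ pairsOf V
  go pre []      eq = ≡.refl
  go pre (u ∷ V) eq = cong₂ _++_
    (cong (star u) (≡.trans (cong (filterᵇ (λ j → toℕ u <ᵇ toℕ j)) (≡.sym eq))
      (filter-above pre u V (subst (AllPairs Fin._<_) (≡.sym eq) sorted))))
    (go (pre ++ [ u ]) V (≡.trans (List.++-assoc pre [ u ] V) eq))

pairs-ascending : Ascending (pairs n)
pairs-ascending {n} ij∈ with Any.satisfied (∈-concatMap⁻ (λ i → map (i ,_) (filterᵇ (λ j → toℕ i <ᵇ toℕ j) (allFin n))) {xs = allFin n} ij∈)
... | i , p with ∈-map⁻ (i ,_) p
...   | j , j∈ , ≡.refl = <ᵇ-true⇒< (toℕ i) (toℕ j) (proj₂ (∈-filterᵇ⁻ (λ j → toℕ i <ᵇ toℕ j) {allFin n} j∈))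

sublists-⊆ : (l : List A) {s : List A} → s ∈ sublists l → ∀ {a} → a ∈ s → a ∈ l
sublists-⊆ []       (here ≡.refl) ()
sublists-⊆ (b ∷ l) s∈ a∈ with ∈-++⁻ (sublists l) s∈
... | inj₁ s∈′ = there (sublists-⊆ l s∈′ a∈)
... | inj₂ s∈′ with ∈-map⁻ (b ∷_) s∈′
...   | s′ , s′∈ , ≡.refl with a∈
...     | here ≡.refl = here ≡.refl
...     | there a∈′   = there (sublists-⊆ l s′∈ a∈′)

Touches : List (Fin n) → Edges n → Set
Touches V E = ∀ {i j} → (i , j) ∈ E → i ∈ V × j ∈ V

splits-⊆ : (l : List A) {C D : List A} → (C , D) ∈ splits l → ∀ {a} → a ∈ C → a ∈ l
splits-⊆ l CD∈ a∈ = Perm.∈-resp-↭ (↭-sym (toPermutation (splits-interleaving l CD∈))) (∈-++⁺ˡ a∈)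

graphs-touch : (V : List (Fin n)) {E : Edges n} → E ∈ graphs V → Touches V E
graphs-touch []      (here ≡.refl) ()
graphs-touch (u ∷ V) E∈ e∈
  with find (∈-concatMap⁻ (λ CD → map (star u (proj₁ CD) ++_) (graphs V)) {xs = splits V} E∈)
... | (C , D) , CD∈ , p with ∈-map⁻ (star u C ++_) p
...   | E′ , E′∈ , ≡.refl with ∈-++⁻ (star u C) e∈
...     | inj₂ e∈E′ = map₁ there (map₂ there (graphs-touch V E′∈ e∈E′))
...     | inj₁ e∈star with ∈-map⁻ (u ,_) e∈star
...       | c , c∈ , ≡.refl = here ≡.refl , there (splits-⊆ V CD∈ c∈)

infix 4 _∼_
_∼_ : Edges n → Edges n → Set
E ∼ E′ = ∀ u v → adj E u v ≡ adj E′ u v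

adj-++ : (E E′ : Edges n) (u v : Fin n) → adj (E ++ E′) u v ≡ adj E u v ∨ adj E′ u v
adj-++ []      E′ u v = ≡.refl
adj-++ (e ∷ E) E′ u v = ≡.trans (cong (joins e u v ∨_) (adj-++ E E′ u v)) (≡.sym (Bool.∨-assoc (joins e u v) _ _))

∼-++ : (E : Edges n) {E₁ E₂ : Edges n} → E₁ ∼ E₂ → E ++ E₁ ∼ E ++ E₂
∼-++ E {E₁} {E₂} eq u v = ≡.trans (adj-++ E E₁ u v) (≡.trans (cong (adj E u v ∨_) (eq u v)) (≡.sym (adj-++ E E₂ u v)))

↭⇒∼ : {E E′ : Edges n} → E ↭ E′ → E ∼ E′
↭⇒∼ {E = E} {E′} p u v = ≡-of-true (half p) (half (↭-sym p))
  where
  half : ∀ {E E′} → E ↭ E′ → adj E u v ≡ true → adj E′ u v ≡ true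
  half {E} {E′} p eq with adj⁻ E eq
  ... | e , e∈ , j = adj⁺ E′ (Perm.∈-resp-↭ p e∈) j

flip-∼ : (u v : Fin n) (E E′ : Edges n) → E ∼ E′ → (u , v) ∷ E ∼ (v , u) ∷ E′
flip-∼ u v E E′ eq w w′ = cong₂ _∨_ (≡.trans (Bool.∨-comm ((u =ᶠ w) ∧ (v =ᶠ w′)) _)
  (cong₂ _∨_ (Bool.∧-comm (u =ᶠ w′) (v =ᶠ w)) (Bool.∧-comm (u =ᶠ w) (v =ᶠ w′)))) (eq w w′)

interleaving-rest : {C D l : List (Fin n)} → Unique l → Interleaving C D l → filterᵇ (not ∘ member C) l ≡ D
interleaving-rest []       []                                   = ≡.refl
interleaving-rest {C = y ∷ C} (y∉ ∷ uniq) (consˡ sp) rewrite =ᶠ-refl y = ≡.trans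
  (filterᵇ-cong _ (λ {i} i∈ → cong (λ b → not (b ∨ member C i)) (=ᶠ-≢ {i = i} {y} (All.lookup y∉ i∈ ∘ ≡.sym)))) (interleaving-rest uniq sp)
interleaving-rest {C = C} {y ∷ D} (y∉ ∷ uniq) (consʳ sp)
  rewrite ∉⇒member C (λ y∈C → All.lookup y∉ (Perm.∈-resp-↭ (↭-sym (toPermutation sp)) (∈-++⁺ˡ y∈C)) ≡.refl) =
  cong (y ∷_) (interleaving-rest uniq sp)

module AddStar (u : Fin n) (V C : List (Fin n)) (E : Edges n) (u∉V : u ∉ V) (C⊆V : ∀ {c} → c ∈ C → c ∈ V) (touches : Touches V E) where
  adj-centre : ∀ {w} → w ∈ V → adj (star u C ++ E) u w ≡ member C w
  adj-centre {w} w∈V = ≡-of-true forward (λ eq → adj⁺ (star u C ++ E) (∈-++⁺ˡ (∈-map⁺ (u ,_) (member⇒∈ C eq))) (inj₁ (≡.refl , ≡.refl)))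
    where
    forward : adj (star u C ++ E) u w ≡ true → member C w ≡ true
    forward eq with adj⁻ (star u C ++ E) eq
    ... | e , e∈ , j with ∈-++⁻ (star u C) e∈
    forward eq | e , e∈ , inj₁ (≡.refl , ≡.refl) | inj₂ e∈E = ⊥-elim (u∉V (proj₁ (touches e∈E)))
    forward eq | e , e∈ , inj₂ (≡.refl , ≡.refl) | inj₂ e∈E = ⊥-elim (u∉V (proj₂ (touches e∈E)))
    ... | inj₁ e∈star with ∈-map⁻ (u ,_) e∈star
    forward eq | e , e∈ , inj₁ (≡.refl , ≡.refl) | inj₁ e∈star | c , c∈ , ≡.refl = ∈⇒member c∈
    forward eq | e , e∈ , inj₂ (≡.refl , ≡.refl) | inj₁ e∈star | c , c∈ , ≡.refl = ⊥-elim (u∉V w∈V)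

  adj-others : ∀ {v w} → v ∈ V → w ∈ V → adj (star u C ++ E) v w ≡ adj E v w
  adj-others {v} {w} v∈V w∈V = ≡-of-true forward backward
    where
    backward : adj E v w ≡ true → adj (star u C ++ E) v w ≡ true
    backward eq with adj⁻ E eq
    ... | e , e∈ , j = adj⁺ (star u C ++ E) (∈-++⁺ʳ (star u C) e∈) j

    forward : adj (star u C ++ E) v w ≡ true → adj E v w ≡ true
    forward eq with adj⁻ (star u C ++ E) eq
    ... | e , e∈ , j with ∈-++⁻ (star u C) e∈
    ...   | inj₂ e∈E = adj⁺ E e∈E j
    ...   | inj₁ e∈star with ∈-map⁻ (u ,_) e∈star
    forward eq | e , e∈ , inj₁ (≡.refl , _) | inj₁ e∈star | c , c∈ , ≡.refl = ⊥-elim (u∉V v∈V)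
    forward eq | e , e∈ , inj₂ (≡.refl , _) | inj₁ e∈star | c , c∈ , ≡.refl = ⊥-elim (u∉V w∈V)

module TreeSums {c ℓ : Level} (R : CommutativeRing c ℓ) where
  open CommutativeRing R
  open Sums R
  open SetoidReasoning setoid

  ∑-sublists-++ : (xs ys : List A) (Ψ : List A → Carrier) →
    ∑ (sublists (xs ++ ys)) Ψ ≈ ∑[ s ∈ sublists xs ] ∑[ s′ ∈ sublists ys ] Ψ (s ++ s′)
  ∑-sublists-++ []       ys Ψ = sym (+-identityʳ _)
  ∑-sublists-++ (a ∷ xs) ys Ψ = begin
    _ ≈⟨ ∑-++ (sublists (xs ++ ys)) _ Ψ ⟩
    _ ≈⟨ +-congˡ (∑-map (a ∷_) (sublists (xs ++ ys)) Ψ) ⟩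
    _ ≈⟨ +-cong (∑-sublists-++ xs ys Ψ) (∑-sublists-++ xs ys (Ψ ∘ (a ∷_))) ⟩
    _ ≈⟨ +-congˡ (∑-map (a ∷_) (sublists xs) _) ⟨
    _ ≈⟨ ∑-++ (sublists xs) _ _ ⟨
    _ ∎

  ∑-sublists-map : (f : A → B) (l : List A) (Ψ : List B → Carrier) →
    ∑ (sublists (map f l)) Ψ ≈ ∑[ CD ∈ splits l ] Ψ (map f (proj₁ CD))
  ∑-sublists-map f []      Ψ = refl
  ∑-sublists-map f (a ∷ l) Ψ = begin
    _ ≈⟨ ∑-++ (sublists (map f l)) _ Ψ ⟩
    _ ≈⟨ +-comm _ _ ⟩
    _ ≈⟨ +-congʳ (∑-map (f a ∷_) (sublists (map f l)) Ψ) ⟩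
    _ ≈⟨ +-cong (∑-sublists-map f l (Ψ ∘ (f a ∷_))) (∑-sublists-map f l Ψ) ⟩
    _ ≈⟨ ∑-splits-∷ a l _ ⟨
    _ ∎

  ∑-graphs-∷ : (u : Fin n) (V : List (Fin n)) (Ψ : Edges n → Carrier) →
    ∑ (graphs (u ∷ V)) Ψ ≈ ∑[ CD ∈ splits V ] ∑[ E ∈ graphs V ] Ψ (star u (proj₁ CD) ++ E)
  ∑-graphs-∷ u V Ψ = trans (∑-concatMap _ (splits V) Ψ) (∑-cong (splits V) (λ _ → ∑-map _ (graphs V) Ψ))

  ∑-sublists-pairsOf : (V : List (Fin n)) (Ψ : Edges n → Carrier) → ∑ (sublists (pairsOf V)) Ψ ≈ ∑ (graphs V) Ψ
  ∑-sublists-pairsOf []      Ψ = refl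
  ∑-sublists-pairsOf (u ∷ V) Ψ = begin
    _ ≈⟨ ∑-sublists-++ (star u V) (pairsOf V) Ψ ⟩
    _ ≈⟨ ∑-sublists-map (u ,_) V _ ⟩
    _ ≈⟨ ∑-cong (splits V) (λ {CD} _ → ∑-sublists-pairsOf V (Ψ ∘ (star u (proj₁ CD) ++_))) ⟩
    _ ≈⟨ ∑-graphs-∷ u V Ψ ⟨
    _ ∎

  ∑-splits-↭ : {l l′ : List A} → l ↭ l′ → (χ : List A → Carrier) → (∀ {C C′} → C ↭ C′ → χ C ≈ χ C′) →
    ∑[ CD ∈ splits l ] χ (proj₁ CD) ≈ ∑[ CD ∈ splits l′ ] χ (proj₁ CD)
  ∑-splits-↭ Perm.refl χ inv = refl
  ∑-splits-↭ {l = a ∷ l} {a ∷ l′} (Perm.prep _ p) χ inv = begin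
    _ ≈⟨ ∑-splits-∷ a l _ ⟩
    _ ≈⟨ +-cong (∑-splits-↭ p (χ ∘ (a ∷_)) (inv ∘ prep a)) (∑-splits-↭ p χ inv) ⟩
    _ ≈⟨ ∑-splits-∷ a l′ _ ⟨
    _ ∎
  ∑-splits-↭ {l = a ∷ b ∷ l} {b ∷ a ∷ l′} (Perm.swap _ _ p) χ inv = begin
    _ ≈⟨ ∑-splits-∷ a (b ∷ l) _ ⟩
    _ ≈⟨ +-cong (∑-splits-∷ b l _) (∑-splits-∷ b l _) ⟩
    _ ≈⟨ +-cong (+-cong (trans (∑-splits-↭ p (λ C → χ (a ∷ b ∷ C)) (λ q → inv (prep a (prep b q))))
                               (∑-cong (splits l′) (λ _ → inv (Perm.swap a b ↭-refl))))
                        (∑-splits-↭ p (χ ∘ (a ∷_)) (inv ∘ prep a)))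
                (+-cong (∑-splits-↭ p (χ ∘ (b ∷_)) (inv ∘ prep b)) (∑-splits-↭ p χ inv)) ⟩
    _ ≈⟨ +-interchange _ _ _ _ ⟩
    _ ≈⟨ +-cong (∑-splits-∷ a l′ _) (∑-splits-∷ a l′ _) ⟨
    _ ≈⟨ ∑-splits-∷ b (a ∷ l′) _ ⟨
    _ ∎
    where
    open import Algebra.Properties.CommutativeSemigroup +-commutativeSemigroup using () renaming (interchange to +-interchange)
  ∑-splits-↭ (Perm.trans p p′) χ inv = trans (∑-splits-↭ p χ inv) (∑-splits-↭ p′ χ inv)

  -- The neighbourhoods of `u` and `v` in `V` are chosen independently, so their stars commute; the
  -- edge between `u` and `v`, if present, only changes its orientation.
  ∑-graphs-swap : (u v : Fin n) (V : List (Fin n)) (Ψ : Edges n → Carrier) → (∀ {E E′} → E ∼ E′ → Ψ E ≈ Ψ E′) →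
    ∑ (graphs (u ∷ v ∷ V)) Ψ ≈ ∑ (graphs (v ∷ u ∷ V)) Ψ
  ∑-graphs-swap {n} u v V Ψ inv = begin
    _ ≈⟨ unfold u v ⟩
    _ ≈⟨ +-cong (exchange (λ {C} {D} E → inv (flip-∼ u v (star u C ++ (star v D ++ E)) (star v D ++ (star u C ++ E)) (commute u v C D E)))) (exchange (λ {C} {D} E → inv (commute u v C D E))) ⟩
    _ ≈⟨ unfold v u ⟨
    _ ∎
    where
    unfold : ∀ u v → ∑ (graphs (u ∷ v ∷ V)) Ψ
      ≈ (∑[ CD ∈ splits V ] ∑[ CD′ ∈ splits V ] ∑[ E ∈ graphs V ] Ψ ((u , v) ∷ star u (proj₁ CD) ++ (star v (proj₁ CD′) ++ E)))
        + (∑[ CD ∈ splits V ] ∑[ CD′ ∈ splits V ] ∑[ E ∈ graphs V ] Ψ (star u (proj₁ CD) ++ (star v (proj₁ CD′) ++ E)))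
    unfold u v = trans (∑-graphs-∷ u (v ∷ V) Ψ) (trans (∑-splits-∷ v V _)
      (+-cong (∑-cong (splits V) (λ _ → ∑-graphs-∷ v V _)) (∑-cong (splits V) (λ _ → ∑-graphs-∷ v V _))))

    commute : ∀ u v C D (E : Edges n) → star u C ++ (star v D ++ E) ∼ star v D ++ (star u C ++ E)
    commute u v C D E = ↭⇒∼ (↭-trans (Perm.↭-reflexive (≡.sym (List.++-assoc (star u C) _ E)))
      (↭-trans (Perm.++⁺ʳ E (Perm.++-comm (star u C) (star v D))) (Perm.↭-reflexive (List.++-assoc (star v D) _ E))))

    exchange : ∀ {f g : List (Fin n) → List (Fin n) → Edges n → Carrier} → (∀ {C D} E → f C D E ≈ g D C E) →
      ∑[ CD ∈ splits V ] ∑[ CD′ ∈ splits V ] ∑[ E ∈ graphs V ] f (proj₁ CD) (proj₁ CD′) E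
        ≈ ∑[ CD ∈ splits V ] ∑[ CD′ ∈ splits V ] ∑[ E ∈ graphs V ] g (proj₁ CD) (proj₁ CD′) E
    exchange f≈g = trans (∑-swap (splits V) (splits V) _)
      (∑-cong (splits V) (λ _ → ∑-cong (splits V) (λ _ → ∑-cong (graphs V) (λ {E} _ → f≈g E))))

  -- After a pop the vertices have to be listed again as queue followed by pool.
  ∑-graphs-↭ : {V V′ : List (Fin n)} → V ↭ V′ → (Ψ : Edges n → Carrier) → (∀ {E E′} → E ∼ E′ → Ψ E ≈ Ψ E′) →
    ∑ (graphs V) Ψ ≈ ∑ (graphs V′) Ψ
  ∑-graphs-↭ Perm.refl Ψ inv = refl
  ∑-graphs-↭ {V = u ∷ V} {.u ∷ V′} (Perm.prep _ p) Ψ inv = begin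
    _ ≈⟨ ∑-graphs-∷ u V Ψ ⟩
    _ ≈⟨ ∑-cong (splits V) (λ {CD} _ → ∑-graphs-↭ p (Ψ ∘ (star u (proj₁ CD) ++_)) (λ eq → inv (∼-++ (star u (proj₁ CD)) eq))) ⟩
    _ ≈⟨ ∑-splits-↭ p (λ C → ∑[ E ∈ graphs V′ ] Ψ (star u C ++ E))
           (λ q → ∑-cong (graphs V′) (λ {E} _ → inv (↭⇒∼ (Perm.++⁺ʳ E (Perm.map⁺ (u ,_) q))))) ⟩
    _ ≈⟨ ∑-graphs-∷ u V′ Ψ ⟨
    _ ∎
  ∑-graphs-↭ {V = u ∷ v ∷ V} {.v ∷ .u ∷ V′} (Perm.swap _ _ p) Ψ inv = trans (∑-graphs-swap u v V Ψ inv) (begin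
    _ ≈⟨ ∑-graphs-∷ v (u ∷ V) Ψ ⟩
    _ ≈⟨ ∑-cong (splits (u ∷ V)) (λ {CD} _ → trans (∑-graphs-∷ u V _) (trans
           (∑-cong (splits V) (λ {CD′} _ → ∑-graphs-↭ p (λ E → Ψ (star v (proj₁ CD) ++ (star u (proj₁ CD′) ++ E)))
             (λ eq → inv (∼-++ (star v (proj₁ CD)) (∼-++ (star u (proj₁ CD′)) eq)))))
           (trans (∑-splits-↭ p (λ C → ∑[ E ∈ graphs V′ ] Ψ (star v (proj₁ CD) ++ (star u C ++ E)))
             (λ q → ∑-cong (graphs V′) (λ {E} _ → inv (∼-++ (star v (proj₁ CD)) (↭⇒∼ (Perm.++⁺ʳ E (Perm.map⁺ (u ,_) q)))))))
             (sym (∑-graphs-∷ u V′ _))))) ⟩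
    _ ≈⟨ ∑-splits-↭ (prep u p) (λ C → ∑[ E ∈ graphs (u ∷ V′) ] Ψ (star v C ++ E))
           (λ q → ∑-cong (graphs (u ∷ V′)) (λ {E} _ → inv (↭⇒∼ (Perm.++⁺ʳ E (Perm.map⁺ (v ,_) q))))) ⟩
    _ ≈⟨ ∑-graphs-∷ v (u ∷ V′) Ψ ⟨
    _ ∎)
  ∑-graphs-↭ (Perm.trans p p′) Ψ inv = trans (∑-graphs-↭ p Ψ inv) (∑-graphs-↭ p′ Ψ inv)

  ∑-splits-avoid : (U l : List A) (χ : List A → Carrier) → (∀ C y → y ∈ U → y ∈ C → χ C ≈ 0#) →
    ∑[ CD ∈ splits (U ++ l) ] χ (proj₁ CD) ≈ ∑[ CD ∈ splits l ] χ (proj₁ CD)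
  ∑-splits-avoid []      l χ χ≈0 = refl
  ∑-splits-avoid (y ∷ U) l χ χ≈0 = begin
    _ ≈⟨ ∑-splits-∷ y (U ++ l) _ ⟩
    _ ≈⟨ +-cong (trans (∑-cong (splits (U ++ l)) (λ {CD} _ → χ≈0 (y ∷ proj₁ CD) y (here ≡.refl) (here ≡.refl))) (∑-zero (splits (U ++ l))))
                (∑-splits-avoid U l χ (λ C y y∈ → χ≈0 C y (there y∈))) ⟩
    _ ≈⟨ +-identityˡ _ ⟩
    _ ∎

  searchTerm : ℕ → List (Fin n) → List (Fin n) → (List ℕ → Carrier) → Edges n → Carrier
  searchTerm f U l φ E = if bfsOk f (adj E) U l then φ (searchDegrees f (adj E) U l) else 0#

  searchTerm-∼ : ∀ f (U l : List (Fin n)) φ {E E′} → E ∼ E′ → searchTerm f U l φ E ≈ searchTerm f U l φ E′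
  searchTerm-∼ f U l φ eq with search-cong f U l (λ {v} {w} _ _ → eq v w)
  ... | ok≡ , degrees≡ = reflexive (cong₂ (λ b as → if b then φ as else 0#) ok≡ degrees≡)

  -- The neighbourhood of `u` is chosen first. If it meets the queue the search fails; otherwise it
  -- is the set `C` of children, and the search continues on the remaining graph, which is still
  -- arbitrary.
  ∑-graphs-search : ∀ f (U l : List (Fin n)) (φ : List ℕ → Carrier) → f ≡ length U ℕ.+ length l → Unique (U ++ l) →
    ∑ (graphs (U ++ l)) (searchTerm f U l φ) ≈ ∑ (degreeSeqs f (length U) l) φ
  ∑-graphs-search zero    []      []      φ f≡ uniq = refl
  ∑-graphs-search (suc f) []      (w ∷ l) φ f≡ uniq = ∑-zero (graphs (w ∷ l))
  ∑-graphs-search (suc f) (u ∷ U) l       φ f≡ (u∉ ∷ uniq) = begin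
    _ ≈⟨ ∑-graphs-∷ u (U ++ l) _ ⟩
    _ ≈⟨ ∑-splits-avoid U l (λ C → ∑[ E ∈ graphs (U ++ l) ] searchTerm (suc f) (u ∷ U) l φ (star u C ++ E)) sibling ⟩
    _ ≈⟨ ∑-splits-cong l (λ {C} {D} sp → popCentre C D sp) ⟩
    _ ≈⟨ ∑-concatMap _ (splits l) φ ⟨
    _ ∎
    where
    u∉V : u ∉ U ++ l
    u∉V u∈ = All.lookup u∉ u∈ ≡.refl

    sibling : ∀ C y → y ∈ U → y ∈ C → ∑[ E ∈ graphs (U ++ l) ] searchTerm (suc f) (u ∷ U) l φ (star u C ++ E) ≈ 0#
    sibling C y y∈U y∈C = trans (∑-cong (graphs (U ++ l)) (λ {E} _ → reflexive (not-ok E))) (∑-zero (graphs (U ++ l)))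
      where
      not-ok : ∀ E → searchTerm (suc f) (u ∷ U) l φ (star u C ++ E) ≡ 0#
      not-ok E rewrite any-true⁺ (adj (star u C ++ E) u) y∈U
        (adj⁺ (star u C ++ E) (∈-++⁺ˡ (∈-map⁺ (u ,_) y∈C)) (inj₁ (≡.refl , ≡.refl))) = ≡.refl

    popCentre : ∀ C D → Interleaving C D l →
      ∑[ E ∈ graphs (U ++ l) ] searchTerm (suc f) (u ∷ U) l φ (star u C ++ E)
        ≈ ∑ (map (length C ∷_) (degreeSeqs f (length U ℕ.+ length C) D)) φ
    popCentre C D sp = begin
      _ ≈⟨ ∑-cong (graphs (U ++ l)) (λ {E} E∈ → reflexive (popped E (graphs-touch (U ++ l) E∈))) ⟩
      ∑ (graphs (U ++ l)) (searchTerm f (U ++ C) D (φ ∘ (length C ∷_)))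
        ≈⟨ ∑-graphs-↭ reorder _ (λ {E} {E′} → searchTerm-∼ f (U ++ C) D (φ ∘ (length C ∷_)) {E} {E′}) ⟩
      ∑ (graphs ((U ++ C) ++ D)) (searchTerm f (U ++ C) D (φ ∘ (length C ∷_)))
        ≈⟨ ∑-graphs-search f (U ++ C) D (φ ∘ (length C ∷_)) f≡′ (Unique-resp-↭ reorder uniq) ⟩
      ∑ (degreeSeqs f (length (U ++ C)) D) (φ ∘ (length C ∷_))
        ≡⟨ cong (λ k → ∑ (degreeSeqs f k D) (φ ∘ (length C ∷_))) (List.length-++ U) ⟩
      ∑ (degreeSeqs f (length U ℕ.+ length C) D) (φ ∘ (length C ∷_))
        ≈⟨ ∑-map (length C ∷_) (degreeSeqs f (length U ℕ.+ length C) D) φ ⟨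
      _ ∎
      where
      reorder : U ++ l ↭ (U ++ C) ++ D
      reorder = ↭-trans (Perm.++⁺ˡ U (toPermutation sp)) (Perm.↭-reflexive (≡.sym (List.++-assoc U C D)))

      f≡′ : f ≡ length (U ++ C) ℕ.+ length D
      f≡′ = ≡.trans (ℕ.suc-injective f≡) (≡.trans (≡.sym (List.length-++ U)) (≡.trans (Perm.↭-length reorder) (List.length-++ (U ++ C))))

      C⊆l : ∀ {c} → c ∈ C → c ∈ l
      C⊆l c∈ = Perm.∈-resp-↭ (↭-sym (toPermutation sp)) (∈-++⁺ˡ c∈)

      unique-l : ∀ U → Unique (U ++ l) → Unique l
      unique-l []      uniq       = uniq
      unique-l (_ ∷ U) (_ ∷ uniq) = unique-l U uniq

      popped : ∀ E → Touches (U ++ l) E →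
        searchTerm (suc f) (u ∷ U) l φ (star u C ++ E) ≡ searchTerm f (U ++ C) D (φ ∘ (length C ∷_)) E
      popped E touches = ≡.trans (cong (λ b → unfolded b (chosen a u l) (rest a u l)) no-siblings)
        (≡.trans (cong₂ (unfolded false) chosen≡ rest≡)
          (cong₂ (λ b as → if b then φ (length C ∷ as) else 0#) (proj₁ next) (proj₂ next)))
        where
        a = adj (star u C ++ E)
        unfolded : Bool → List (Fin _) → List (Fin _) → Carrier
        unfolded b C′ D′ = if not b ∧ bfsOk f a (U ++ C′) D′ then φ (length C′ ∷ searchDegrees f a (U ++ C′) D′) else 0#
        open AddStar u (U ++ l) C E u∉V (λ c∈ → ∈-++⁺ʳ U (C⊆l c∈)) touches
        no-siblings : any (adj (star u C ++ E) u) U ≡ false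
        no-siblings = Bool.¬-not λ eq → found (any-true⁻ (adj (star u C ++ E) u) U eq)
          where
          found : ¬ (∃ λ w → w ∈ U × adj (star u C ++ E) u w ≡ true)
          found (w , w∈ , auw) = unique-disjoint U uniq w∈ (C⊆l (member⇒∈ C (≡.trans (≡.sym (adj-centre (∈-++⁺ˡ w∈))) auw)))
        chosen≡ : chosen (adj (star u C ++ E)) u l ≡ C
        chosen≡ = ≡.trans (filterᵇ-cong l (λ w∈ → adj-centre (∈-++⁺ʳ U w∈))) (filterᵇ-member (unique-l U uniq) (interleaving-⊆ˡ sp))
        rest≡ : rest (adj (star u C ++ E)) u l ≡ D
        rest≡ = ≡.trans (filterᵇ-cong l (λ w∈ → cong not (adj-centre (∈-++⁺ʳ U w∈)))) (interleaving-rest (unique-l U uniq) sp)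
        back : ∀ {w} → w ∈ (U ++ C) ++ D → w ∈ U ++ l
        back = Perm.∈-resp-↭ (↭-sym reorder)
        next : bfsOk f (adj (star u C ++ E)) (U ++ C) D ≡ bfsOk f (adj E) (U ++ C) D
             × searchDegrees f (adj (star u C ++ E)) (U ++ C) D ≡ searchDegrees f (adj E) (U ++ C) D
        next = search-cong f (U ++ C) D (λ v∈ w∈ → adj-others (back v∈) (back w∈))

-- The three sides expressed by `bfsSum`

module Theorem {c ℓ : Level} (R : CommutativeRing c ℓ) (q : CommutativeRing.Carrier R)
               (N : ℕ) (x : Fin N → CommutativeRing.Carrier R) where
  open CommutativeRing R
  open Poly R q N x
  open Sums R
  open TreeSums R
  open Process R q N x
  open StripLLT R q N x
  open Parking R q N x
  open Cumulant R q N x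
  open SetoidReasoning setoid

  length-pool : ∀ m → length (map Fin.suc (allFin m)) ≡ m
  length-pool m = ≡.trans (List.length-map Fin.suc (allFin m)) (List.length-tabulate id)

  parkingSum≈ : ∀ m → ∑[ f ∈ parkingFunctions m ] LLTμ (suc m) (schröderOf m f) ≈ bfsSum (map Fin.suc (allFin m))
  parkingSum≈ m = trans
    (reflexive (cong (λ k → ∑[ f ∈ parkingFunctions k ] LLTμ (suc k) (schröderOf k f)) (≡.sym (length-pool m))))
    (parkingSum≈bfsSum (map Fin.suc (allFin m)))

  treeSum≈bfsSum : ∀ m → ∑[ T ∈ cayleyTrees (suc m) ] LLT (νTree m T) ≈ bfsSum (map Fin.suc (allFin m))
  treeSum≈bfsSum m = begin
    _ ≈⟨ ∑-filterᵇ isTree (sublists (pairs V)) _ ⟩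
    _ ≈⟨ ∑-cong (sublists (pairs V)) (λ {E} E∈ → term E (λ e∈ → pairs-ascending (sublists-⊆ (pairs V) E∈ e∈))) ⟩
    ∑ (sublists (pairs V)) (searchTerm V [ Fin.zero ] pool φ)
      ≡⟨ cong (λ ps → ∑ (sublists ps) (searchTerm V [ Fin.zero ] pool φ)) (pairs≡pairsOf V) ⟩
    ∑ (sublists (pairsOf (allFin V))) (searchTerm V [ Fin.zero ] pool φ)
      ≈⟨ ∑-sublists-pairsOf (allFin V) _ ⟩
    ∑ (graphs (allFin V)) (searchTerm V [ Fin.zero ] pool φ)
      ≡⟨ cong (λ vs → ∑ (graphs vs) (searchTerm V [ Fin.zero ] pool φ)) (allFin-suc m) ⟩
    ∑ (graphs (Fin.zero ∷ pool)) (searchTerm V [ Fin.zero ] pool φ)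
      ≈⟨ ∑-graphs-search V [ Fin.zero ] pool φ (cong suc (≡.sym |pool|)) (subst Unique (allFin-suc m) (allFin⁺ V)) ⟩
    ∑ (degreeSeqs V 1 pool) φ
      ≡⟨ cong (λ k → ∑[ as ∈ degreeSeqs (suc k) 1 pool ] ∑[ v ∈ allFuns N (suc k) ] degreeWeight 1 as v * monomial v) |pool| ⟨
    _ ∎
    where
    V = suc m
    pool = map Fin.suc (allFin m)

    |pool| : length pool ≡ m
    |pool| = length-pool m

    φ : List ℕ → Carrier
    φ as = ∑[ v ∈ allFuns N V ] degreeWeight 1 as v * monomial v

    term : ∀ E → Ascending E → (if isTree E then LLT (νTree m E) else 0#) ≈ searchTerm V [ Fin.zero ] pool φ E
    term E asc rewrite Search.isTree≡bfsOk E asc with bfsOk V (adj E) [ Fin.zero ] pool in ok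
    ... | false = refl
    ... | true with SearchShapes.tree-shape E asc ok
    ...   | t , ν≡ , size≡ , degrees≡ = begin
      LLT (νTree m E)       ≡⟨ cong LLT ν≡ ⟩
      LLT (strips t 0)      ≈⟨ LLT-strips t ⟩
      _ ≡⟨ cong (λ k → ∑[ v ∈ allFuns N k ] degreeWeight 1 (bfsDegrees k [ t ]) v * monomial v) size≡ ⟩
      φ (bfsDegrees V [ t ]) ≡⟨ cong φ degrees≡ ⟩
      _ ∎

  cumulant≈bfsSum : ∀ m (κ : Subset (suc m) → Carrier) → (∀ a b → t * a ≈ t * b → a ≈ b) → IsCumulant (suc m) κ →
    κ ⊤ ≈ bfsSum (map Fin.suc (allFin m))
  cumulant≈bfsSum m κ reg isκ = begin
    κ ⊤ ≡⟨ cong κ (≡.trans (≡.sym toSubset-allFin) (cong toSubset (allFin-suc m))) ⟩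
    κ (toSubset (Fin.zero ∷ map Fin.suc (allFin m)))
      ≈⟨ κ≈bfsSum κ isκ reg _ Fin.zero (map Fin.suc (allFin m)) ℕ.≤-refl (subst (_⊆ allFin (suc m)) (allFin-suc m) ⊆-refl) ⟩
    _ ∎

theorem1p1 : ∀ {c ℓ} (R : CommutativeRing c ℓ) (q : CommutativeRing.Carrier R)
    (N : ℕ) (x : Fin N → CommutativeRing.Carrier R) →
    (∀ a b → CommutativeRing._≈_ R
    (CommutativeRing._*_ R (CommutativeRing._-_ R q (CommutativeRing.1# R)) a)
    (CommutativeRing._*_ R (CommutativeRing._-_ R q (CommutativeRing.1# R)) b)
    → CommutativeRing._≈_ R a b) →
    (m : ℕ) (κ : Subset (suc m) → CommutativeRing.Carrier R) →
    Poly.IsCumulant R q N x (suc m) κ →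
    CommutativeRing._≈_ R (κ ⊤)
    (Poly.sumR R q N x (map (λ T → Poly.LLT R q N x (νTree m T)) (cayleyTrees (suc m))))
    × CommutativeRing._≈_ R (κ ⊤)
    (Poly.sumR R q N x (map (λ f → Poly.LLTμ R q N x (suc m) (schröderOf m f)) (parkingFunctions m)))
theorem1p1 R q N x reg m κ isκ =
    trans (cumulant≈bfsSum m κ reg isκ) (sym (treeSum≈bfsSum m))
  , trans (cumulant≈bfsSum m κ reg isκ) (sym (parkingSum≈ m))
  where
  open CommutativeRing R
  open Theorem R q N x
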